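{- For every admissible index $i$ (i.e. $1\le i\le n$ if $s>n-1$, and $2\le i\le n$ if $s=n-1$), the irreducible component $K^i$ of $Y$ is given by \[ K^i=\{V_\bullet\in \mathrm{Fl}(1^n,s-1)\ \mid\ V_{i-1}\subseteq \mathrm{im}(x)\subseteq V_n\subseteq x^{ -1}V_{i-1}\}, \] where $x^{ -1}V_{i-1}$ denotes the preimage of $V_{i-1}$ under the linear map $x$.
   Context: Fix integers $n\ge 2$ and $s\ge n-1$, let $N=n+s-1$, and let $e_1,\dots,e_N$ be the standard basis of $\mathbb{C}^N$. Let $x:\mathbb{C}^N\to\mathbb{C}^N$ be the linear map with $xe_m=e_{m-(n-1)}$ for $n\le m\le 2n-2$ and $xe_m=0$ otherwise; thus $\mathrm{im}(x)=\mathrm{span}(e_1,\dots,e_{n-1})$ and $x$ is nilpotent of Jordan type $(2^{n-1},1^{s-n+1})$. Let $\mathrm{Fl}(1^n,s-1)$ be the variety of partial flags $V_\bullet=(0=V_0\subset V_1\subset\cdots\subset V_n\subset\mathbb{C}^N)$ with $\dim V_j=j$. The $\Delta$-Springer fiber is the closed subvariety $Y=Y_{n,(1^{n-1}),s}=\{V_\bullet\in\mathrm{Fl}(1^n,s-1)\mid \mathrm{im}(x)\subseteq V_n,\ xV_j\subseteq V_j \text{ for all } j\}$. For a sequence $w=(w_1,\dots,w_n)$ of distinct elements of $\{1,\dots,N\}$, the Schubert cell $X_w^\circ\subseteq \mathrm{Fl}(1^n,s-1)$ is the set of flags with $\dim(V_j\cap\mathrm{span}(e_1,\dots,e_m))=\#\{l\le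 j: w_l\le m\}$ for all $j,m$. For an admissible $i$ (namely $1\le i\le n$ if $s>n-1$, and $2\le i\le n$ if $s=n-1$) put $w^{(i)}=(n-1,n-2,\dots,n-i+1,\,N,\,n-i,n-i-1,\dots,1)$ and define $K^i$ to be the closure in $Y$ of $X^\circ_{w^{(i)}}\cap Y$. (It is known that these $K^i$ are exactly the irreducible components of $Y$, and that $Y$ has dimension $\binom{n-1}{2}+(s-1)$.) -}

module Defs where

open import Algebra.Bundles using (RawRing)
open import Data.Bool.Base using (if_then_else_)
open import Data.Fin.Base using (Fin; toℕ; fromℕ; inject₁; inject!)
open import Data.List.Base using (length; filter; allFin)
open import Data.Nat.Base as ℕ using (ℕ; suc; _∸_)
import Data.Nat.Properties as ℕ
open import Data.Product.Base using (∃; _×_; _,_)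
open import Data.Rational.Base as ℚ using (ℚ; 0ℚ; 1ℚ; ½)
import Data.Rational.Properties as ℚ
open import Data.Rational.Solver using (module +-*-Solver)
open import Data.Sum.Base using (_⊎_)
open import Data.Vec.Functional using (Vector)
open import Function.Bundles using (_⇔_)
open import Level using (0ℓ) renaming (suc to lsuc)
open import Relation.Binary.Definitions using (tri<; tri≈; tri>)
open import Relation.Binary.PropositionalEquality
open import Relation.Nullary.Decidable using (⌊_⌋; _×-dec_)
open import Relation.Unary using (Pred; _⊆_; _∩_; _≐_; _⊢_)

-- Real numbers are Cauchy sequences of rationals; two are equal (_≈ᴿ_) when
-- their difference is a null sequence.
Cauchy : Pred (ℕ → ℚ) 0ℓ
Cauchy u = ∀ ε → 0ℚ ℚ.< ε →
  ∃ λ k → ∀ m n → k ℕ.≤ m → k ℕ.≤ n → ℚ.∣ u m ℚ.- u n ∣ ℚ.< ε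

record ℝ : Set where
  constructor mkℝ
  field
    seq    : ℕ → ℚ
    cauchy : Cauchy seq

open ℝ public

infix 4 _≈ᴿ_

record _≈ᴿ_ (x y : ℝ) : Set where
  constructor mk≈ᴿ
  field
    null : ∀ ε → 0ℚ ℚ.< ε →
      ∃ λ k → ∀ m → k ℕ.≤ m → ℚ.∣ seq x m ℚ.- seq y m ∣ ℚ.< ε

open _≈ᴿ_ public

private
  half-pos : ∀ ε → 0ℚ ℚ.< ε → 0ℚ ℚ.< ½ ℚ.* ε
  half-pos ε ε>0 = ℚ.positive⁻¹ (½ ℚ.* ε) {{ℚ.pos*pos⇒pos ½ ε {{ε⁺}}}}
    where ε⁺ = ℚ.positive ε>0

  halves : ∀ ε → ½ ℚ.* ε ℚ.+ ½ ℚ.* ε ≡ ε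
  halves ε = trans (sym (ℚ.*-distribʳ-+ ε ½ ½)) (ℚ.*-identityˡ ε)

  const-cauchy : ∀ q → Cauchy (λ _ → q)
  const-cauchy q ε ε>0 = 0 , λ _ _ _ _ →
    subst (ℚ._< ε) (sym (cong ℚ.∣_∣ (ℚ.+-inverseʳ q))) ε>0

  neg-cauchy : ∀ u → Cauchy u → Cauchy (λ m → ℚ.- u m)
  neg-cauchy u cu ε ε>0 with k , h ← cu ε ε>0 = k , λ m n k≤m k≤n →
    subst (ℚ._< ε)
      (trans (sym (ℚ.∣-p∣≡∣p∣ (u m ℚ.- u n)))
             (cong ℚ.∣_∣ (ℚ.neg-distrib-+ (u m) (ℚ.- u n))))
      (h m n k≤m k≤n)

  +-cauchy : ∀ u v → Cauchy u → Cauchy v → Cauchy (λ m → u m ℚ.+ v m)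
  +-cauchy u v cu cv ε ε>0
    with k , h ← cu (½ ℚ.* ε) (half-pos ε ε>0)
       | l , g ← cv (½ ℚ.* ε) (half-pos ε ε>0) = k ℕ.⊔ l , λ m n p q →
    let open ℚ.≤-Reasoning in begin-strict
      ℚ.∣ (u m ℚ.+ v m) ℚ.- (u n ℚ.+ v n) ∣
        ≡⟨ cong ℚ.∣_∣ (solve 4 (λ a b c d →
             (a :+ b) :- (c :+ d) := (a :- c) :+ (b :- d)) refl (u m) (v m) (u n) (v n)) ⟩
      ℚ.∣ (u m ℚ.- u n) ℚ.+ (v m ℚ.- v n) ∣
        ≤⟨ ℚ.∣p+q∣≤∣p∣+∣q∣ (u m ℚ.- u n) (v m ℚ.- v n) ⟩
      ℚ.∣ u m ℚ.- u n ∣ ℚ.+ ℚ.∣ v m ℚ.- v n ∣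
        <⟨ ℚ.+-mono-< (h m n (ℕ.m⊔n≤o⇒m≤o k l p) (ℕ.m⊔n≤o⇒m≤o k l q))
                      (g m n (ℕ.m⊔n≤o⇒n≤o k l p) (ℕ.m⊔n≤o⇒n≤o k l q)) ⟩
      ½ ℚ.* ε ℚ.+ ½ ℚ.* ε
        ≡⟨ halves ε ⟩
      ε ∎
    where open +-*-Solver

  eventually-bounded : ∀ u → Cauchy u →
    ∃ λ B → 0ℚ ℚ.< B × ∃ λ k → ∀ m → k ℕ.≤ m → ℚ.∣ u m ∣ ℚ.≤ B
  eventually-bounded u cu with k , h ← cu 1ℚ (ℚ.positive⁻¹ 1ℚ) =
    1ℚ ℚ.+ ℚ.∣ u k ∣ ,
    ℚ.+-mono-<-≤ (ℚ.positive⁻¹ 1ℚ) (ℚ.0≤∣p∣ (u k)) ,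
    k , λ m k≤m →
    let open ℚ.≤-Reasoning in begin
      ℚ.∣ u m ∣
        ≡⟨ cong ℚ.∣_∣ (solve 2 (λ a b → a := (a :- b) :+ b) refl (u m) (u k)) ⟩
      ℚ.∣ (u m ℚ.- u k) ℚ.+ u k ∣
        ≤⟨ ℚ.∣p+q∣≤∣p∣+∣q∣ (u m ℚ.- u k) (u k) ⟩
      ℚ.∣ u m ℚ.- u k ∣ ℚ.+ ℚ.∣ u k ∣
        ≤⟨ ℚ.+-monoˡ-≤ ℚ.∣ u k ∣ (ℚ.<⇒≤ (h m k k≤m ℕ.≤-refl)) ⟩
      1ℚ ℚ.+ ℚ.∣ u k ∣ ∎
    where open +-*-Solver

  -- δ with B * δ ≡ ε
  scaled : ∀ B ε → 0ℚ ℚ.< B → 0ℚ ℚ.< ε → ∃ λ δ → 0ℚ ℚ.< δ × B ℚ.* δ ≡ ε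
  scaled B ε B>0 ε>0 =
    B⁻¹ ℚ.* ε ,
    ℚ.positive⁻¹ (B⁻¹ ℚ.* ε) {{ℚ.pos*pos⇒pos B⁻¹ {{ℚ.1/pos⇒pos B}} ε {{ℚ.positive ε>0}}}} ,
    trans (sym (ℚ.*-assoc B B⁻¹ ε)) (trans (cong (ℚ._* ε) (ℚ.*-inverseʳ B)) (ℚ.*-identityˡ ε))
    where
    instance
      B⁺ = ℚ.positive B>0
      B≢0 = ℚ.pos⇒nonZero B
    B⁻¹ = ℚ.1/ B

  bounded*small : ∀ {B p q δ} → 0ℚ ℚ.< B → ℚ.∣ p ∣ ℚ.≤ B → ℚ.∣ q ∣ ℚ.< δ →
    ℚ.∣ p ℚ.* q ∣ ℚ.< B ℚ.* δ
  bounded*small {B} {p} {q} {δ} B>0 p≤B q<δ = let open ℚ.≤-Reasoning in begin-strict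
    ℚ.∣ p ℚ.* q ∣          ≡⟨ ℚ.∣p*q∣≡∣p∣*∣q∣ p q ⟩
    ℚ.∣ p ∣ ℚ.* ℚ.∣ q ∣    ≤⟨ ℚ.*-monoʳ-≤-nonNeg ℚ.∣ q ∣ {{ℚ.nonNegative (ℚ.0≤∣p∣ q)}} p≤B ⟩
    B ℚ.* ℚ.∣ q ∣          <⟨ ℚ.*-monoʳ-<-pos B {{ℚ.positive B>0}} q<δ ⟩
    B ℚ.* δ                ∎

  *-close : ∀ {B C δ η a b c d} → 0ℚ ℚ.< B → 0ℚ ℚ.< C →
    ℚ.∣ a ∣ ℚ.≤ B → ℚ.∣ b ℚ.- d ∣ ℚ.< δ → ℚ.∣ d ∣ ℚ.≤ C → ℚ.∣ a ℚ.- c ∣ ℚ.< η →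
    ℚ.∣ a ℚ.* b ℚ.- c ℚ.* d ∣ ℚ.< B ℚ.* δ ℚ.+ C ℚ.* η
  *-close {B} {C} {δ} {η} {a} {b} {c} {d} B>0 C>0 a≤B bd<δ d≤C ac<η =
    let open ℚ.≤-Reasoning in begin-strict
      ℚ.∣ a ℚ.* b ℚ.- c ℚ.* d ∣
        ≡⟨ cong ℚ.∣_∣ (solve 4 (λ a b c d →
             a :* b :- c :* d := a :* (b :- d) :+ d :* (a :- c)) refl a b c d) ⟩
      ℚ.∣ a ℚ.* (b ℚ.- d) ℚ.+ d ℚ.* (a ℚ.- c) ∣
        ≤⟨ ℚ.∣p+q∣≤∣p∣+∣q∣ (a ℚ.* (b ℚ.- d)) (d ℚ.* (a ℚ.- c)) ⟩
      ℚ.∣ a ℚ.* (b ℚ.- d) ∣ ℚ.+ ℚ.∣ d ℚ.* (a ℚ.- c) ∣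
        <⟨ ℚ.+-mono-< (bounded*small {B} {a} {b ℚ.- d} B>0 a≤B bd<δ)
                      (bounded*small {C} {d} {a ℚ.- c} C>0 d≤C ac<η) ⟩
      B ℚ.* δ ℚ.+ C ℚ.* η ∎
    where open +-*-Solver

  *-cauchy : ∀ u v → Cauchy u → Cauchy v → Cauchy (λ m → u m ℚ.* v m)
  *-cauchy u v cu cv ε ε>0 = bound (eventually-bounded u cu) (eventually-bounded v cv)
    where
    Bounded : (ℕ → ℚ) → ℚ → ℕ → Set
    Bounded t B k = ∀ m → k ℕ.≤ m → ℚ.∣ t m ∣ ℚ.≤ B

    Close : (ℕ → ℚ) → ℚ → ℕ → Set
    Close t δ k = ∀ m n → k ℕ.≤ m → k ℕ.≤ n → ℚ.∣ t m ℚ.- t n ∣ ℚ.< δ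

    combine : ∀ B C δ η → 0ℚ ℚ.< B → 0ℚ ℚ.< C → B ℚ.* δ ≡ ½ ℚ.* ε → C ℚ.* η ≡ ½ ℚ.* ε →
      (∃ λ i → Bounded u B i) → (∃ λ j → Bounded v C j) →
      (∃ λ k → Close u η k) → (∃ λ l → Close v δ l) →
      ∃ λ k → Close (λ m → u m ℚ.* v m) ε k
    combine B C δ η B>0 C>0 Bδ≡ Cη≡ (i , uB) (j , vC) (k , h) (l , g) =
      (i ℕ.⊔ j) ℕ.⊔ (k ℕ.⊔ l) , λ m n p q →
        subst (ℚ.∣ u m ℚ.* v m ℚ.- u n ℚ.* v n ∣ ℚ.<_)
          (trans (cong₂ ℚ._+_ Bδ≡ Cη≡) (halves ε))
          (*-close {B} {C} {δ} {η} {u m} {v m} {u n} {v n} B>0 C>0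
            (uB m (i≤ p)) (g m n (l≤ p) (l≤ q)) (vC n (j≤ q)) (h m n (k≤ p) (k≤ q)))
      where
      M = (i ℕ.⊔ j) ℕ.⊔ (k ℕ.⊔ l)
      i≤ : ∀ {o} → M ℕ.≤ o → i ℕ.≤ o
      i≤ p = ℕ.m⊔n≤o⇒m≤o i j (ℕ.m⊔n≤o⇒m≤o (i ℕ.⊔ j) (k ℕ.⊔ l) p)
      j≤ : ∀ {o} → M ℕ.≤ o → j ℕ.≤ o
      j≤ p = ℕ.m⊔n≤o⇒n≤o i j (ℕ.m⊔n≤o⇒m≤o (i ℕ.⊔ j) (k ℕ.⊔ l) p)
      k≤ : ∀ {o} → M ℕ.≤ o → k ℕ.≤ o
      k≤ p = ℕ.m⊔n≤o⇒m≤o k l (ℕ.m⊔n≤o⇒n≤o (i ℕ.⊔ j) (k ℕ.⊔ l) p)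
      l≤ : ∀ {o} → M ℕ.≤ o → l ℕ.≤ o
      l≤ p = ℕ.m⊔n≤o⇒n≤o k l (ℕ.m⊔n≤o⇒n≤o (i ℕ.⊔ j) (k ℕ.⊔ l) p)

    bound : (∃ λ B → 0ℚ ℚ.< B × ∃ λ i → Bounded u B i) →
            (∃ λ C → 0ℚ ℚ.< C × ∃ λ j → Bounded v C j) →
            ∃ λ k → Close (λ m → u m ℚ.* v m) ε k
    bound (B , B>0 , uB) (C , C>0 , vC) =
      rescale (scaled B (½ ℚ.* ε) B>0 ε/2>0) (scaled C (½ ℚ.* ε) C>0 ε/2>0)
      where
      ε/2>0 = half-pos ε ε>0
      rescale : (∃ λ δ → 0ℚ ℚ.< δ × B ℚ.* δ ≡ ½ ℚ.* ε) →
                (∃ λ η → 0ℚ ℚ.< η × C ℚ.* η ≡ ½ ℚ.* ε) →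
                ∃ λ k → Close (λ m → u m ℚ.* v m) ε k
      rescale (δ , δ>0 , Bδ≡) (η , η>0 , Cη≡) =
        combine B C δ η B>0 C>0 Bδ≡ Cη≡ uB vC (cu η η>0) (cv δ δ>0)

infixl 6 _+ᴿ_
infixl 7 _*ᴿ_
infix  8 -ᴿ_

-- Opaque only so that Agda does not expand rational arithmetic when it
-- normalises; `unfolding` recovers these definitions.
opaque
  _+ᴿ_ _*ᴿ_ : ℝ → ℝ → ℝ
  x +ᴿ y = mkℝ (λ m → seq x m ℚ.+ seq y m) (+-cauchy (seq x) (seq y) (cauchy x) (cauchy y))
  x *ᴿ y = mkℝ (λ m → seq x m ℚ.* seq y m) (*-cauchy (seq x) (seq y) (cauchy x) (cauchy y))

  -ᴿ_ : ℝ → ℝ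
  -ᴿ x = mkℝ (λ m → ℚ.- seq x m) (neg-cauchy (seq x) (cauchy x))

  0ᴿ 1ᴿ : ℝ
  0ᴿ = mkℝ (λ _ → 0ℚ) (const-cauchy 0ℚ)
  1ᴿ = mkℝ (λ _ → 1ℚ) (const-cauchy 1ℚ)

record ℂ : Set where
  constructor _+i_
  field
    re im : ℝ

open ℂ public

infix 4 _≈ᶜ_

record _≈ᶜ_ (z w : ℂ) : Set where
  constructor mk≈ᶜ
  field
    re≈ : re z ≈ᴿ re w
    im≈ : im z ≈ᴿ im w

open _≈ᶜ_ public

ℂ-rawRing : RawRing 0ℓ 0ℓ
ℂ-rawRing = record
  { Carrier = ℂ
  ; _≈_     = _≈ᶜ_
  ; _+_     = λ z w → (re z +ᴿ re w) +i (im z +ᴿ im w)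
  ; _*_     = λ z w → (re z *ᴿ re w +ᴿ -ᴿ (im z *ᴿ im w)) +i (re z *ᴿ im w +ᴿ im z *ᴿ re w)
  ; -_      = λ z → (-ᴿ re z) +i (-ᴿ im z)
  ; 0#      = 0ᴿ +i 0ᴿ
  ; 1#      = 1ᴿ +i 0ᴿ
  }

open RawRing ℂ-rawRing using (_≈_; _+_; _*_; 0#; 1#; +-rawMonoid)
open import Algebra.Definitions.RawMonoid +-rawMonoid using (sum)

infix 4 _≈ᵥ_

_≈ᵥ_ : ∀ {N} → Vector ℂ N → Vector ℂ N → Set
v ≈ᵥ w = ∀ k → v k ≈ w k

linearCombination : ∀ {d N} → Vector ℂ d → Vector (Vector ℂ N) d → Vector ℂ N
linearCombination c b k = sum λ l → c l * b l k

LinearlyIndependent : ∀ {d N} → Vector (Vector ℂ N) d → Set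
LinearlyIndependent b =
  ∀ c → linearCombination c b ≈ᵥ (λ _ → 0#) → ∀ l → c l ≈ 0#

Span : ∀ {d N} → Vector (Vector ℂ N) d → Pred (Vector ℂ N) 0ℓ
Span b v = ∃ λ c → v ≈ᵥ linearCombination c b

-- "U is a linear subspace of dimension d": U is the span of d linearly
-- independent vectors.
HasDim : ∀ {N} → Pred (Vector ℂ N) 0ℓ → ℕ → Set
HasDim {N} U d = ∃ λ (b : Vector (Vector ℂ N) d) → LinearlyIndependent b × U ≐ Span b

-- Indices in the mathematics start at 1.
pos : ∀ {n} → Fin n → ℕ
pos i = suc (toℕ i)

-- e m is the m-th standard basis vector, for 1 ≤ m ≤ N.
e : ∀ {N} → ℕ → Vector ℂ N
e m k = if pos k ℕ.≡ᵇ m then 1# else 0#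

-- ⟨e₁,…,eₘ⟩
span-e : ∀ {N} → ℕ → Pred (Vector ℂ N) 0ℓ
span-e m = Span λ (k : Fin m) → e (pos k)

-- A point of Fl(1ⁿ, N - n): space j is Vⱼ, and the constraint dim V₀ = 0 says V₀ = 0.
record Flag (n N : ℕ) : Set₁ where
  field
    space  : Fin (suc n) → Pred (Vector ℂ N) 0ℓ
    nested : ∀ (j : Fin n) → space (inject₁ j) ⊆ space (Fin.suc j)
    dim    : ∀ j → HasDim (space j) (toℕ j)

open Flag public

-- A is a frame of V when Vⱼ = ⟨A₁,…,Aⱼ⟩ for all j.
IsFrame : ∀ {n N} → Vector (Vector ℂ N) n → Flag n N → Set
IsFrame A V = LinearlyIndependent A × (∀ j → space V j ≐ Span (λ l → A (inject! {i = j} l)))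

data Polynomial (X : Set) : Set where
  con       : ℂ → Polynomial X
  var       : X → Polynomial X
  _:+_ _:*_ : Polynomial X → Polynomial X → Polynomial X

⟦_⟧ : ∀ {X} → Polynomial X → (X → ℂ) → ℂ
⟦ con c ⟧  ρ = c
⟦ var x ⟧  ρ = ρ x
⟦ p :+ q ⟧ ρ = ⟦ p ⟧ ρ + ⟦ q ⟧ ρ
⟦ p :* q ⟧ ρ = ⟦ p ⟧ ρ * ⟦ q ⟧ ρ

-- The flag variety is the quotient of the variety of frames (an open
-- subset of the space of n-tuples of vectors) by the group of invertible
-- triangular matrices, and its Zariski topology is the quotient topology:
-- Z is closed iff the frames of its members are cut out, among all frames,
-- by a set F of polynomials in the n·N coordinates.
ZariskiClosed : ∀ {n N} → Pred (Flag n N) 0ℓ → Set₁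
ZariskiClosed {n} {N} Z =
  ∃ λ (F : Pred (Polynomial (Fin n × Fin N)) 0ℓ) →
    ∀ V A → IsFrame A V →
      Z V ⇔ (∀ f → F f → ⟦ f ⟧ (λ { (l , k) → A l k }) ≈ 0#)

-- Closure of S in the subspace Y.
ClosureIn : ∀ {n N} → Pred (Flag n N) 0ℓ → Pred (Flag n N) 0ℓ → Pred (Flag n N) (lsuc 0ℓ)
ClosureIn Y S V = Y V × (∀ Z → ZariskiClosed Z → S ⊆ Z → Z V)

-- #{ l ≤ j : w_l ≤ m }
count : ∀ {n} → Vector ℕ n → ℕ → ℕ → ℕ
count {n} w j m = length (filter (λ l → (pos l ℕ.≤? j) ×-dec (w l ℕ.≤? m)) (allFin n))

SchubertCell : ∀ {n N} → Vector ℕ n → Pred (Flag n N) 0ℓ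
SchubertCell {n} {N} w V =
  ∀ (j : Fin (suc n)) m → m ℕ.≤ N → HasDim (space V j ∩ span-e m) (count w (toℕ j) m)

module ΔSpringer (n s : ℕ) where

  N : ℕ
  N = n ℕ.+ s ∸ 1

  -- x e_m; note that e (m ∸ (n ∸ 1)) is a genuine basis vector for n ≤ m.
  x-basis : ℕ → Vector ℂ N
  x-basis m =
    if ⌊ (n ℕ.≤? m) ×-dec (m ℕ.≤? 2 ℕ.* n ∸ 2) ⌋
    then e (m ∸ (n ∸ 1))
    else (λ _ → 0#)

  x : Vector ℂ N → Vector ℂ N
  x v = linearCombination v (λ m → x-basis (pos m))

  im-x : Pred (Vector ℂ N) 0ℓ
  im-x w = ∃ λ v → w ≈ᵥ x v

  Y : Pred (Flag n N) 0ℓ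
  Y V = im-x ⊆ space V (fromℕ n) × (∀ j → space V j ⊆ x ⊢ space V j)

  -- i : Fin n stands for the index pos i, so 1 ≤ pos i ≤ n is automatic.
  Admissible : Fin n → Set
  Admissible i = (n ∸ 1 ℕ.< s) ⊎ (s ≡ n ∸ 1 × 2 ℕ.≤ pos i)

  -- w⁽ⁱ⁾ = (n-1, …, n-i+1, N, n-i, …, 1)
  w⟨_⟩ : Fin n → Vector ℕ n
  w⟨ i ⟩ l with ℕ.<-cmp (pos l) (pos i)
  ... | tri< _ _ _ = n ∸ pos l
  ... | tri≈ _ _ _ = N
  ... | tri> _ _ _ = suc n ∸ pos l

  K : Fin n → Pred (Flag n N) (lsuc 0ℓ)
  K i = ClosureIn Y (SchubertCell w⟨ i ⟩ ∩ Y)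

-- In K^i the flag satisfies V_{i-1} ⊆ im(x) and x(V_n) ⊆ V_{i-1} because on the cell
-- V_i = V_{i-1} + ⟨v⟩ with v ∉ im(x), V_i ∩ im(x) = V_{i-1} and V_n = im(x) + ⟨v⟩;
-- these conditions are closed. Conversely, the frames of the flags
-- satisfying V_{i-1} ⊆ im(x) ⊆ V_n ⊆ x⁻¹V_{i-1} are the independent tuples
-- A_l = u_l + d_l v with u_l ∈ im(x), d_l = 0 for l < i and xv ∈ ⟨u_1,…,u_{i-1}⟩.
-- Such tuples are parametrised by an affine space, so any of them is joined by a
-- polynomial curve A(t) to the coordinate frame (e_{w_1},…,e_{w_n}). Elimination in
-- the pivot columns w_1,…,w_n succeeds on that frame, hence at all but finitely many
-- t, and wherever it succeeds A(t) spans a flag of the cell. A polynomial vanishing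
-- on the frames of the cell therefore vanishes along the whole curve.
module Submission where

open import Algebra.Bundles using (CommutativeRing; RawRing)
open import Axiom.ExcludedMiddle using (ExcludedMiddle)
open import Data.Bool.Base using (true; false; if_then_else_)
open import Data.Fin.Base as Fin using (Fin; zero; suc; toℕ; fromℕ; fromℕ<; inject₁; inject!; punchIn)
import Data.Fin.Induction as Fin
import Data.Fin.Properties as Fin
open import Data.List.Base as List using (List; length; filter; allFin; tabulate)
open import Data.Nat.Base as ℕ using (ℕ; zero; suc; z≤n; s≤s)
import Data.Nat.Properties as ℕ
open import Data.Product.Base using (∃; _×_; _,_; proj₁; proj₂)
open import Data.Sum.Base using (_⊎_; inj₁; inj₂)
open import Data.Vec.Functional using (Vector; removeAt; foldr)
open import Function.Base using (_∘_)
open import Function.Bundles using (_⇔_; mk⇔; Equivalence)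
open import Function.Definitions using (Injective)
open import Induction.WellFounded using (Acc; acc)
open import Level using (0ℓ)
open import Relation.Binary.Definitions using (tri<; tri≈; tri>)
open import Relation.Binary.PropositionalEquality as ≡ using (_≡_; _≢_)
open import Relation.Nullary using (Dec; yes; no; does; ¬_; contradiction)
open import Relation.Nullary.Decidable using (_×-dec_; decidable-stable; dec-true)
open import Relation.Unary using (Pred; Decidable; _⊆_; _≐_; _∩_; _⊢_)

-- The condition that xv lies in the span of u_1,...,u_{i-1} is not linear in the pair (u, v), so a
-- straight segment between two such tuples may leave the set. What moves linearly instead are the
-- coefficients c of xv in the u_l. Since x has an explicit section `lift` over im(x), v is
-- recovered as lift(sum of c_l u_l) plus a vector of ker(x), which also moves linearly. This
-- replaces any appeal to irreducibility or to the dimension of Y. Membership in the cell must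
-- follow from the nonvanishing of a single polynomial. The shape of w^(i) makes this possible:
-- apart from N its entries descend through n-1,...,1, so when a row is reached, every column of
-- im(x) to the right of its pivot has already been cleared by earlier rows. Nonzero pivots then
-- determine all the dimensions that the cell prescribes. Equality of Cauchy reals is undecidable,
-- so excluded middle supplies inverses, pivots, roots and vectors outside a subspace.

-- The field of complex numbers

module ComplexNumbers where

  open import Data.Integer.Base as ℤ using (+_)
  import Data.Nat.Coprimality as Coprime
  open import Data.Rational.Base as ℚ using (ℚ; 0ℚ; 1ℚ; ½; mkℚ)
  import Data.Rational.Properties as ℚ
  open import Algebra.Properties.Group ℚ.+-0-group using (x∙y⁻¹≈ε⇒x≈y)
  open import Data.Rational.Solver using (module +-*-Solver)
  open import Defs
  open import Relation.Binary.PropositionalEquality using (refl; sym; trans; cong; cong₂; subst)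
  open +-*-Solver using (solve; _:=_; :-_; _:-_) renaming (_:+_ to _⊕_; _:*_ to _⊗_)

  Null : (ℕ → ℚ) → Set
  Null u = ∀ ε → 0ℚ ℚ.< ε → ∃ λ k → ∀ m → k ℕ.≤ m → ℚ.∣ u m ∣ ℚ.< ε

  ½-pos : ∀ {ε} → 0ℚ ℚ.< ε → 0ℚ ℚ.< ½ ℚ.* ε
  ½-pos {ε} ε>0 = ℚ.positive⁻¹ (½ ℚ.* ε) {{ℚ.pos*pos⇒pos ½ ε {{ℚ.positive ε>0}}}}

  ½+½ : ∀ ε → ½ ℚ.* ε ℚ.+ ½ ℚ.* ε ≡ ε
  ½+½ ε = trans (sym (ℚ.*-distribʳ-+ ε ½ ½)) (ℚ.*-identityˡ ε)

  <⇒≱ : ∀ {p q} → p ℚ.< q → ¬ q ℚ.≤ p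
  <⇒≱ p<q q≤p = ℚ.<-irrefl refl (ℚ.<-≤-trans p<q q≤p)

  *-pos : ∀ p q → 0ℚ ℚ.< p → 0ℚ ℚ.< q → 0ℚ ℚ.< p ℚ.* q
  *-pos p q p>0 q>0 =
    ℚ.positive⁻¹ (p ℚ.* q) {{ℚ.pos*pos⇒pos p {{ℚ.positive p>0}} q {{ℚ.positive q>0}}}}

  null-resp : ∀ {u v} → (∀ m → u m ≡ v m) → Null u → Null v
  null-resp u≗v nu ε ε>0 with k , h ← nu ε ε>0 =
    k , λ m k≤m → subst (λ q → ℚ.∣ q ∣ ℚ.< ε) (u≗v m) (h m k≤m)

  null-0 : ∀ {u} → (∀ m → u m ≡ 0ℚ) → Null u
  null-0 u≗0 ε ε>0 = 0 , λ m _ → subst (λ q → ℚ.∣ q ∣ ℚ.< ε) (sym (u≗0 m)) ε>0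

  null-+ : ∀ {u v : ℕ → ℚ} → Null u → Null v → Null (λ m → u m ℚ.+ v m)
  null-+ {u} {v} nu nv ε ε>0
    with k , h ← nu (½ ℚ.* ε) (½-pos ε>0) | l , g ← nv (½ ℚ.* ε) (½-pos ε>0) =
    k ℕ.⊔ l , λ m p → ℚ.≤-<-trans (ℚ.∣p+q∣≤∣p∣+∣q∣ (u m) (v m))
      (subst (ℚ.∣ u m ∣ ℚ.+ ℚ.∣ v m ∣ ℚ.<_) (½+½ ε)
        (ℚ.+-mono-< (h m (ℕ.m⊔n≤o⇒m≤o k l p)) (g m (ℕ.m⊔n≤o⇒n≤o k l p))))

  null-neg : ∀ {u} → Null u → Null (λ m → ℚ.- u m)
  null-neg {u} nu ε ε>0 with k , h ← nu ε ε>0 =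
    k , λ m k≤m → subst (ℚ._< ε) (sym (ℚ.∣-p∣≡∣p∣ (u m))) (h m k≤m)

  cauchy-bounded : ∀ {u} → Cauchy u →
    ∃ λ B → 0ℚ ℚ.< B × ∃ λ k → ∀ m → k ℕ.≤ m → ℚ.∣ u m ∣ ℚ.≤ B
  cauchy-bounded {u} cu with k , h ← cu 1ℚ (ℚ.positive⁻¹ 1ℚ) =
    1ℚ ℚ.+ ℚ.∣ u k ∣ ,
    ℚ.+-mono-<-≤ (ℚ.positive⁻¹ 1ℚ) (ℚ.0≤∣p∣ (u k)) ,
    k , λ m k≤m →
    let open ℚ.≤-Reasoning in begin
      ℚ.∣ u m ∣
        ≡⟨ cong ℚ.∣_∣ (solve 2 (λ a b → a := (a :- b) ⊕ b) refl (u m) (u k)) ⟩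
      ℚ.∣ (u m ℚ.- u k) ℚ.+ u k ∣
        ≤⟨ ℚ.∣p+q∣≤∣p∣+∣q∣ (u m ℚ.- u k) (u k) ⟩
      ℚ.∣ u m ℚ.- u k ∣ ℚ.+ ℚ.∣ u k ∣
        ≤⟨ ℚ.+-monoˡ-≤ ℚ.∣ u k ∣ (ℚ.<⇒≤ (h m k k≤m ℕ.≤-refl)) ⟩
      1ℚ ℚ.+ ℚ.∣ u k ∣ ∎

  solve-*-pos : ∀ B ε → 0ℚ ℚ.< B → 0ℚ ℚ.< ε → ∃ λ δ → 0ℚ ℚ.< δ × B ℚ.* δ ≡ ε
  solve-*-pos B ε B>0 ε>0 = B⁻¹ ℚ.* ε ,
    *-pos B⁻¹ ε (ℚ.positive⁻¹ B⁻¹ {{ℚ.1/pos⇒pos B}}) ε>0 ,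
    trans (sym (ℚ.*-assoc B B⁻¹ ε)) (trans (cong (ℚ._* ε) (ℚ.*-inverseʳ B)) (ℚ.*-identityˡ ε))
    where
    instance
      B⁺ = ℚ.positive B>0
      B≢0 = ℚ.pos⇒nonZero B
    B⁻¹ = ℚ.1/ B

  -- A Cauchy sequence is eventually bounded by some B > 0, so it suffices to take the null factor
  -- below ε / B.
  null-* : ∀ {u v} → Cauchy u → Null v → Null (λ m → u m ℚ.* v m)
  null-* {u} {v} cu nv ε ε>0 = let
    B , B>0 , k , bd = cauchy-bounded {u} cu
    δ , δ>0 , Bδ≡ε = solve-*-pos B ε B>0 ε>0
    l , h = nv δ δ>0
    open ℚ.≤-Reasoning
    in k ℕ.⊔ l , λ m p → begin-strict
      ℚ.∣ u m ℚ.* v m ∣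
        ≡⟨ ℚ.∣p*q∣≡∣p∣*∣q∣ (u m) (v m) ⟩
      ℚ.∣ u m ∣ ℚ.* ℚ.∣ v m ∣
        ≤⟨ ℚ.*-monoʳ-≤-nonNeg ℚ.∣ v m ∣ {{ℚ.nonNegative (ℚ.0≤∣p∣ (v m))}}
             (bd m (ℕ.m⊔n≤o⇒m≤o k l p)) ⟩
      B ℚ.* ℚ.∣ v m ∣
        <⟨ ℚ.*-monoʳ-<-pos B {{ℚ.positive B>0}} (h m (ℕ.m⊔n≤o⇒n≤o k l p)) ⟩
      B ℚ.* δ
        ≡⟨ Bδ≡ε ⟩
      ε ∎

  pointwise : ∀ {x y} → (∀ m → seq x m ≡ seq y m) → x ≈ᴿ y
  pointwise {x} {y} x≗y = mk≈ᴿ (null-0 λ m →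
    trans (cong (ℚ._- seq y m) (x≗y m)) (ℚ.+-inverseʳ (seq y m)))

  ≈ᴿ-refl : ∀ {x} → x ≈ᴿ x
  ≈ᴿ-refl = pointwise λ _ → refl

  ≈ᴿ-sym : ∀ {x y} → x ≈ᴿ y → y ≈ᴿ x
  ≈ᴿ-sym {x} {y} (mk≈ᴿ p) = mk≈ᴿ (null-resp
    (λ m → solve 2 (λ a b → :- (a :- b) := b :- a) refl (seq x m) (seq y m)) (null-neg p))

  ≈ᴿ-trans : ∀ {x y z} → x ≈ᴿ y → y ≈ᴿ z → x ≈ᴿ z
  ≈ᴿ-trans {x} {y} {z} (mk≈ᴿ p) (mk≈ᴿ q) = mk≈ᴿ (null-resp
    (λ m → solve 3 (λ a b c → (a :- b) ⊕ (b :- c) := a :- c) refl (seq x m) (seq y m) (seq z m))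
    (null-+ p q))

  opaque
    unfolding _+ᴿ_

    +ᴿ-cong : ∀ {x y u v} → x ≈ᴿ y → u ≈ᴿ v → x +ᴿ u ≈ᴿ y +ᴿ v
    +ᴿ-cong {x} {y} {u} {v} (mk≈ᴿ p) (mk≈ᴿ q) = mk≈ᴿ (null-resp
      (λ m → solve 4 (λ a b c d → (a :- b) ⊕ (c :- d) := (a ⊕ c) :- (b ⊕ d)) refl
        (seq x m) (seq y m) (seq u m) (seq v m))
      (null-+ p q))

    -ᴿ-cong : ∀ {x y} → x ≈ᴿ y → -ᴿ x ≈ᴿ -ᴿ y
    -ᴿ-cong {x} {y} (mk≈ᴿ p) = mk≈ᴿ (null-resp
      (λ m → solve 2 (λ a b → :- (a :- b) := (:- a) :- (:- b)) refl (seq x m) (seq y m))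
      (null-neg p))

    *ᴿ-cong : ∀ {x y u v} → x ≈ᴿ y → u ≈ᴿ v → x *ᴿ u ≈ᴿ y *ᴿ v
    *ᴿ-cong {x} {y} {u} {v} (mk≈ᴿ p) (mk≈ᴿ q) = mk≈ᴿ (null-resp
      (λ m → solve 4 (λ a b c d → a ⊗ (c :- d) ⊕ d ⊗ (a :- b) := (a ⊗ c) :- (b ⊗ d)) refl
        (seq x m) (seq y m) (seq u m) (seq v m))
      (null-+ (null-* {seq x} (cauchy x) q) (null-* {seq v} (cauchy v) p)))

    +ᴿ-assoc : ∀ x y z → (x +ᴿ y) +ᴿ z ≈ᴿ x +ᴿ (y +ᴿ z)
    +ᴿ-assoc x y z = pointwise λ m → ℚ.+-assoc (seq x m) (seq y m) (seq z m)

    +ᴿ-comm : ∀ x y → x +ᴿ y ≈ᴿ y +ᴿ x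
    +ᴿ-comm x y = pointwise λ m → ℚ.+-comm (seq x m) (seq y m)

    +ᴿ-identityˡ : ∀ x → 0ᴿ +ᴿ x ≈ᴿ x
    +ᴿ-identityˡ x = pointwise λ m → ℚ.+-identityˡ (seq x m)

    +ᴿ-inverseˡ : ∀ x → -ᴿ x +ᴿ x ≈ᴿ 0ᴿ
    +ᴿ-inverseˡ x = pointwise λ m → ℚ.+-inverseˡ (seq x m)

    1ᴿ≉0ᴿ : ¬ 1ᴿ ≈ᴿ 0ᴿ
    1ᴿ≉0ᴿ (mk≈ᴿ p) with k , h ← p 1ℚ (ℚ.positive⁻¹ 1ℚ) = ℚ.<-irrefl refl (h k ℕ.≤-refl)

    -- Like its neighbours, this is one component of a ring law of the complex numbers. Term by term
    -- it is a polynomial identity over the rationals, available once the opaque real operations are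
    -- unfolded.
    *ᶜ-assoc-re : ∀ a b c d e f →
      (a *ᴿ c +ᴿ -ᴿ (b *ᴿ d)) *ᴿ e +ᴿ -ᴿ ((a *ᴿ d +ᴿ b *ᴿ c) *ᴿ f) ≈ᴿ
      a *ᴿ (c *ᴿ e +ᴿ -ᴿ (d *ᴿ f)) +ᴿ -ᴿ (b *ᴿ (c *ᴿ f +ᴿ d *ᴿ e))
    *ᶜ-assoc-re a b c d e f = pointwise λ m → solve 6 (λ a b c d e f →
      (a ⊗ c :- b ⊗ d) ⊗ e :- (a ⊗ d ⊕ b ⊗ c) ⊗ f :=
      a ⊗ (c ⊗ e :- d ⊗ f) :- b ⊗ (c ⊗ f ⊕ d ⊗ e)) refl
      (seq a m) (seq b m) (seq c m) (seq d m) (seq e m) (seq f m)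

    *ᶜ-assoc-im : ∀ a b c d e f →
      (a *ᴿ c +ᴿ -ᴿ (b *ᴿ d)) *ᴿ f +ᴿ (a *ᴿ d +ᴿ b *ᴿ c) *ᴿ e ≈ᴿ
      a *ᴿ (c *ᴿ f +ᴿ d *ᴿ e) +ᴿ b *ᴿ (c *ᴿ e +ᴿ -ᴿ (d *ᴿ f))
    *ᶜ-assoc-im a b c d e f = pointwise λ m → solve 6 (λ a b c d e f →
      (a ⊗ c :- b ⊗ d) ⊗ f ⊕ (a ⊗ d ⊕ b ⊗ c) ⊗ e :=
      a ⊗ (c ⊗ f ⊕ d ⊗ e) ⊕ b ⊗ (c ⊗ e :- d ⊗ f)) refl
      (seq a m) (seq b m) (seq c m) (seq d m) (seq e m) (seq f m)

    *ᶜ-comm-re : ∀ a b c d → a *ᴿ c +ᴿ -ᴿ (b *ᴿ d) ≈ᴿ c *ᴿ a +ᴿ -ᴿ (d *ᴿ b)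
    *ᶜ-comm-re a b c d = pointwise λ m → solve 4 (λ a b c d →
      a ⊗ c :- b ⊗ d := c ⊗ a :- d ⊗ b) refl (seq a m) (seq b m) (seq c m) (seq d m)

    *ᶜ-comm-im : ∀ a b c d → a *ᴿ d +ᴿ b *ᴿ c ≈ᴿ c *ᴿ b +ᴿ d *ᴿ a
    *ᶜ-comm-im a b c d = pointwise λ m → solve 4 (λ a b c d →
      a ⊗ d ⊕ b ⊗ c := c ⊗ b ⊕ d ⊗ a) refl (seq a m) (seq b m) (seq c m) (seq d m)

    *ᶜ-identity-re : ∀ a b → 1ᴿ *ᴿ a +ᴿ -ᴿ (0ᴿ *ᴿ b) ≈ᴿ a
    *ᶜ-identity-re a b = pointwise λ m →
      trans (cong₂ (λ p q → p ℚ.- q) (ℚ.*-identityˡ (seq a m)) (ℚ.*-zeroˡ (seq b m)))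
            (ℚ.+-identityʳ (seq a m))

    *ᶜ-identity-im : ∀ a b → 1ᴿ *ᴿ b +ᴿ 0ᴿ *ᴿ a ≈ᴿ b
    *ᶜ-identity-im a b = pointwise λ m →
      trans (cong₂ ℚ._+_ (ℚ.*-identityˡ (seq b m)) (ℚ.*-zeroˡ (seq a m)))
            (ℚ.+-identityʳ (seq b m))

    *ᶜ-distrib-re : ∀ a b c d e f →
      (c +ᴿ e) *ᴿ a +ᴿ -ᴿ ((d +ᴿ f) *ᴿ b) ≈ᴿ
      (c *ᴿ a +ᴿ -ᴿ (d *ᴿ b)) +ᴿ (e *ᴿ a +ᴿ -ᴿ (f *ᴿ b))
    *ᶜ-distrib-re a b c d e f = pointwise λ m → solve 6 (λ a b c d e f →
      (c ⊕ e) ⊗ a :- (d ⊕ f) ⊗ b := (c ⊗ a :- d ⊗ b) ⊕ (e ⊗ a :- f ⊗ b)) refl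
      (seq a m) (seq b m) (seq c m) (seq d m) (seq e m) (seq f m)

    *ᶜ-distrib-im : ∀ a b c d e f →
      (c +ᴿ e) *ᴿ b +ᴿ (d +ᴿ f) *ᴿ a ≈ᴿ (c *ᴿ b +ᴿ d *ᴿ a) +ᴿ (e *ᴿ b +ᴿ f *ᴿ a)
    *ᶜ-distrib-im a b c d e f = pointwise λ m → solve 6 (λ a b c d e f →
      (c ⊕ e) ⊗ b ⊕ (d ⊕ f) ⊗ a := (c ⊗ b ⊕ d ⊗ a) ⊕ (e ⊗ b ⊕ f ⊗ a)) refl
      (seq a m) (seq b m) (seq c m) (seq d m) (seq e m) (seq f m)

  module _ where
    open RawRing ℂ-rawRing

    ≈ᶜ-trans : ∀ {x y z} → x ≈ᶜ y → y ≈ᶜ z → x ≈ᶜ z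
    ≈ᶜ-trans (mk≈ᶜ p q) (mk≈ᶜ r s) = mk≈ᶜ (≈ᴿ-trans p r) (≈ᴿ-trans q s)

    +ᶜ-comm : ∀ x y → x + y ≈ᶜ y + x
    +ᶜ-comm x y = mk≈ᶜ (+ᴿ-comm (re x) (re y)) (+ᴿ-comm (im x) (im y))

    *ᶜ-comm : ∀ x y → x * y ≈ᶜ y * x
    *ᶜ-comm x y = mk≈ᶜ (*ᶜ-comm-re (re x) (im x) (re y) (im y)) (*ᶜ-comm-im (re x) (im x) (re y) (im y))

    +ᶜ-cong : ∀ {x y u v} → x ≈ᶜ y → u ≈ᶜ v → x + u ≈ᶜ y + v
    +ᶜ-cong (mk≈ᶜ p q) (mk≈ᶜ r s) = mk≈ᶜ (+ᴿ-cong p r) (+ᴿ-cong q s)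

    *ᶜ-cong : ∀ {x y u v} → x ≈ᶜ y → u ≈ᶜ v → x * u ≈ᶜ y * v
    *ᶜ-cong (mk≈ᶜ p q) (mk≈ᶜ r s) = mk≈ᶜ
      (+ᴿ-cong (*ᴿ-cong p r) (-ᴿ-cong (*ᴿ-cong q s)))
      (+ᴿ-cong (*ᴿ-cong p s) (*ᴿ-cong q r))

    +ᶜ-identityˡ : ∀ x → 0# + x ≈ᶜ x
    +ᶜ-identityˡ x = mk≈ᶜ (+ᴿ-identityˡ (re x)) (+ᴿ-identityˡ (im x))

    *ᶜ-identityˡ : ∀ x → 1# * x ≈ᶜ x
    *ᶜ-identityˡ x = mk≈ᶜ (*ᶜ-identity-re (re x) (im x)) (*ᶜ-identity-im (re x) (im x))

    +ᶜ-inverseˡ : ∀ x → (- x) + x ≈ᶜ 0#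
    +ᶜ-inverseˡ x = mk≈ᶜ (+ᴿ-inverseˡ (re x)) (+ᴿ-inverseˡ (im x))

    *ᶜ-distribʳ : ∀ x y z → (y + z) * x ≈ᶜ y * x + z * x
    *ᶜ-distribʳ x y z = mk≈ᶜ
      (*ᶜ-distrib-re (re x) (im x) (re y) (im y) (re z) (im z))
      (*ᶜ-distrib-im (re x) (im x) (re y) (im y) (re z) (im z))

    ℂ-commutativeRing : CommutativeRing 0ℓ 0ℓ
    ℂ-commutativeRing = record
      { Carrier = ℂ
      ; _≈_ = _≈ᶜ_
      ; _+_ = _+_
      ; _*_ = _*_
      ; -_ = -_
      ; 0# = 0#
      ; 1# = 1#
      ; isCommutativeRing = record
        { isRing = record
          { +-isAbelianGroup = record
            { isGroup = record
              { isMonoid = record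
                { isSemigroup = record
                  { isMagma = record
                    { isEquivalence = record
                      { refl  = mk≈ᶜ ≈ᴿ-refl ≈ᴿ-refl
                      ; sym   = λ (mk≈ᶜ p q) → mk≈ᶜ (≈ᴿ-sym p) (≈ᴿ-sym q)
                      ; trans = ≈ᶜ-trans
                      }
                    ; ∙-cong = +ᶜ-cong
                    }
                  ; assoc = λ x y z → mk≈ᶜ (+ᴿ-assoc (re x) (re y) (re z)) (+ᴿ-assoc (im x) (im y) (im z))
                  }
                ; identity = +ᶜ-identityˡ , λ x → ≈ᶜ-trans (+ᶜ-comm x 0#) (+ᶜ-identityˡ x)
                }
              ; inverse = +ᶜ-inverseˡ , λ x → ≈ᶜ-trans (+ᶜ-comm x (- x)) (+ᶜ-inverseˡ x)
              ; ⁻¹-cong = λ (mk≈ᶜ p q) → mk≈ᶜ (-ᴿ-cong p) (-ᴿ-cong q)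
              }
            ; comm = +ᶜ-comm
            }
          ; *-cong = *ᶜ-cong
          ; *-assoc = λ x y z → mk≈ᶜ
              (*ᶜ-assoc-re (re x) (im x) (re y) (im y) (re z) (im z))
              (*ᶜ-assoc-im (re x) (im x) (re y) (im y) (re z) (im z))
          ; *-identity = *ᶜ-identityˡ , λ x → ≈ᶜ-trans (*ᶜ-comm x 1#) (*ᶜ-identityˡ x)
          ; distrib =
              (λ x y z → ≈ᶜ-trans (*ᶜ-comm x (y + z)) (≈ᶜ-trans (*ᶜ-distribʳ x y z)
                (+ᶜ-cong (*ᶜ-comm y x) (*ᶜ-comm z x)))) ,
              *ᶜ-distribʳ
          }
        ; *-comm = *ᶜ-comm
        }
      }

  -- The second field of `mkℚ` is the denominator minus one. Building the fraction n/1 directly lets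
  -- its numerator compute to `n`, from which injectivity is read off.
  natℝ : ℕ → ℝ
  natℝ n = mkℝ (λ _ → mkℚ (+ n) 0 (Coprime.sym (Coprime.1-coprimeTo n)))
    λ ε ε>0 → 0 , λ _ _ _ _ → subst (ℚ._< ε) (sym (cong ℚ.∣_∣ (ℚ.+-inverseʳ (mkℚ (+ n) 0 _)))) ε>0

  ≡-from-small : ∀ p q → (∀ ε → 0ℚ ℚ.< ε → ℚ.∣ p ℚ.- q ∣ ℚ.< ε) → p ≡ q
  ≡-from-small p q small = x∙y⁻¹≈ε⇒x≈y p q (ℚ.∣p∣≡0⇒p≡0 (p ℚ.- q) (ℚ.≤-antisym
    (ℚ.≮⇒≥ λ d>0 → ℚ.<-irrefl refl (small ℚ.∣ p ℚ.- q ∣ d>0))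
    (ℚ.0≤∣p∣ (p ℚ.- q))))

  natℝ-injective : ∀ {m n} → natℝ m ≈ᴿ natℝ n → m ≡ n
  natℝ-injective {m} {n} (mk≈ᴿ p) = cong (λ q → ℤ.∣ ℚ.numerator q ∣)
    (≡-from-small (seq (natℝ m) 0) (seq (natℝ n) 0) λ ε ε>0 → let k , h = p ε ε>0 in h k ℕ.≤-refl)

  natℂ : ℕ → ℂ
  natℂ n = natℝ n +i 0ᴿ

  natℂ-injective : ∀ {m n} → natℂ m ≈ᶜ natℂ n → m ≡ n
  natℂ-injective (mk≈ᶜ p _) = natℝ-injective p

  -- Total, with the default 0 at 0, so that it can be composed with a sequence that is bounded away
  -- from 0 only from some index on.
  recip : ℚ → ℚ
  recip q with q ℚ.≟ 0ℚ
  ... | yes _ = 0ℚ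
  ... | no q≢0 = (ℚ.1/ q) {{ℚ.≢-nonZero q≢0}}

  *-recip : ∀ {q} → q ≢ 0ℚ → q ℚ.* recip q ≡ 1ℚ
  *-recip {q} q≢0 with q ℚ.≟ 0ℚ
  ... | yes q≡0 = contradiction q≡0 q≢0
  ... | no q≢0 = ℚ.*-inverseʳ q {{ℚ.≢-nonZero q≢0}}

  apart⇒≢0 : ∀ {δ q} → 0ℚ ℚ.< δ → δ ℚ.≤ ℚ.∣ q ∣ → q ≢ 0ℚ
  apart⇒≢0 δ>0 δ≤q refl = <⇒≱ δ>0 δ≤q

  ≤-*-mono : ∀ {p q r s} → 0ℚ ℚ.≤ p → 0ℚ ℚ.≤ s → p ℚ.≤ r → q ℚ.≤ s → p ℚ.* q ℚ.≤ r ℚ.* s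
  ≤-*-mono {p} {q} {r} {s} 0≤p 0≤s p≤r q≤s =
    ℚ.≤-trans (ℚ.*-monoˡ-≤-nonNeg p {{ℚ.nonNegative 0≤p}} q≤s)
              (ℚ.*-monoʳ-≤-nonNeg s {{ℚ.nonNegative 0≤s}} p≤r)

  -- |1/a - 1/b| = |b - a| / |ab|, which is at most |b - a| / δ^2 when |a| and |b| are at least δ.
  -- Hence the tolerance ε δ^2 that is asked of `u`.
  recip-cauchy : ∀ {u δ k} → Cauchy u → 0ℚ ℚ.< δ → (∀ m → k ℕ.≤ m → δ ℚ.≤ ℚ.∣ u m ∣) →
    Cauchy (recip ∘ u)
  recip-cauchy {u} {δ} {k} cu δ>0 δ≤u ε ε>0
    = let l , h = cu (ε ℚ.* (δ ℚ.* δ)) (*-pos ε (δ ℚ.* δ) ε>0 (*-pos δ δ δ>0 δ>0))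
    in k ℕ.⊔ l , λ m n p q → close (ℕ.m⊔n≤o⇒m≤o k l p) (ℕ.m⊔n≤o⇒m≤o k l q)
      (h n m (ℕ.m⊔n≤o⇒n≤o k l q) (ℕ.m⊔n≤o⇒n≤o k l p))
    where
    0≤δ = ℚ.<⇒≤ δ>0
    close : ∀ {m n} → k ℕ.≤ m → k ℕ.≤ n → ℚ.∣ u n ℚ.- u m ∣ ℚ.< ε ℚ.* (δ ℚ.* δ) →
      ℚ.∣ recip (u m) ℚ.- recip (u n) ∣ ℚ.< ε
    close {m} {n} k≤m k≤n un-um<εδδ =
      ℚ.*-cancelʳ-<-nonNeg (δ ℚ.* δ) {{ℚ.nonNegative (ℚ.<⇒≤ (*-pos δ δ δ>0 δ>0))}}
        (let open ℚ.≤-Reasoning in begin-strict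
          ℚ.∣ r ℚ.- s ∣ ℚ.* (δ ℚ.* δ)
            ≤⟨ ℚ.*-monoˡ-≤-nonNeg ℚ.∣ r ℚ.- s ∣ {{ℚ.nonNegative (ℚ.0≤∣p∣ (r ℚ.- s))}}
                 (≤-*-mono {δ} {δ} {ℚ.∣ u m ∣} {ℚ.∣ u n ∣} 0≤δ (ℚ.0≤∣p∣ (u n)) (δ≤u m k≤m) (δ≤u n k≤n)) ⟩
          ℚ.∣ r ℚ.- s ∣ ℚ.* (ℚ.∣ u m ∣ ℚ.* ℚ.∣ u n ∣)
            ≡⟨ cong (ℚ.∣ r ℚ.- s ∣ ℚ.*_) (ℚ.∣p*q∣≡∣p∣*∣q∣ (u m) (u n)) ⟨
          ℚ.∣ r ℚ.- s ∣ ℚ.* ℚ.∣ u m ℚ.* u n ∣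
            ≡⟨ ℚ.∣p*q∣≡∣p∣*∣q∣ (r ℚ.- s) (u m ℚ.* u n) ⟨
          ℚ.∣ (r ℚ.- s) ℚ.* (u m ℚ.* u n) ∣
            ≡⟨ cong ℚ.∣_∣ (solve 4 (λ r s a b →
                 (r :- s) ⊗ (a ⊗ b) := (a ⊗ r) ⊗ b :- (b ⊗ s) ⊗ a) refl r s (u m) (u n)) ⟩
          ℚ.∣ (u m ℚ.* r) ℚ.* u n ℚ.- (u n ℚ.* s) ℚ.* u m ∣
            ≡⟨ cong₂ (λ p q → ℚ.∣ p ℚ.* u n ℚ.- q ℚ.* u m ∣)
                 (*-recip (apart⇒≢0 δ>0 (δ≤u m k≤m))) (*-recip (apart⇒≢0 δ>0 (δ≤u n k≤n))) ⟩
          ℚ.∣ 1ℚ ℚ.* u n ℚ.- 1ℚ ℚ.* u m ∣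
            ≡⟨ cong₂ (λ p q → ℚ.∣ p ℚ.- q ∣) (ℚ.*-identityˡ (u n)) (ℚ.*-identityˡ (u m)) ⟩
          ℚ.∣ u n ℚ.- u m ∣
            <⟨ un-um<εδδ ⟩
          ε ℚ.* (δ ℚ.* δ) ∎)
      where
      r = recip (u m)
      s = recip (u n)

  square-nonneg : ∀ p → 0ℚ ℚ.≤ p ℚ.* p
  square-nonneg p with ℚ.≤-total 0ℚ p
  ... | inj₁ 0≤p = subst (ℚ._≤ p ℚ.* p) (ℚ.*-zeroʳ p) (ℚ.*-monoˡ-≤-nonNeg p {{ℚ.nonNegative 0≤p}} 0≤p)
  ... | inj₂ p≤0 = subst (ℚ._≤ p ℚ.* p) (ℚ.*-zeroʳ p) (ℚ.*-monoˡ-≤-nonPos p {{ℚ.nonPositive p≤0}} p≤0)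

  -- A term with |u| at least ε would make the sum of squares at least ε^2. Applied to both
  -- components, it shows that |z|^2 is not null when z is nonzero.
  null-sum-of-squares : ∀ {u v : ℕ → ℚ} → Null (λ m → u m ℚ.* u m ℚ.+ v m ℚ.* v m) → Null u
  null-sum-of-squares {u} {v} nuv ε ε>0 =
    let k , h = nuv (ε ℚ.* ε) (*-pos ε ε ε>0 ε>0) in k , λ m k≤m → ℚ.≰⇒> λ ε≤u →
      <⇒≱ {ℚ.∣ u m ℚ.* u m ℚ.+ v m ℚ.* v m ∣} {ε ℚ.* ε} (h m k≤m) (let open ℚ.≤-Reasoning in begin
      ε ℚ.* ε                                ≤⟨ ≤-*-mono {ε} {ε} {ℚ.∣ u m ∣} {ℚ.∣ u m ∣} (ℚ.<⇒≤ ε>0) (ℚ.0≤∣p∣ (u m)) ε≤u ε≤u ⟩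
      ℚ.∣ u m ∣ ℚ.* ℚ.∣ u m ∣                ≡⟨ ℚ.∣p*q∣≡∣p∣*∣q∣ (u m) (u m) ⟨
      ℚ.∣ u m ℚ.* u m ∣                      ≡⟨ ℚ.0≤p⇒∣p∣≡p {u m ℚ.* u m} (square-nonneg (u m)) ⟩
      u m ℚ.* u m                            ≡⟨ ℚ.+-identityʳ (u m ℚ.* u m) ⟨
      u m ℚ.* u m ℚ.+ 0ℚ                     ≤⟨ ℚ.+-monoʳ-≤ (u m ℚ.* u m) {0ℚ} {v m ℚ.* v m} (square-nonneg (v m)) ⟩
      u m ℚ.* u m ℚ.+ v m ℚ.* v m            ≤⟨ p≤∣p∣ (u m ℚ.* u m ℚ.+ v m ℚ.* v m) ⟩
      ℚ.∣ u m ℚ.* u m ℚ.+ v m ℚ.* v m ∣      ∎)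
    where
    p≤∣p∣ : ∀ p → p ℚ.≤ ℚ.∣ p ∣
    p≤∣p∣ p with ℚ.≤-total 0ℚ p
    ... | inj₁ 0≤p = ℚ.≤-reflexive (sym (ℚ.0≤p⇒∣p∣≡p 0≤p))
    ... | inj₂ p≤0 = ℚ.≤-trans p≤0 (ℚ.0≤∣p∣ p)

  module _ (em : ∀ {ℓ} → ExcludedMiddle ℓ) where

    -- By contradiction: if no such bound existed, some term past a Cauchy modulus for ½ε would be
    -- below ½ε in absolute value and would pull every term past that modulus below ε, so the
    -- sequence would be null.
    apart : ∀ {u} → Cauchy u → ¬ Null u →
      ∃ λ δ → 0ℚ ℚ.< δ × ∃ λ k → ∀ m → k ℕ.≤ m → δ ℚ.≤ ℚ.∣ u m ∣
    apart {u} cu ¬nu = decidable-stable em λ ¬apart → ¬nu λ ε ε>0 →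
      let k , h = cu (½ ℚ.* ε) (½-pos ε>0) in
      k , λ m k≤m → decidable-stable (_ ℚ.<? _) λ um≮ε → ¬apart (½ ℚ.* ε , ½-pos ε>0 , k , λ l k≤l →
        ℚ.≮⇒≥ λ ul<½ε → um≮ε (let open ℚ.≤-Reasoning in begin-strict
          ℚ.∣ u m ∣
            ≡⟨ cong ℚ.∣_∣ (solve 2 (λ a b → a := (a :- b) ⊕ b) refl (u m) (u l)) ⟩
          ℚ.∣ (u m ℚ.- u l) ℚ.+ u l ∣
            ≤⟨ ℚ.∣p+q∣≤∣p∣+∣q∣ (u m ℚ.- u l) (u l) ⟩
          ℚ.∣ u m ℚ.- u l ∣ ℚ.+ ℚ.∣ u l ∣
            <⟨ ℚ.+-mono-< (h m l k≤m k≤l) ul<½ε ⟩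
          ½ ℚ.* ε ℚ.+ ½ ℚ.* ε
            ≡⟨ ½+½ ε ⟩
          ε ∎))

    open RawRing ℂ-rawRing

    opaque
      unfolding _+ᴿ_

      -- The inverse is the conjugate of z divided by |z|^2. The real part of the product equals 1
      -- only from the index `k` on, where the terms of |z|^2 are nonzero; the imaginary part
      -- vanishes term by term.
      ᶜ-inverse : ∀ z → ¬ z ≈ᶜ 0# → ∃ λ w → z * w ≈ᶜ 1#
      ᶜ-inverse z z≉0 = invert (apart {seq ∣z∣²} (cauchy ∣z∣²) λ n∣z∣² → z≉0 (mk≈ᶜ
        (mk≈ᴿ (null-resp {a} {λ m → a m ℚ.- 0ℚ} (λ m → sym (ℚ.+-identityʳ (a m)))
          (null-sum-of-squares {a} {b} n∣z∣²)))
        (mk≈ᴿ (null-resp {b} {λ m → b m ℚ.- 0ℚ} (λ m → sym (ℚ.+-identityʳ (b m)))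
          (null-sum-of-squares {b} {a} (null-resp {seq ∣z∣²} {λ m → b m ℚ.* b m ℚ.+ a m ℚ.* a m}
            (λ m → ℚ.+-comm (a m ℚ.* a m) (b m ℚ.* b m)) n∣z∣²))))))
        where
        ∣z∣² : ℝ
        ∣z∣² = re z *ᴿ re z +ᴿ im z *ᴿ im z
        a b : ℕ → ℚ
        a = seq (re z)
        b = seq (im z)
        invert : (∃ λ δ → 0ℚ ℚ.< δ × ∃ λ k → ∀ m → k ℕ.≤ m → δ ℚ.≤ ℚ.∣ seq ∣z∣² m ∣) →
          ∃ λ w → z * w ≈ᶜ 1#
        invert (δ , δ>0 , k , δ≤) =
          (re z *ᴿ r) +i (-ᴿ (im z *ᴿ r)) , mk≈ᶜ
            (mk≈ᴿ λ ε ε>0 → k , λ m k≤m → subst (λ q → ℚ.∣ q ∣ ℚ.< ε)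
              (sym (trans (cong (ℚ._- 1ℚ) (trans (re≡ (a m) (b m) (seq r m)) (*-recip (apart⇒≢0 δ>0 (δ≤ m k≤m)))))
                (ℚ.+-inverseʳ 1ℚ))) ε>0)
            (pointwise λ m → im≡ (a m) (b m) (seq r m))
          where
          r : ℝ
          r = mkℝ (recip ∘ seq ∣z∣²) (recip-cauchy {seq ∣z∣²} (cauchy ∣z∣²) δ>0 δ≤)
          re≡ : ∀ a b r → a ℚ.* (a ℚ.* r) ℚ.- b ℚ.* (ℚ.- (b ℚ.* r)) ≡ (a ℚ.* a ℚ.+ b ℚ.* b) ℚ.* r
          re≡ = solve 3 (λ a b r → a ⊗ (a ⊗ r) :- b ⊗ (:- (b ⊗ r)) := (a ⊗ a ⊕ b ⊗ b) ⊗ r) refl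
          im≡ : ∀ a b r → a ℚ.* (ℚ.- (b ℚ.* r)) ℚ.+ b ℚ.* (a ℚ.* r) ≡ 0ℚ
          im≡ = solve 3 (λ a b r → a ⊗ (:- (b ⊗ r)) ⊕ b ⊗ (a ⊗ r) := con 0ℚ) refl
            where open +-*-Solver using (con)

-- Fraction-free Gaussian elimination with prescribed pivot columns. The product
-- of the pivots plays the role of a minor: it is a polynomial in the entries, and
-- a family is independent iff it is nonzero for some choice of the columns.
module Elimination {C : Set} (_+_ _*_ : C → C → C) (1# -1# : C) where

  reduce : ∀ {d N} → Fin N → Vector (Vector C N) (suc d) → Vector (Vector C N) d
  reduce k u l j = (u zero k * u (suc l) j) + ((-1# * u (suc l) k) * u zero j)

  pivotProduct : ∀ {d N} → Vector (Fin N) d → Vector (Vector C N) d → C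
  pivotProduct {zero}  κ u = 1#
  pivotProduct {suc d} κ u = u zero (κ zero) * pivotProduct (κ ∘ suc) (reduce (κ zero) u)

-- Linear algebra over a field

record IsField (R : CommutativeRing 0ℓ 0ℓ) : Set where
  open CommutativeRing R
  field
    1≉0     : ¬ 1# ≈ 0#
    inverse : ∀ x → ¬ x ≈ 0# → ∃ λ y → x * y ≈ 1#

module LinearAlgebra (em : ∀ {ℓ} → ExcludedMiddle ℓ) (R : CommutativeRing 0ℓ 0ℓ) (F : IsField R) where

  open CommutativeRing R hiding (zero)
  open IsField F
  open import Algebra.Properties.Ring ring using (-1*x≈-x)
  open import Algebra.Properties.Semiring.Sum semiring
  open import Relation.Binary.Reasoning.Setoid setoid
  open Elimination _+_ _*_ 1# (- 1#)
  open import Algebra.Solver.Ring.NaturalCoefficients.Default commutativeSemiring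
    using (solve; _:=_) renaming (_:+_ to _⊕_; _:*_ to _⊗_)

  open import Data.Vec.Functional using (_∷_)

  private
    variable
      d m n N : ℕ

  Vec : ℕ → Set
  Vec = Vector Carrier

  0ᵥ : Vec N
  0ᵥ _ = 0#

  infix 4 _≈ᵥ_
  _≈ᵥ_ : Vec N → Vec N → Set
  v ≈ᵥ w = ∀ k → v k ≈ w k

  linearCombination : Vec d → Vector (Vec N) d → Vec N
  linearCombination c b k = sum λ l → c l * b l k

  LinearlyIndependent : Vector (Vec N) d → Set
  LinearlyIndependent b = ∀ c → linearCombination c b ≈ᵥ 0ᵥ → ∀ l → c l ≈ 0#

  Span : Vector (Vec N) d → Pred (Vec N) 0ℓ
  Span b v = ∃ λ c → v ≈ᵥ linearCombination c b

  HasDim : Pred (Vec N) 0ℓ → ℕ → Set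
  HasDim {N} U d = ∃ λ (b : Vector (Vec N) d) → LinearlyIndependent b × U ≐ Span b

  *-cancel-0 : ∀ {x y} → x * y ≈ 0# → ¬ x ≈ 0# → y ≈ 0#
  *-cancel-0 {x} {y} xy≈0 x≉0 = let z , xz≈1 = inverse x x≉0 in begin
    y            ≈⟨ *-identityˡ y ⟨
    1# * y       ≈⟨ *-congʳ xz≈1 ⟨
    x * z * y    ≈⟨ solve 3 (λ x y z → x ⊗ z ⊗ y := z ⊗ (x ⊗ y)) refl x y z ⟩
    z * (x * y)  ≈⟨ *-congˡ xy≈0 ⟩
    z * 0#       ≈⟨ zeroʳ z ⟩
    0#           ∎

  *-≉0 : ∀ {x y} → ¬ x ≈ 0# → ¬ y ≈ 0# → ¬ x * y ≈ 0#
  *-≉0 x≉0 y≉0 xy≈0 = y≉0 (*-cancel-0 xy≈0 x≉0)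

  x+-1x≈0 : ∀ x → x + - 1# * x ≈ 0#
  x+-1x≈0 x = trans (+-congˡ (-1*x≈-x x)) (-‿inverseʳ x)

  sum-≈0 : {t : Vec n} → (∀ l → t l ≈ 0#) → sum t ≈ 0#
  sum-≈0 {n} t≈0 = trans (sum-cong-≋ t≈0) (sum-replicate-zero n)

  sum-single : ∀ {t : Vec n} l → (∀ l′ → l′ ≢ l → t l′ ≈ 0#) → sum t ≈ t l
  sum-single {suc n} {t} l t≈0 = begin
    sum t                       ≈⟨ sum-remove {i = l} t ⟩
    t l + sum (removeAt t l)    ≈⟨ +-congˡ (sum-≈0 λ j → t≈0 (punchIn l j) (Fin.punchInᵢ≢i l j)) ⟩
    t l + 0#                    ≈⟨ +-identityʳ (t l) ⟩
    t l                         ∎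

  δ : Fin n → Vec n
  δ l l′ = if does (l Fin.≟ l′) then 1# else 0#

  δ-same : (l : Fin n) → δ l l ≈ 1#
  δ-same l with l Fin.≟ l
  ... | yes _ = refl
  ... | no l≢l = contradiction ≡.refl l≢l

  δ-distinct : {l l′ : Fin n} → l ≢ l′ → δ l l′ ≈ 0#
  δ-distinct {l = l} {l′} l≢l′ with l Fin.≟ l′
  ... | yes l≡l′ = contradiction l≡l′ l≢l′
  ... | no _ = refl

  lc-cong : ∀ {c c′ : Vec d} {b b′ : Vector (Vec N) d} →
    c ≈ᵥ c′ → (∀ l → b l ≈ᵥ b′ l) → linearCombination c b ≈ᵥ linearCombination c′ b′
  lc-cong c≈c′ b≈b′ k = sum-cong-≋ λ l → *-cong (c≈c′ l) (b≈b′ l k)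

  lc-zeroˡ : ∀ {c : Vec d} (b : Vector (Vec N) d) → c ≈ᵥ 0ᵥ → linearCombination c b ≈ᵥ 0ᵥ
  lc-zeroˡ b c≈0 k = sum-≈0 λ l → trans (*-congʳ (c≈0 l)) (zeroˡ (b l k))

  lc-δ : ∀ l (b : Vector (Vec N) d) → linearCombination (δ l) b ≈ᵥ b l
  lc-δ l b k = begin
    sum (λ l′ → δ l l′ * b l′ k)  ≈⟨ sum-single l (λ l′ l′≢l →
                                       trans (*-congʳ (δ-distinct (l′≢l ∘ ≡.sym))) (zeroˡ (b l′ k))) ⟩
    δ l l * b l k                 ≈⟨ *-congʳ (δ-same l) ⟩
    1# * b l k                    ≈⟨ *-identityˡ (b l k) ⟩
    b l k                         ∎

  lc-+ : ∀ c c′ (b : Vector (Vec N) d) →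
    linearCombination (λ l → c l + c′ l) b ≈ᵥ
    λ k → linearCombination c b k + linearCombination c′ b k
  lc-+ c c′ b k = trans (sum-cong-≋ λ l → distribʳ (b l k) (c l) (c′ l))
    (∑-distrib-+ (λ l → c l * b l k) (λ l → c′ l * b l k))

  lc-* : ∀ a c (b : Vector (Vec N) d) →
    linearCombination (λ l → a * c l) b ≈ᵥ λ k → a * linearCombination c b k
  lc-* a c b k = trans (sum-cong-≋ λ l → *-assoc a (c l) (b l k))
    (sym (*-distribˡ-sum a λ l → c l * b l k))

  lc-lc : ∀ c (M : Vector (Vec d) m) (b : Vector (Vec N) d) →
    linearCombination (linearCombination c M) b ≈ᵥ
    linearCombination c (λ p → linearCombination (M p) b)
  lc-lc c M b k = begin
    sum (λ l → sum (λ p → c p * M p l) * b l k)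
      ≈⟨ sum-cong-≋ (λ l → *-distribʳ-sum (b l k) λ p → c p * M p l) ⟩
    sum (λ l → sum (λ p → c p * M p l * b l k))
      ≈⟨ ∑-comm (λ l p → c p * M p l * b l k) ⟩
    sum (λ p → sum (λ l → c p * M p l * b l k))
      ≈⟨ sum-cong-≋ (λ p → sum-cong-≋ λ l → *-assoc (c p) (M p l) (b l k)) ⟩
    sum (λ p → sum (λ l → c p * (M p l * b l k)))
      ≈⟨ sum-cong-≋ (λ p → *-distribˡ-sum (c p) λ l → M p l * b l k) ⟨
    sum (λ p → c p * sum (λ l → M p l * b l k)) ∎

  -- Closure properties rather than a basis: spans, coordinate hyperplanes and preimages under x are
  -- all instances, and an inclusion of a span is then checked on generators.
  record IsSubspace (U : Pred (Vec N) 0ℓ) : Set where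
    field
      resp  : ∀ {v w} → v ≈ᵥ w → U v → U w
      0∈    : U 0ᵥ
      +∈    : ∀ {v w} → U v → U w → U (λ k → v k + w k)
      *∈    : ∀ a {v} → U v → U (λ k → a * v k)

    unscale : ∀ {a v} → ¬ a ≈ 0# → U (λ k → a * v k) → U v
    unscale {a} {v} a≉0 av∈U = let b , ab≈1 = inverse a a≉0 in
      resp (λ k → begin
        b * (a * v k)  ≈⟨ solve 3 (λ a b v → b ⊗ (a ⊗ v) := (a ⊗ b) ⊗ v) refl a b (v k) ⟩
        a * b * v k    ≈⟨ *-congʳ ab≈1 ⟩
        1# * v k       ≈⟨ *-identityˡ (v k) ⟩
        v k            ∎)
        (*∈ b av∈U)

    cancel : ∀ {v w} → U (λ k → v k + w k) → U w → U v
    cancel {v} {w} v+w∈U w∈U = resp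
      (λ k → begin
        v k + w k + - 1# * w k    ≈⟨ +-assoc (v k) (w k) _ ⟩
        v k + (w k + - 1# * w k)  ≈⟨ +-congˡ (x+-1x≈0 (w k)) ⟩
        v k + 0#                  ≈⟨ +-identityʳ (v k) ⟩
        v k                       ∎)
      (+∈ v+w∈U (*∈ (- 1#) w∈U))

    sum∈ : (t : Vector (Vec N) d) → (∀ l → U (t l)) → U (λ k → sum λ l → t l k)
    sum∈ {zero}  t t∈U = 0∈
    sum∈ {suc d} t t∈U = +∈ (t∈U zero) (sum∈ (t ∘ suc) (t∈U ∘ suc))

    sum-cancel : (t : Vector (Vec N) d) → U (λ k → sum λ l → t l k) →
      ∀ l → (∀ l′ → l′ ≢ l → U (t l′)) → U (t l)
    sum-cancel {suc d} t Σt∈U l t∈U = cancel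
      (resp (λ k → sum-remove {i = l} λ l → t l k) Σt∈U)
      (sum∈ (removeAt t l) λ j → t∈U (punchIn l j) (Fin.punchInᵢ≢i l j))

    span⊆ : {b : Vector (Vec N) d} → (∀ l → U (b l)) → Span b ⊆ U
    span⊆ {b = b} b∈U (c , v≈) = resp (λ k → sym (v≈ k)) (sum∈ _ λ l → *∈ (c l) (b∈U l))

  span-isSubspace : (b : Vector (Vec N) d) → IsSubspace (Span b)
  span-isSubspace b = record
    { resp = λ v≈w (c , v≈) → c , λ k → trans (sym (v≈w k)) (v≈ k)
    ; 0∈   = 0ᵥ , λ k → sym (lc-zeroˡ b (λ _ → refl) k)
    ; +∈   = λ (c , v≈) (c′ , w≈) → (λ l → c l + c′ l) , λ k →
               trans (+-cong (v≈ k) (w≈ k)) (sym (lc-+ c c′ b k))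
    ; *∈   = λ a (c , v≈) → (λ l → a * c l) , λ k → trans (*-congˡ (v≈ k)) (sym (lc-* a c b k))
    }

  ∈span : (b : Vector (Vec N) d) → ∀ l → Span b (b l)
  ∈span b l = δ l , λ k → sym (lc-δ l b k)

  hasDim-isSubspace : ∀ {U : Pred (Vec N) 0ℓ} → HasDim U d → IsSubspace U
  hasDim-isSubspace (b , _ , U⊆ , ⊆U) = record
    { resp = λ v≈w v∈U → ⊆U (resp v≈w (U⊆ v∈U))
    ; 0∈   = ⊆U 0∈
    ; +∈   = λ v∈U w∈U → ⊆U (+∈ (U⊆ v∈U) (U⊆ w∈U))
    ; *∈   = λ a v∈U → ⊆U (*∈ a (U⊆ v∈U))
    }
    where open IsSubspace (span-isSubspace b)

  -- `linearCombination c (δ ∘ f)` extends the coefficients `c` by zero outside the image of `f`;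
  -- injectivity makes its entry at `f p` equal to `c p`.
  independent-∘ : ∀ {b : Vector (Vec N) d} {f : Fin m → Fin d} →
    LinearlyIndependent b → Injective _≡_ _≡_ f → LinearlyIndependent (b ∘ f)
  independent-∘ {b = b} {f} indep f-inj c lc≈0 p = begin
    c p
      ≈⟨ *-identityʳ (c p) ⟨
    c p * 1#
      ≈⟨ *-congˡ (δ-same (f p)) ⟨
    c p * δ (f p) (f p)
      ≈⟨ sum-single p (λ q q≢p → trans (*-congˡ (δ-distinct (q≢p ∘ f-inj))) (zeroʳ (c q))) ⟨
    sum (λ q → c q * δ (f q) (f p))
      ≈⟨ indep (linearCombination c (δ ∘ f)) (λ k → trans (lc-lc c (δ ∘ f) b k)
           (trans (lc-cong {c = c} (λ _ → refl) (λ q → lc-δ (f q) b) k) (lc≈0 k))) (f p) ⟩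
    0# ∎

  independent-∷ : ∀ {u : Vector (Vec N) d} {v} →
    LinearlyIndependent u → ¬ Span u v → LinearlyIndependent (v ∷ u)
  independent-∷ {u = u} {v} indep v∉ c lc≈0 = λ { zero → c₀≈0 ; (suc l) → tail≈0 l }
    where
    open IsSubspace (span-isSubspace u)
    c₀≈0 : c zero ≈ 0#
    c₀≈0 = decidable-stable em λ c₀≉0 → v∉ (unscale c₀≉0
      (cancel (resp (λ k → sym (lc≈0 k)) 0∈) (c ∘ suc , λ k → refl)))
    tail≈0 : ∀ l → c (suc l) ≈ 0#
    tail≈0 = indep (c ∘ suc) λ k → begin
      linearCombination (c ∘ suc) u k
        ≈⟨ +-identityˡ _ ⟨
      0# + linearCombination (c ∘ suc) u k
        ≈⟨ +-congʳ (trans (*-congʳ c₀≈0) (zeroˡ (v k))) ⟨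
      c zero * v k + linearCombination (c ∘ suc) u k
        ≈⟨ lc≈0 k ⟩
      0# ∎

  ¬independent-∷ : ∀ {u : Vector (Vec N) d} {v} → Span u v → ¬ LinearlyIndependent (v ∷ u)
  ¬independent-∷ {u = u} {v} (c , v≈) indep = 1≉0 (begin
    1#         ≈⟨ +-identityʳ 1# ⟨
    1# + 0#    ≈⟨ +-congˡ -1≈0 ⟨
    1# + - 1#  ≈⟨ -‿inverseʳ 1# ⟩
    0#         ∎)
    where
    -1≈0 : - 1# ≈ 0#
    -1≈0 = indep (- 1# ∷ c) (λ k → begin
      - 1# * v k + linearCombination c u k  ≈⟨ +-congˡ (v≈ k) ⟨
      - 1# * v k + v k                      ≈⟨ +-comm _ _ ⟩
      v k + - 1# * v k                      ≈⟨ x+-1x≈0 (v k) ⟩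
      0#                                    ∎) zero

  -- Turns a relation among the reduced rows into one among the original rows. Both directions of
  -- the transfer of independence read their coefficients from it.
  lc-reduce : ∀ k (u : Vector (Vec N) (suc d)) c →
    linearCombination c (reduce k u) ≈ᵥ
    linearCombination (sum (λ l → c l * (- 1# * u (suc l) k)) ∷ λ l → u zero k * c l) u
  lc-reduce k u c j = begin
    sum (λ l → c l * (u zero k * u (suc l) j + - 1# * u (suc l) k * u zero j))
      ≈⟨ sum-cong-≋ (λ l → solve 6 (λ c a x m y z →
           c ⊗ (a ⊗ x ⊕ m ⊗ y ⊗ z) := (c ⊗ (m ⊗ y)) ⊗ z ⊕ a ⊗ c ⊗ x) refl
           (c l) (u zero k) (u (suc l) j) (- 1#) (u (suc l) k) (u zero j)) ⟩
    sum (λ l → c l * (- 1# * u (suc l) k) * u zero j + u zero k * c l * u (suc l) j)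
      ≈⟨ ∑-distrib-+ (λ l → c l * (- 1# * u (suc l) k) * u zero j) _ ⟩
    sum (λ l → c l * (- 1# * u (suc l) k) * u zero j) + sum (λ l → u zero k * c l * u (suc l) j)
      ≈⟨ +-congʳ (*-distribʳ-sum (u zero j) (λ l → c l * (- 1# * u (suc l) k))) ⟨
    sum (λ l → c l * (- 1# * u (suc l) k)) * u zero j + sum (λ l → u zero k * c l * u (suc l) j) ∎

  reduce-independent : ∀ k (u : Vector (Vec N) (suc d)) → ¬ u zero k ≈ 0# →
    LinearlyIndependent u → LinearlyIndependent (reduce k u)
  reduce-independent k u u₀≉0 indep c lc≈0 l = *-cancel-0
    (indep (sum (λ l → c l * (- 1# * u (suc l) k)) ∷ λ l → u zero k * c l)
      (λ j → trans (sym (lc-reduce k u c j)) (lc≈0 j)) (suc l)) u₀≉0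

  -- Column `k` of a relation `c` expresses u_0[k] c_0 through the other coefficients, and that
  -- value is exactly the coefficient of u_0 in the corresponding relation among reduced rows. So
  -- this relation is u_0[k] times the given one, hence trivial.
  reduce-independent⁻¹ : ∀ k (u : Vector (Vec N) (suc d)) → ¬ u zero k ≈ 0# →
    LinearlyIndependent (reduce k u) → LinearlyIndependent u
  reduce-independent⁻¹ k u u₀≉0 indep c lc≈0 = λ { zero → c₀≈0 ; (suc l) → tail≈0 l }
    where
    S = linearCombination (c ∘ suc) (u ∘ suc) k
    c₀-term : sum (λ l → c (suc l) * (- 1# * u (suc l) k)) ≈ u zero k * c zero
    c₀-term = begin
      sum (λ l → c (suc l) * (- 1# * u (suc l) k))
        ≈⟨ sum-cong-≋ (λ l → solve 3 (λ c m y → c ⊗ (m ⊗ y) := m ⊗ (c ⊗ y)) refl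
             (c (suc l)) (- 1#) (u (suc l) k)) ⟩
      sum (λ l → - 1# * (c (suc l) * u (suc l) k))
        ≈⟨ *-distribˡ-sum (- 1#) (λ l → c (suc l) * u (suc l) k) ⟨
      - 1# * S
        ≈⟨ +-identityˡ _ ⟨
      0# + - 1# * S
        ≈⟨ +-congʳ (lc≈0 k) ⟨
      c zero * u zero k + S + - 1# * S
        ≈⟨ +-assoc _ S _ ⟩
      c zero * u zero k + (S + - 1# * S)
        ≈⟨ +-cong (*-comm (c zero) (u zero k)) (x+-1x≈0 S) ⟩
      u zero k * c zero + 0#
        ≈⟨ +-identityʳ _ ⟩
      u zero k * c zero ∎
    tail≈0 : ∀ l → c (suc l) ≈ 0#
    tail≈0 = indep (c ∘ suc) λ j → begin
      linearCombination (c ∘ suc) (reduce k u) j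
        ≈⟨ lc-reduce k u (c ∘ suc) j ⟩
      sum (λ l → c (suc l) * (- 1# * u (suc l) k)) * u zero j + sum (λ l → u zero k * c (suc l) * u (suc l) j)
        ≈⟨ +-congʳ (*-congʳ c₀-term) ⟩
      linearCombination (λ l → u zero k * c l) u j
        ≈⟨ lc-* (u zero k) c u j ⟩
      u zero k * linearCombination c u j
        ≈⟨ *-congˡ (lc≈0 j) ⟩
      u zero k * 0#
        ≈⟨ zeroʳ (u zero k) ⟩
      0# ∎
    c₀≈0 : c zero ≈ 0#
    c₀≈0 = *-cancel-0 (trans (sym c₀-term)
      (sum-≈0 λ l → trans (*-congʳ (tail≈0 l)) (zeroˡ _))) u₀≉0

  *-≉0⁻¹ : ∀ {x y} → ¬ x * y ≈ 0# → ¬ x ≈ 0# × ¬ y ≈ 0#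
  *-≉0⁻¹ {x} {y} xy≉0 =
    (λ x≈0 → xy≉0 (trans (*-congʳ x≈0) (zeroˡ y))) ,
    (λ y≈0 → xy≉0 (trans (*-congˡ y≈0) (zeroʳ x)))

  -- Reduction preserves independence, so at every stage the leading row is nonzero and excluded
  -- middle yields a column for the next pivot.
  independent⇒pivots : (u : Vector (Vec N) d) → LinearlyIndependent u →
    ∃ λ κ → ¬ pivotProduct κ u ≈ 0#
  independent⇒pivots {d = zero}  u indep = (λ ()) , 1≉0
  independent⇒pivots {d = suc d} u indep =
    let k , u₀≉0 = nonzero-entry
        κ , p≉0  = independent⇒pivots (reduce k u) (reduce-independent k u u₀≉0 indep)
    in k ∷ κ , *-≉0 u₀≉0 p≉0
    where
    nonzero-entry : ∃ λ k → ¬ u zero k ≈ 0#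
    nonzero-entry = decidable-stable em λ none → 1≉0 (trans (sym (δ-same {suc d} zero))
      (indep (δ zero) (λ k → trans (lc-δ zero u k)
        (decidable-stable em λ u₀≉0 → none (k , u₀≉0))) zero))

  pivots⇒independent : ∀ κ (u : Vector (Vec N) d) → ¬ pivotProduct κ u ≈ 0# → LinearlyIndependent u
  pivots⇒independent {d = zero}  κ u p≉0 c lc≈0 ()
  pivots⇒independent {d = suc d} κ u p≉0 =
    let u₀≉0 , p′≉0 = *-≉0⁻¹ p≉0 in
    reduce-independent⁻¹ (κ zero) u u₀≉0 (pivots⇒independent (κ ∘ suc) (reduce (κ zero) u) p′≉0)

  -- When the column below the pivot is already zero, reduction merely scales the remaining rows by
  -- that nonzero pivot, so the triangular shape persists.
  triangular⇒pivots : ∀ κ (u : Vector (Vec N) d) → (∀ l → ¬ u l (κ l) ≈ 0#) →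
    (∀ {l l′} → l Fin.< l′ → u l′ (κ l) ≈ 0#) → ¬ pivotProduct κ u ≈ 0#
  triangular⇒pivots {d = zero}  κ u diag below = 1≉0
  triangular⇒pivots {d = suc d} κ u diag below =
    *-≉0 (diag zero) (triangular⇒pivots (κ ∘ suc) (reduce (κ zero) u)
      (λ l r≈0 → *-≉0 (diag zero) (diag (suc l)) (trans (sym (reduced l (κ (suc l)))) r≈0))
      (λ {l} {l′} l<l′ → trans (reduced l′ (κ (suc l)))
        (trans (*-congˡ (below (s≤s l<l′))) (zeroʳ _))))
    where
    reduced : ∀ l j → reduce (κ zero) u l j ≈ u zero (κ zero) * u (suc l) j
    reduced l j = begin
      u zero (κ zero) * u (suc l) j + - 1# * u (suc l) (κ zero) * u zero j
        ≈⟨ +-congˡ (*-congʳ (*-congˡ (below (s≤s z≤n)))) ⟩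
      u zero (κ zero) * u (suc l) j + - 1# * 0# * u zero j
        ≈⟨ +-congˡ (trans (*-congʳ (zeroʳ (- 1#))) (zeroˡ (u zero j))) ⟩
      u zero (κ zero) * u (suc l) j + 0#
        ≈⟨ +-identityʳ _ ⟩
      u zero (κ zero) * u (suc l) j ∎

  -- v ∈ ⟨u₀,…,u_l⟩, through subspaces so that no coefficients need be handled.
  infix 4 _∈⟨_≤_⟩
  _∈⟨_≤_⟩ : Vec N → Vector (Vec N) d → Fin d → Set₁
  v ∈⟨ u ≤ l ⟩ = ∀ {U} → IsSubspace U → (∀ l′ → l′ Fin.≤ l → U (u l′)) → U v

  -- In the two membership fields only indices up to `l` occur, so `row` and `u` generate the same
  -- flag and not just the same space.
  record Echelon (κ : Vector (Fin N) d) (u : Vector (Vec N) d) : Set₁ where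
    field
      row   : Vector (Vec N) d
      diag  : ∀ l → ¬ row l (κ l) ≈ 0#
      below : ∀ {l l′} → l Fin.< l′ → row l′ (κ l) ≈ 0#
      row∈  : ∀ l → row l ∈⟨ u ≤ l ⟩
      ∈row  : ∀ l → u l ∈⟨ row ≤ l ⟩

  vanishing-isSubspace : (k : Fin N) → IsSubspace (λ v → v k ≈ 0#)
  vanishing-isSubspace k = record
    { resp = λ v≈w v≈0 → trans (sym (v≈w k)) v≈0
    ; 0∈   = refl
    ; +∈   = λ v≈0 w≈0 → trans (+-cong v≈0 w≈0) (+-identityˡ 0#)
    ; *∈   = λ a v≈0 → trans (*-congˡ v≈0) (zeroʳ a)
    }

  echelon : ∀ κ (u : Vector (Vec N) d) → ¬ pivotProduct κ u ≈ 0# → Echelon κ u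
  echelon {d = zero} κ u _ = record
    { row = λ () ; diag = λ () ; below = λ { {()} _ } ; row∈ = λ () ; ∈row = λ () }
  echelon {d = suc d} κ u p≉0 = record
    { row   = u zero ∷ E.row
    ; diag  = λ { zero → u₀≉0 ; (suc l) → E.diag l }
    -- The later rows lie in the span of the reduced vectors, so they are tested against the
    -- hyperplane of vectors vanishing in the first pivot column.
    ; below = λ { {zero}  {suc l′} _ → E.row∈ l′ (vanishing-isSubspace (κ zero)) λ l _ → reduced≈0 l
                ; {suc l} {suc l′} (s≤s l<l′) → E.below l<l′ }
    ; row∈  = λ { zero    S u∈ → u∈ zero z≤n
                ; (suc l) S u∈ → E.row∈ l S λ l′ l′≤l →
                    let open IsSubspace S in +∈ (*∈ _ (u∈ (suc l′) (s≤s l′≤l))) (*∈ _ (u∈ zero z≤n)) }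
    ; ∈row  = λ { zero    S row∈ → row∈ zero z≤n
                ; (suc l) S row∈ →
                    let open IsSubspace S in
                    unscale u₀≉0 (cancel (E.∈row l S λ l′ l′≤l → row∈ (suc l′) (s≤s l′≤l))
                      (*∈ _ (row∈ zero z≤n))) }
    }
    where
    u₀≉0 = proj₁ (*-≉0⁻¹ p≉0)
    module E = Echelon (echelon (κ ∘ suc) (reduce (κ zero) u) (proj₂ (*-≉0⁻¹ p≉0)))
    reduced≈0 : ∀ l → reduce (κ zero) u l (κ zero) ≈ 0#
    reduced≈0 l = trans (+-congˡ (solve 3 (λ m x y → m ⊗ x ⊗ y := m ⊗ (y ⊗ x)) refl
      (- 1#) (u (suc l) (κ zero)) (u zero (κ zero)))) (x+-1x≈0 _)

  -- A column used twice would have been cleared by its first use and could not carry the second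
  -- pivot. This is where the bound on the size of independent families comes from.
  pivots-injective : ∀ κ (u : Vector (Vec N) d) → ¬ pivotProduct κ u ≈ 0# → Injective _≡_ _≡_ κ
  pivots-injective κ u p≉0 {l} {l′} κl≡κl′ with Fin.<-cmp l l′
  ... | tri≈ _ l≡l′ _ = l≡l′
  ... | tri< l<l′ _ _ = contradiction (≡.subst (λ k → row l′ k ≈ 0#) κl≡κl′ (below l<l′)) (diag l′)
    where open Echelon (echelon κ u p≉0)
  ... | tri> _ _ l′<l = contradiction (≡.subst (λ k → row l k ≈ 0#) (≡.sym κl≡κl′) (below l′<l)) (diag l)
    where open Echelon (echelon κ u p≉0)

  -- Strong induction on `l`, reading the combination in column κ_l: later rows vanish there by
  -- `below`, earlier rows in `P` have zero coefficient by induction, and earlier rows outside `P`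
  -- vanish there by `above`. Only the diagonal term remains.
  triangular-coefficients : ∀ {κ : Vector (Fin N) d} {u : Vector (Vec N) d} →
    (∀ l → ¬ u l (κ l) ≈ 0#) → (∀ {l l′} → l Fin.< l′ → u l′ (κ l) ≈ 0#) →
    ∀ c (P : Pred (Fin d) 0ℓ) → (∀ l → P l → linearCombination c u (κ l) ≈ 0#) →
    (∀ l l′ → P l → ¬ P l′ → u l′ (κ l) ≈ 0#) →
    ∀ l → P l → c l ≈ 0#
  triangular-coefficients {κ = κ} {u} diag below c P lc≈0 above l = go l (Fin.<-wellFounded l)
    where
    go : ∀ l → Acc Fin._<_ l → P l → c l ≈ 0#
    go l (acc rec) Pl = *-cancel-0 (trans (*-comm (u l (κ l)) (c l)) (trans (sym
      (sum-single l other)) (lc≈0 l Pl))) (diag l)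
      where
      other : ∀ l′ → l′ ≢ l → c l′ * u l′ (κ l) ≈ 0#
      other l′ l′≢l with Fin.<-cmp l′ l | em {P = P l′}
      ... | tri≈ _ l′≡l _ | _ = contradiction l′≡l l′≢l
      ... | tri> _ _ l<l′ | _ = trans (*-congˡ (below l<l′)) (zeroʳ (c l′))
      ... | tri< l′<l _ _ | yes Pl′ = trans (*-congʳ (go l′ (rec l′<l) Pl′)) (zeroˡ _)
      ... | tri< l′<l _ _ | no ¬Pl′ = trans (*-congˡ (above l l′ Pl ¬Pl′)) (zeroʳ (c l′))

  -- The coefficient rows of `u` in terms of `b` are themselves independent, and their pivots inject
  -- the m indices into the d columns.
  independent-size : ∀ {u : Vector (Vec N) m} {b : Vector (Vec N) d} →
    LinearlyIndependent u → (∀ l → Span b (u l)) → m ℕ.≤ d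
  independent-size {u = u} {b} indep u∈ =
    let κ , p≉0 = independent⇒pivots M M-independent in
    Fin.injective⇒≤ (pivots-injective κ M p≉0)
    where
    M = proj₁ ∘ u∈
    M-independent : LinearlyIndependent M
    M-independent c lc≈0 = indep c λ k → begin
      linearCombination c u k
        ≈⟨ lc-cong {c = c} (λ _ → refl) (proj₂ ∘ u∈) k ⟩
      linearCombination c (λ l → linearCombination (M l) b) k
        ≈⟨ lc-lc c M b k ⟨
      linearCombination (linearCombination c M) b k
        ≈⟨ lc-zeroˡ b lc≈0 k ⟩
      0# ∎

  independent-spans : ∀ {u b : Vector (Vec N) d} →
    LinearlyIndependent u → (∀ l → Span b (u l)) → Span b ⊆ Span u
  independent-spans {u = u} indep u∈ {v} v∈ = decidable-stable em λ v∉ → ℕ.1+n≰n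
    (independent-size {u = v ∷ u} (independent-∷ indep v∉) λ { zero → v∈ ; (suc l) → u∈ l })

  hasDim-spans : ∀ {U : Pred (Vec N) 0ℓ} {u : Vector (Vec N) d} →
    HasDim U d → LinearlyIndependent u → (∀ l → U (u l)) → U ⊆ Span u
  hasDim-spans (b , _ , U⊆ , _) indep u∈ v∈ = independent-spans indep (U⊆ ∘ u∈) (U⊆ v∈)

  hasDim-⊇ : ∀ {U W : Pred (Vec N) 0ℓ} → HasDim U d → HasDim W d → U ⊆ W → W ⊆ U
  hasDim-⊇ (b , indep , _ , b⊆U) dimW U⊆W w∈ =
    b⊆U (hasDim-spans dimW indep (λ l → U⊆W (b⊆U (∈span b l))) w∈)

  hasDim-new : ∀ {U W : Pred (Vec N) 0ℓ} → HasDim U d → HasDim W (suc d) → ∃ λ v → W v × ¬ U v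
  hasDim-new (b , _ , U⊆ , _) (b′ , indep , _ , ⊆W) = decidable-stable em λ none →
    ℕ.1+n≰n (independent-size indep λ l → U⊆
      (decidable-stable em λ b′∉ → none (b′ l , ⊆W (∈span b′ l) , b′∉)))

  hasDim-∷ : ∀ {U W : Pred (Vec N) 0ℓ} → HasDim U d → HasDim W (suc d) → U ⊆ W →
    ∀ {v} → W v → ¬ U v → ∀ {z} → W z → ∃ λ a → ∃ λ y → U y × z ≈ᵥ λ k → a * v k + y k
  hasDim-∷ (b , indep , U⊆ , ⊆U) dimW U⊆W {v} v∈W v∉U z∈W =
    let c , z≈ = hasDim-spans {u = v ∷ b} dimW (independent-∷ indep (v∉U ∘ ⊆U))
                   (λ { zero → v∈W ; (suc l) → U⊆W (⊆U (∈span b l)) }) z∈W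
    in c zero , linearCombination (c ∘ suc) b , ⊆U (c ∘ suc , λ _ → refl) , z≈

  -- Induction from the last index down: once the higher coefficients vanish, all other terms lie in
  -- the subspace preceding `A l`, so a nonzero c_l would put `A l` there too.
  chain-independent : ∀ {U : Fin (suc n) → Pred (Vec N) 0ℓ} {A : Vector (Vec N) n} →
    (∀ j → IsSubspace (U j)) → (∀ {i j} → i Fin.≤ j → U i ⊆ U j) →
    (∀ l → U (suc l) (A l)) → (∀ l → ¬ U (inject₁ l) (A l)) → LinearlyIndependent A
  chain-independent {U = U} {A} U-sub U-mono A∈ A∉ c lc≈0 l = go l (Fin.>-wellFounded l)
    where
    go : ∀ l → Acc Fin._>_ l → c l ≈ 0#
    go l (acc rec) = decidable-stable em λ cl≉0 → A∉ l (unscale cl≉0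
      (sum-cancel (λ l k → c l * A l k) (resp (λ k → sym (lc≈0 k)) 0∈) l other))
      where
      open IsSubspace (U-sub (inject₁ l))
      other : ∀ l′ → l′ ≢ l → U (inject₁ l) (λ k → c l′ * A l′ k)
      other l′ l′≢l with Fin.<-cmp l′ l
      ... | tri≈ _ l′≡l _ = contradiction l′≡l l′≢l
      ... | tri< l′<l _ _ = *∈ (c l′) (U-mono
            (≡.subst (suc (toℕ l′) ℕ.≤_) (≡.sym (Fin.toℕ-inject₁ l)) l′<l) (A∈ l′))
      ... | tri> _ _ l<l′ = resp (λ k → sym (trans (*-congʳ (go l′ (rec l<l′))) (zeroˡ _))) 0∈

-- Polynomial functions of one variable

module PolynomialFunctions (em : ∀ {ℓ} → ExcludedMiddle ℓ) (R : CommutativeRing 0ℓ 0ℓ) (F : IsField R) where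

  open import Data.List.Base using ([]; _∷_; _++_)
  open import Data.List.Relation.Unary.Any as Any using (Any; here; there)
  import Data.List.Relation.Unary.Any.Properties as Any
  open CommutativeRing R hiding (zero)
  open LinearAlgebra em R F using (*-cancel-0; x+-1x≈0)
  open import Algebra.Properties.Group +-group using (x∙y⁻¹≈ε⇒x≈y)
  open import Relation.Binary.Reasoning.Setoid setoid
  open import Algebra.Solver.Ring.NaturalCoefficients.Default commutativeSemiring
    using (solve; _:=_) renaming (_:+_ to _⊕_; _:*_ to _⊗_)

  -- Horner form imposed on a function instead of a list of coefficients, since only values along a
  -- curve are ever compared. Degree below 0 means the zero function.
  Degree< : ℕ → (Carrier → Carrier) → Set
  Degree< zero    g = ∀ t → g t ≈ 0#
  Degree< (suc d) g = ∃ λ a → ∃ λ h → Degree< d h × ∀ t → g t ≈ a + t * h t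

  IsPolynomial : (Carrier → Carrier) → Set
  IsPolynomial g = ∃ λ d → Degree< d g

  degree-resp : ∀ d {g h} → (∀ t → g t ≈ h t) → Degree< d g → Degree< d h
  degree-resp zero    g≈h g≈0 t = trans (sym (g≈h t)) (g≈0 t)
  degree-resp (suc d) g≈h (a , q , dq , g≈) = a , q , dq , λ t → trans (sym (g≈h t)) (g≈ t)

  degree-scale : ∀ d a {g} → Degree< d g → Degree< d (λ t → a * g t)
  degree-scale zero    a g≈0 t = trans (*-congˡ (g≈0 t)) (zeroʳ a)
  degree-scale (suc d) a (b , q , dq , g≈) = a * b , (λ t → a * q t) , degree-scale d a dq , λ t →
    trans (*-congˡ (g≈ t)) (solve 4 (λ a b t q → a ⊗ (b ⊕ t ⊗ q) := a ⊗ b ⊕ t ⊗ (a ⊗ q)) refl a b t (q t))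

  degree-+ : ∀ d e {g h} → Degree< d g → Degree< e h → Degree< (d ℕ.⊔ e) (λ t → g t + h t)
  degree-+ zero e g≈0 dh = degree-resp e (λ t → sym (trans (+-congʳ (g≈0 t)) (+-identityˡ _))) dh
  degree-+ (suc d) zero dg h≈0 =
    degree-resp (suc d) (λ t → sym (trans (+-congˡ (h≈0 t)) (+-identityʳ _))) dg
  degree-+ (suc d) (suc e) (a , p , dp , g≈) (b , q , dq , h≈) =
    a + b , (λ t → p t + q t) , degree-+ d e dp dq , λ t → trans (+-cong (g≈ t) (h≈ t))
      (solve 5 (λ a b t p q → (a ⊕ t ⊗ p) ⊕ (b ⊕ t ⊗ q) := (a ⊕ b) ⊕ t ⊗ (p ⊕ q)) refl a b t (p t) (q t))

  const-isPolynomial : ∀ a → IsPolynomial (λ _ → a)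
  const-isPolynomial a = 1 , a , (λ _ → 0#) , (λ _ → refl) , λ t →
    sym (trans (+-congˡ (zeroʳ t)) (+-identityʳ a))

  shift-isPolynomial : ∀ {g} → IsPolynomial g → IsPolynomial (λ t → t * g t)
  shift-isPolynomial {g} (d , dg) = suc d , 0# , g , dg , λ t → sym (+-identityˡ _)

  id-isPolynomial : IsPolynomial (λ t → t)
  id-isPolynomial = let d , dt = shift-isPolynomial (const-isPolynomial 1#)
    in d , degree-resp d *-identityʳ dt

  +-isPolynomial : ∀ {g h} → IsPolynomial g → IsPolynomial h → IsPolynomial (λ t → g t + h t)
  +-isPolynomial (d , dg) (e , dh) = d ℕ.⊔ e , degree-+ d e dg dh

  *-isPolynomial : ∀ {g h} → IsPolynomial g → IsPolynomial h → IsPolynomial (λ t → g t * h t)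
  *-isPolynomial {g} {h} (zero  , g≈0) _ = zero , λ t → trans (*-congʳ (g≈0 t)) (zeroˡ (h t))
  *-isPolynomial {g} {h} (suc d , a , q , dq , g≈) (e , dh) =
    let f , df = +-isPolynomial (e , degree-scale e a dh)
                     (shift-isPolynomial (*-isPolynomial (d , dq) (e , dh)))
    in f , degree-resp f (λ t → sym (trans (*-congʳ (g≈ t))
      (solve 4 (λ a t q h → (a ⊕ t ⊗ q) ⊗ h := a ⊗ h ⊕ t ⊗ (q ⊗ h)) refl a t (q t) (h t)))) df

  line : Carrier → Carrier → Carrier → Carrier
  line t a b = (1# + - 1# * t) * a + t * b

  line-0 : ∀ a b → line 0# a b ≈ a
  line-0 a b = begin
    (1# + - 1# * 0#) * a + 0# * b  ≈⟨ +-cong (*-congʳ (+-congˡ (zeroʳ (- 1#)))) (zeroˡ b) ⟩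
    (1# + 0#) * a + 0#             ≈⟨ +-identityʳ _ ⟩
    (1# + 0#) * a                  ≈⟨ *-congʳ (+-identityʳ 1#) ⟩
    1# * a                         ≈⟨ *-identityˡ a ⟩
    a                              ∎

  line-1 : ∀ a b → line 1# a b ≈ b
  line-1 a b = begin
    (1# + - 1# * 1#) * a + 1# * b  ≈⟨ +-cong (*-congʳ (x+-1x≈0 1#)) (*-identityˡ b) ⟩
    0# * a + b                     ≈⟨ +-congʳ (zeroˡ a) ⟩
    0# + b                         ≈⟨ +-identityˡ b ⟩
    b                              ∎

  line-isPolynomial : ∀ a b → IsPolynomial (λ t → line t a b)
  line-isPolynomial a b = +-isPolynomial
    (*-isPolynomial (+-isPolynomial (const-isPolynomial 1#)
                                    (*-isPolynomial (const-isPolynomial (- 1#)) id-isPolynomial))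
      (const-isPolynomial a))
    (*-isPolynomial id-isPolynomial (const-isPolynomial b))

  -- Synthetic division. With g = a + t h and h(t) = h(r) + (t - r) q(t), writing t as (t - r) + r
  -- in front of h gives the quotient h + r q.
  factor : ∀ d {g} → Degree< (suc d) g → ∀ r →
    ∃ λ q → Degree< d q × ∀ t → g t ≈ g r + (t - r) * q t
  factor zero {g} (a , h , h≈0 , g≈) r = (λ _ → 0#) , (λ _ → refl) , λ t → begin
    g t                    ≈⟨ constant t ⟩
    a                      ≈⟨ constant r ⟨
    g r                    ≈⟨ +-identityʳ (g r) ⟨
    g r + 0#               ≈⟨ +-congˡ (zeroʳ (t - r)) ⟨
    g r + (t - r) * 0#     ∎
    where
    constant : ∀ t → g t ≈ a
    constant t = trans (g≈ t) (trans (+-congˡ (trans (*-congˡ (h≈0 t)) (zeroʳ t))) (+-identityʳ a))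
  factor (suc d) {g} (a , h , dh , g≈) r =
    let q , dq , h≈ = factor d dh r in
    (λ t → h t + r * q t) ,
    ≡.subst (λ e → Degree< e λ t → h t + r * q t) (ℕ.m≥n⇒m⊔n≡m (ℕ.n≤1+n d))
      (degree-+ (suc d) d dh (degree-scale d r dq)) ,
    λ t → begin
      g t
        ≈⟨ g≈ t ⟩
      a + t * h t
        ≈⟨ +-congˡ (*-congʳ (t≈ t)) ⟩
      a + (t - r + r) * h t
        ≈⟨ +-congˡ (distribʳ (h t) (t - r) r) ⟩
      a + ((t - r) * h t + r * h t)
        ≈⟨ +-congˡ (+-congˡ (*-congˡ (h≈ t))) ⟩
      a + ((t - r) * h t + r * (h r + (t - r) * q t))
        ≈⟨ solve 6 (λ a r s ht hr qt → a ⊕ (s ⊗ ht ⊕ r ⊗ (hr ⊕ s ⊗ qt)) :=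
             (a ⊕ r ⊗ hr) ⊕ s ⊗ (ht ⊕ r ⊗ qt)) refl a r (t - r) (h t) (h r) (q t) ⟩
      a + r * h r + (t - r) * (h t + r * q t)
        ≈⟨ +-congʳ (g≈ r) ⟨
      g r + (t - r) * (h t + r * q t) ∎
    where
    t≈ : ∀ t → t ≈ t - r + r
    t≈ t = begin
      t               ≈⟨ +-identityʳ t ⟨
      t + 0#          ≈⟨ +-congˡ (-‿inverseˡ r) ⟨
      t + (- r + r)   ≈⟨ +-assoc t (- r) r ⟨
      t - r + r       ∎

  -- Each root found is divided out. The nonzero value at `t₀` forces the quotient to be nonzero at
  -- `t₀` as well, so the recursion on the degree goes through.
  finitely-many-roots : ∀ d {g} → Degree< d g → (∃ λ t → ¬ g t ≈ 0#) →
    ∃ λ rs → ∀ t → g t ≈ 0# → Any (t ≈_) rs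
  finitely-many-roots zero g≈0 (t , gt≉0) = contradiction (g≈0 t) gt≉0
  finitely-many-roots (suc d) {g} dg (t₀ , gt₀≉0) with em {P = ∃ λ r → g r ≈ 0#}
  ... | no none = [] , λ t gt≈0 → contradiction (t , gt≈0) none
  ... | yes (r , gr≈0) =
    let q , dq , g≈ = factor d dg r
        g≈′ t = trans (g≈ t) (trans (+-congʳ gr≈0) (+-identityˡ _))
        rs , q-roots = finitely-many-roots d dq
          (t₀ , λ qt₀≈0 → gt₀≉0 (trans (g≈′ t₀) (trans (*-congˡ qt₀≈0) (zeroʳ _))))
    in r ∷ rs , λ t gt≈0 → root (g≈′ t) gt≈0 (q-roots t)
    where
    root : ∀ {t qt rs} → g t ≈ (t - r) * qt → g t ≈ 0# → (qt ≈ 0# → Any (t ≈_) rs) → Any (t ≈_) (r ∷ rs)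
    root {t} gt≈ gt≈0 q-root with em {P = t - r ≈ 0#}
    ... | yes t-r≈0 = here (x∙y⁻¹≈ε⇒x≈y t r t-r≈0)
    ... | no t-r≉0 = there (q-root (*-cancel-0 (trans (sym gt≈) gt≈0) t-r≉0))

  module _ (ι : ℕ → Carrier) (ι-injective : ∀ {m n} → ι m ≈ ι n → m ≡ n) where

    -- Pigeonhole: if every `ι n` were in the list, two of the first length + 1 naturals would share
    -- a position and so be equal.
    infinite : ∀ rs → ∃ λ t → ¬ Any (t ≈_) rs
    infinite rs = decidable-stable em λ none →
      let ι∈ : ∀ n → Any (ι n ≈_) rs
          ι∈ n = decidable-stable em λ ι∉ → none (ι n , ι∉)
          i , j , i<j , same = Fin.pigeonhole (ℕ.n<1+n (length rs))
            (λ (i : Fin (suc (length rs))) → Any.index (ι∈ (toℕ i)))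
      in ℕ.<⇒≢ i<j (ι-injective (trans (Any.lookup-index (ι∈ (toℕ i)))
           (trans (reflexive (≡.cong (List.lookup rs) same)) (sym (Any.lookup-index (ι∈ (toℕ j)))))))

    -- A nonempty open subset of the line is dense: were f nonzero somewhere, both f and g would
    -- have finitely many roots, and a point off all of them would contradict the hypothesis.
    vanishing-on-open : ∀ {f g} → IsPolynomial f → IsPolynomial g → (∃ λ t → ¬ g t ≈ 0#) →
      (∀ t → ¬ g t ≈ 0# → f t ≈ 0#) → ∀ t → f t ≈ 0#
    vanishing-on-open (d , df) (e , dg) g≢0 f≈0 t = decidable-stable em λ ft≉0 →
      let rs , f-roots = finitely-many-roots d df (t , ft≉0)
          rs′ , g-roots = finitely-many-roots e dg g≢0
          t′ , t′∉ = infinite (rs ++ rs′)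
      in t′∉ (Any.++⁺ˡ (f-roots t′ (f≈0 t′ λ gt′≈0 → t′∉ (Any.++⁺ʳ rs (g-roots t′ gt′≈0)))))

-- Prefix spans and their intersections with coordinate subspaces

toℕ-inject! : ∀ {n} {j : Fin (suc n)} (l : Fin (toℕ j)) → toℕ (inject! {i = j} l) ≡ toℕ l
toℕ-inject! {suc n} {suc j} zero    = ≡.refl
toℕ-inject! {suc n} {suc j} (suc l) = ≡.cong suc (toℕ-inject! {n} {j} l)

module Prefixes (em : ∀ {ℓ} → ExcludedMiddle ℓ) (R : CommutativeRing 0ℓ 0ℓ) (F : IsField R) where

  open import Data.List.Membership.Propositional.Properties using (∈-filter⁺; ∈-filter⁻; ∈-allFin; ∈-lookup)
  import Data.List.Relation.Unary.All as All
  open import Data.List.Relation.Unary.AllPairs using (_∷_)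
  import Data.List.Relation.Unary.Any as Any
  import Data.List.Relation.Unary.Any.Properties as Any
  open import Data.List.Relation.Unary.Unique.Propositional using (Unique)
  import Data.List.Relation.Unary.Unique.Propositional.Properties as Unique
  open import Defs using (count; pos)
  open CommutativeRing R hiding (zero)
  open LinearAlgebra em R F

  lookup-injective : ∀ {A : Set} {xs : List A} → Unique xs → Injective _≡_ _≡_ (List.lookup xs)
  lookup-injective (x∉ ∷ _) {zero}  {zero}  _  = ≡.refl
  lookup-injective (x∉ ∷ _) {zero}  {suc j} eq = contradiction eq (All.lookup x∉ (∈-lookup j))
  lookup-injective (x∉ ∷ _) {suc i} {zero}  eq = contradiction (≡.sym eq) (All.lookup x∉ (∈-lookup i))
  lookup-injective (_ ∷ uniq) {suc i} {suc j} eq = ≡.cong suc (lookup-injective uniq eq)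

  private
    variable
      n N : ℕ

  Prefix : Vector (Vec N) n → Fin (suc n) → Pred (Vec N) 0ℓ
  Prefix A j = Span λ l → A (inject! {i = j} l)

  ∈prefix : ∀ (A : Vector (Vec N) n) j {l} → toℕ l ℕ.< toℕ j → Prefix A j (A l)
  ∈prefix A j {l} l<j = ≡.subst (λ l → Prefix A j (A l))
    (Fin.toℕ-injective (≡.trans (toℕ-inject! {j = j} (fromℕ< l<j)) (Fin.toℕ-fromℕ< l<j)))
    (∈span (λ l → A (inject! {i = j} l)) (fromℕ< l<j))

  prefix⊆ : ∀ {U : Pred (Vec N) 0ℓ} {A : Vector (Vec N) n} {j} → IsSubspace U →
    (∀ l → toℕ l ℕ.< toℕ j → U (A l)) → Prefix A j ⊆ U
  prefix⊆ {j = j} U-sub A∈ = IsSubspace.span⊆ U-sub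
    λ l → A∈ (inject! {i = j} l) (Fin.inject!-< {i = j} l)

  prefix-isSubspace : (A : Vector (Vec N) n) → ∀ j → IsSubspace (Prefix A j)
  prefix-isSubspace A j = span-isSubspace λ l → A (inject! {i = j} l)

  prefix-mono : ∀ (A : Vector (Vec N) n) {i j} → i Fin.≤ j → Prefix A i ⊆ Prefix A j
  prefix-mono A {i} {j} i≤j = prefix⊆ {j = i} (prefix-isSubspace A j) λ l l<i →
    ∈prefix A j (ℕ.<-≤-trans l<i i≤j)

  prefix-hasDim : ∀ {A : Vector (Vec N) n} → LinearlyIndependent A → ∀ j → HasDim (Prefix A j) (toℕ j)
  prefix-hasDim {A = A} indep j =
    _ , independent-∘ indep (Fin.inject!-injective {i = j}) , (λ v∈ → v∈) , (λ v∈ → v∈)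

  span⊆prefix : ∀ {A : Vector (Vec N) n} {j} → n ≡ toℕ j → Span A ⊆ Prefix A j
  span⊆prefix {A = A} {j} n≡j = IsSubspace.span⊆ (prefix-isSubspace A j) λ l →
    ∈prefix A j (≡.subst (toℕ l ℕ.<_) n≡j (Fin.toℕ<n l))

  -- SupportedBelow m = ⟨e₁,…,eₘ⟩
  SupportedBelow : ℕ → Pred (Vec N) 0ℓ
  SupportedBelow m v = ∀ k → m ℕ.≤ toℕ k → v k ≈ 0#

  supportedBelow-isSubspace : ∀ m → IsSubspace {N} (SupportedBelow m)
  supportedBelow-isSubspace m = record
    { resp = λ v≈w v∈ k m≤k → resp (vanishing-isSubspace k) v≈w (v∈ k m≤k)
    ; 0∈   = λ k _ → refl
    ; +∈   = λ {v} {w} v∈ w∈ k m≤k → +∈ (vanishing-isSubspace k) {v} {w} (v∈ k m≤k) (w∈ k m≤k)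
    ; *∈   = λ a {v} v∈ k m≤k → *∈ (vanishing-isSubspace k) a {v} (v∈ k m≤k)
    }
    where open IsSubspace

  module _ {κ : Vector (Fin N) n} {A : Vector (Vec N) n} (E : Echelon κ A)
           (supported : ∀ l → SupportedBelow (pos (κ l)) (Echelon.row E l)) where

    open Echelon E

    row⊆prefix : ∀ j l → toℕ l ℕ.< toℕ j → Prefix A j (row l)
    row⊆prefix j l l<j = row∈ l (prefix-isSubspace A j) λ l′ l′≤l →
      ∈prefix A j (ℕ.≤-<-trans l′≤l l<j)

    prefix⊆row : ∀ j → Prefix A j ⊆ Prefix row j
    prefix⊆row j = prefix⊆ {A = A} {j} (prefix-isSubspace row j) λ l l<j →
      ∈row l (prefix-isSubspace row j) λ l′ l′≤l → ∈prefix row j (ℕ.≤-<-trans l′≤l l<j)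

    row-independent : LinearlyIndependent row
    row-independent = pivots⇒independent κ row (triangular⇒pivots κ row diag below)

    -- The echelon rows with l ≤ j and w_l ≤ m form a basis of the intersection, and `count` is the
    -- length of the very list that selects them.
    prefix∩supported-hasDim : ∀ (w : Vector ℕ n) → (∀ l → w l ≡ pos (κ l)) → ∀ j m →
      HasDim (Prefix A j ∩ SupportedBelow m) (count w (toℕ j) m)
    prefix∩supported-hasDim w w≡ j m = row ∘ List.lookup L ,
      independent-∘ row-independent (lookup-injective (Unique.filter⁺ P? (Unique.allFin⁺ n))) ,
      (λ (v∈A , v∈m) → ⊆L v∈m (prefix⊆row j v∈A)) ,
      λ v∈ → IsSubspace.span⊆ (prefix-isSubspace A j) (λ p → row⊆prefix j _ (proj₁ (∈L⇒P p))) v∈ ,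
             IsSubspace.span⊆ (supportedBelow-isSubspace m) (λ p k m≤k →
               supported _ k (ℕ.≤-trans (≡.subst (ℕ._≤ m) (w≡ _) (proj₂ (∈L⇒P p))) m≤k)) v∈
      where
      P? = λ l → (pos l ℕ.≤? toℕ j) ×-dec (w l ℕ.≤? m)
      L = filter P? (allFin n)
      ∈L⇒P : ∀ p → pos (List.lookup L p) ℕ.≤ toℕ j × w (List.lookup L p) ℕ.≤ m
      ∈L⇒P p = proj₂ (∈-filter⁻ P? {xs = allFin n} (∈-lookup p))
      ⊆L : ∀ {v} → SupportedBelow m v → Prefix row j v → Span (row ∘ List.lookup L) v
      ⊆L {v} v∈m (c , v≈) = resp (λ k → sym (v≈ k)) (sum∈ _ term)
        where
        open IsSubspace (span-isSubspace (row ∘ List.lookup L))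
        c≈0 : ∀ l → m ℕ.< w (inject! {i = j} l) → c l ≈ 0#
        -- `P` selects the rows whose pivot lies beyond column m. The combination vanishes in those
        -- columns, and so do the rows with smaller pivots, by `supported`.
        c≈0 = triangular-coefficients {κ = κ ∘ inject! {i = j}} {u = row ∘ inject! {i = j}}
          (diag ∘ inject! {i = j}) (λ {l} {l′} l<l′ → below
            (≡.subst₂ ℕ._<_ (≡.sym (toℕ-inject! {j = j} l)) (≡.sym (toℕ-inject! {j = j} l′)) l<l′))
          c (λ l → m ℕ.< w (inject! {i = j} l))
          (λ l m<w → trans (sym (v≈ _)) (v∈m _ (ℕ.s≤s⁻¹ (≡.subst (m ℕ.<_) (w≡ _) m<w))))
          (λ l l′ m<w m≮w′ → supported _ _ (ℕ.≤-trans
            (≡.subst (ℕ._≤ m) (w≡ _) (ℕ.≮⇒≥ m≮w′)) (ℕ.s≤s⁻¹ (≡.subst (m ℕ.<_) (w≡ _) m<w))))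
        term : ∀ l → Span (row ∘ List.lookup L) (λ k → c l * row (inject! {i = j} l) k)
        term l with w (inject! {i = j} l) ℕ.≤? m
        ... | no w≰m = resp (λ k → sym (trans (*-congʳ (c≈0 l (ℕ.≰⇒> w≰m))) (zeroˡ _))) 0∈
        ... | yes w≤m = *∈ (c l) (≡.subst (λ l → Span (row ∘ List.lookup L) (row l))
                (≡.sym (Any.lookup-index l∈L)) (∈span (row ∘ List.lookup L) (Any.index l∈L)))
          where l∈L = ∈-filter⁺ P? (∈-allFin (inject! {i = j} l)) (Fin.inject!-< {i = j} l , w≤m)

open import Data.Nat.Base using (_≤_; _<_; _∸_)
open import Data.Vec.Functional using (_∷_)
open import Defs
open import Relation.Binary.PropositionalEquality using (refl)
open ComplexNumbers using (1ᴿ≉0ᴿ; ℂ-commutativeRing; natℂ; natℂ-injective; ᶜ-inverse)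
open CommutativeRing ℂ-commutativeRing using
  ( _≈_; _+_; _*_; -_; 0#; 1#; setoid; semiring; reflexive
  ; +-cong; +-congˡ; +-congʳ; +-assoc; +-comm; +-identityˡ; +-identityʳ
  ; *-cong; *-congˡ; *-congʳ; *-comm; *-identityˡ; *-identityʳ; zeroˡ; zeroʳ)
  renaming (refl to ≈-refl; sym to ≈-sym; trans to ≈-trans)
open import Algebra.Properties.Semiring.Sum semiring using (sum; sum-cong-≋)

ℂ-isField : (∀ {ℓ} → ExcludedMiddle ℓ) → IsField ℂ-commutativeRing
ℂ-isField em = record { 1≉0 = λ p → 1ᴿ≉0ᴿ (re≈ p) ; inverse = ᶜ-inverse em }

-- Combinatorics of the sequence w^(i)

length-filter-initial : ∀ {A : Set} {Q : Pred A 0ℓ} (Q? : Decidable Q) n (f : Fin n → A) k → k ≤ n →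
  (∀ l → Q (f l) ⇔ toℕ l < k) → length (filter Q? (tabulate f)) ≡ k
length-filter-initial Q? zero    f zero k≤n Q⇔ = refl
length-filter-initial Q? (suc n) f k    k≤n Q⇔ with Q? (f zero)
length-filter-initial Q? (suc n) f zero    k≤n Q⇔ | yes q = contradiction (Equivalence.to (Q⇔ zero) q) λ ()
length-filter-initial Q? (suc n) f (suc k) k≤n Q⇔ | yes _ = ≡.cong suc
  (length-filter-initial Q? n (f ∘ suc) k (ℕ.s≤s⁻¹ k≤n) λ l →
    mk⇔ (ℕ.s≤s⁻¹ ∘ Equivalence.to (Q⇔ (suc l))) (Equivalence.from (Q⇔ (suc l)) ∘ s≤s))
length-filter-initial Q? (suc n) f (suc k) k≤n Q⇔ | no ¬q = contradiction (Equivalence.from (Q⇔ zero) (s≤s z≤n)) ¬q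
length-filter-initial Q? (suc n) f zero    k≤n Q⇔ | no _ = length-filter-initial Q? n (f ∘ suc) zero z≤n λ l →
    mk⇔ (λ q → contradiction (Equivalence.to (Q⇔ (suc l)) q) λ ()) λ ()

-- n = p + 1
module Permutation (p s : ℕ) (1≤p : 1 ≤ p) (p≤s : p ≤ s) (i : Fin (suc p)) where

  open ΔSpringer (suc p) s

  p<N : p < N
  p<N = ℕ.m<m+n p (ℕ.≤-trans 1≤p p≤s)

  toℕ≤p : ∀ (l : Fin (suc p)) → toℕ l ≤ p
  toℕ≤p l = ℕ.s≤s⁻¹ (Fin.toℕ<n l)

  -- The additive form avoids truncated subtraction. The sum is p before the entry N and p + 1 after
  -- it, because N delays the descending values by one place.
  w-before : ∀ {l} → l Fin.< i → w⟨ i ⟩ l ℕ.+ toℕ l ≡ p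
  w-before {l} l<i with ℕ.<-cmp (pos l) (pos i)
  ... | tri< _ _ _ = ℕ.m∸n+n≡m (toℕ≤p l)
  ... | tri≈ _ l≡i _ = contradiction (ℕ.suc-injective l≡i) (ℕ.<⇒≢ l<i)
  ... | tri> _ _ i<l = contradiction (ℕ.s≤s⁻¹ i<l) (ℕ.<⇒≯ l<i)

  w-at : w⟨ i ⟩ i ≡ N
  w-at with ℕ.<-cmp (pos i) (pos i)
  ... | tri< i<i _ _ = contradiction i<i (ℕ.<-irrefl refl)
  ... | tri≈ _ _ _ = refl
  ... | tri> _ _ i<i = contradiction i<i (ℕ.<-irrefl refl)

  w-after : ∀ {l} → i Fin.< l → w⟨ i ⟩ l ℕ.+ toℕ l ≡ suc p
  w-after {l} i<l with ℕ.<-cmp (pos l) (pos i)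
  ... | tri< l<i _ _ = contradiction (ℕ.s≤s⁻¹ l<i) (ℕ.<⇒≯ i<l)
  ... | tri≈ _ l≡i _ = contradiction (≡.sym (ℕ.suc-injective l≡i)) (ℕ.<⇒≢ i<l)
  ... | tri> _ _ _ = ℕ.m∸n+n≡m (ℕ.m≤n⇒m≤1+n (toℕ≤p l))

  w≤p : ∀ l → l ≢ i → w⟨ i ⟩ l ≤ p
  w≤p l l≢i with Fin.<-cmp l i
  ... | tri< l<i _ _ = ℕ.m+n≤o⇒m≤o _ (ℕ.≤-reflexive (w-before l<i))
  ... | tri≈ _ l≡i _ = contradiction l≡i l≢i
  ... | tri> _ _ i<l = ℕ.s≤s⁻¹ (≡.subst (w⟨ i ⟩ l <_) (w-after i<l)
                         (ℕ.m<m+n _ (ℕ.≤-<-trans z≤n i<l)))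

  1≤w : ∀ l → 1 ≤ w⟨ i ⟩ l
  1≤w l = ℕ.n≢0⇒n>0 λ w≡0 → impossible w≡0 (Fin.<-cmp l i)
    where
    impossible : w⟨ i ⟩ l ≡ 0 → _ → _
    impossible w≡0 (tri< l<i _ _) = ℕ.<⇒≢ (ℕ.<-≤-trans l<i (toℕ≤p i))
      (≡.trans (≡.cong (ℕ._+ toℕ l) (≡.sym w≡0)) (w-before l<i))
    impossible w≡0 (tri≈ _ refl _) = ℕ.<⇒≢ (ℕ.≤-<-trans z≤n p<N) (≡.trans (≡.sym w≡0) w-at)
    impossible w≡0 (tri> _ _ i<l) = ℕ.<⇒≢ (Fin.toℕ<n l)
      (≡.trans (≡.cong (ℕ._+ toℕ l) (≡.sym w≡0)) (w-after i<l))

  w≤N : ∀ l → w⟨ i ⟩ l ≤ N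
  w≤N l with l Fin.≟ i
  ... | yes refl = ℕ.≤-reflexive w-at
  ... | no l≢i = ℕ.≤-trans (w≤p l l≢i) (ℕ.<⇒≤ p<N)

  -- Columns are counted from 0: the value w_l - 1 is inferred from the type of the bound.
  pivot : Vector (Fin N) (suc p)
  pivot l = fromℕ< (ℕ.≤-trans (ℕ.≤-reflexive (ℕ.m+[n∸m]≡n (1≤w l))) (w≤N l))

  w≡pos-pivot : ∀ l → w⟨ i ⟩ l ≡ pos (pivot l)
  w≡pos-pivot l = ≡.sym (≡.trans (≡.cong suc (Fin.toℕ-fromℕ< _)) (ℕ.m+[n∸m]≡n (1≤w l)))

  w-distinct : ∀ {l l′} → l Fin.< l′ → w⟨ i ⟩ l ≢ w⟨ i ⟩ l′
  w-distinct {l} {l′} l<l′ w≡w′ with Fin.<-cmp l i | Fin.<-cmp l′ i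
  ... | tri≈ _ refl _ | tri≈ _ refl _ = ℕ.<-irrefl refl l<l′
  ... | tri≈ _ refl _ | tri< _ l′≢i _ = ℕ.<⇒≱ p<N (≡.subst (_≤ p) (≡.trans (≡.sym w≡w′) w-at) (w≤p l′ l′≢i))
  ... | tri≈ _ refl _ | tri> _ l′≢i _ = ℕ.<⇒≱ p<N (≡.subst (_≤ p) (≡.trans (≡.sym w≡w′) w-at) (w≤p l′ l′≢i))
  ... | tri< _ l≢i _ | tri≈ _ refl _ = ℕ.<⇒≱ p<N (≡.subst (_≤ p) (≡.trans w≡w′ w-at) (w≤p l l≢i))
  ... | tri> _ l≢i _ | tri≈ _ refl _ = ℕ.<⇒≱ p<N (≡.subst (_≤ p) (≡.trans w≡w′ w-at) (w≤p l l≢i))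
  ... | tri> _ _ i<l | tri< l′<i _ _ = ℕ.<-asym i<l (ℕ.<-trans l<l′ l′<i)
  ... | tri< l<i _ _ | tri< l′<i _ _ = ℕ.<⇒≢ l<l′ (ℕ.+-cancelˡ-≡ (w⟨ i ⟩ l) _ _
        (≡.trans (w-before l<i) (≡.trans (≡.sym (w-before l′<i)) (≡.cong (ℕ._+ toℕ l′) (≡.sym w≡w′)))))
  ... | tri> _ _ i<l | tri> _ _ i<l′ = ℕ.<⇒≢ l<l′ (ℕ.+-cancelˡ-≡ (w⟨ i ⟩ l) _ _
        (≡.trans (w-after i<l) (≡.trans (≡.sym (w-after i<l′)) (≡.cong (ℕ._+ toℕ l′) (≡.sym w≡w′)))))
  ... | tri< l<i _ _ | tri> _ _ i<l′ = ℕ.<⇒≱ i<l′ (ℕ.≤-trans (ℕ.≤-reflexive (ℕ.+-cancelˡ-≡ (w⟨ i ⟩ l) _ _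
        (≡.trans (≡.cong (ℕ._+ toℕ l′) w≡w′) (≡.trans (w-after i<l′)
          (≡.sym (≡.trans (ℕ.+-suc _ _) (≡.cong suc (w-before l<i)))))))) l<i)

  -- Apart from N the sequence runs through p,...,1 in descending order, so every larger value up to
  -- p has occurred before w_l. It follows that the columns of im(x) to the right of a pivot are
  -- already cleared.
  pivot-hit : ∀ {l} → l ≢ i → ∀ (k : Fin N) → w⟨ i ⟩ l ≤ toℕ k → toℕ k < p →
    ∃ λ l′ → l′ Fin.< l × pivot l′ ≡ k
  pivot-hit {l} l≢i k w≤k k<p = hit (Fin.<-cmp l i) (a ℕ.<? toℕ i)
    where
    -- The position, counted from 0, of the value k + 1 in the list p,...,1. In w^(i) it stays at
    -- `a` if a < `toℕ i` and moves to `suc a` otherwise.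
    a = p ∸ suc (toℕ k)
    a+k≡p : a ℕ.+ suc (toℕ k) ≡ p
    a+k≡p = ℕ.m∸n+n≡m k<p
    a<p : a < p
    a<p = ≡.subst (a <_) a+k≡p (ℕ.m<m+n a (s≤s z≤n))
    found : ∀ b (b<n : b < suc p) → b < toℕ l → w⟨ i ⟩ (fromℕ< b<n) ≡ suc (toℕ k) →
      ∃ λ l′ → l′ Fin.< l × pivot l′ ≡ k
    found b b<n b<l w≡ = fromℕ< b<n , ≡.subst (_< toℕ l) (≡.sym (Fin.toℕ-fromℕ< b<n)) b<l ,
      Fin.toℕ-injective (ℕ.suc-injective (≡.trans (≡.sym (w≡pos-pivot (fromℕ< b<n))) w≡))
    before : a < toℕ i → a < toℕ l → ∃ λ l′ → l′ Fin.< l × pivot l′ ≡ k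
    before a<i a<l = found a a<n a<l (ℕ.+-cancelʳ-≡ a _ _ (≡.trans
      (≡.trans (≡.cong (w⟨ i ⟩ (fromℕ< a<n) ℕ.+_) (≡.sym a≡)) (w-before (≡.subst (_< toℕ i) (≡.sym a≡) a<i)))
      (≡.trans (≡.sym a+k≡p) (ℕ.+-comm a _))))
      where
      a<n = ℕ.m≤n⇒m≤1+n a<p
      a≡ = Fin.toℕ-fromℕ< a<n
    after : toℕ i ≤ a → suc a < toℕ l → ∃ λ l′ → l′ Fin.< l × pivot l′ ≡ k
    after i≤a 1+a<l = found (suc a) 1+a<n 1+a<l (ℕ.+-cancelʳ-≡ (suc a) _ _ (≡.trans
      (≡.trans (≡.cong (w⟨ i ⟩ (fromℕ< 1+a<n) ℕ.+_) (≡.sym a≡))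
        (w-after (≡.subst (toℕ i <_) (≡.sym a≡) (s≤s i≤a))))
      (≡.trans (≡.cong suc (≡.sym a+k≡p)) (ℕ.+-comm (suc a) _))))
      where
      1+a<n = s≤s a<p
      a≡ = Fin.toℕ-fromℕ< 1+a<n
    bound : ∀ b c → b ℕ.+ suc (toℕ k) ≡ c → w⟨ i ⟩ l ℕ.+ toℕ l ≡ c → b < toℕ l
    bound b c b+k≡ w+l≡ = ℕ.+-cancelʳ-≤ (toℕ k) (suc b) (toℕ l) (begin
      suc b ℕ.+ toℕ k          ≡⟨ ℕ.+-suc b (toℕ k) ⟨
      b ℕ.+ suc (toℕ k)        ≡⟨ ≡.trans b+k≡ (≡.sym w+l≡) ⟩
      w⟨ i ⟩ l ℕ.+ toℕ l       ≤⟨ ℕ.+-monoˡ-≤ (toℕ l) w≤k ⟩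
      toℕ k ℕ.+ toℕ l          ≡⟨ ℕ.+-comm (toℕ k) (toℕ l) ⟩
      toℕ l ℕ.+ toℕ k          ∎)
      where open ℕ.≤-Reasoning
    hit : _ → _ → ∃ λ l′ → l′ Fin.< l × pivot l′ ≡ k
    hit (tri≈ _ l≡i _) _ = contradiction l≡i l≢i
    hit (tri< l<i _ _) _ = before (ℕ.<-trans a<l l<i) a<l
      where a<l = bound a p a+k≡p (w-before l<i)
    hit (tri> _ _ i<l) (yes a<i) = before a<i (ℕ.<-trans a<i i<l)
    hit (tri> _ _ i<l) (no a≮i) = after (ℕ.≮⇒≥ a≮i) (bound (suc a) (suc p) (≡.cong suc a+k≡p) (w-after i<l))

  w≤p⇒≢ : ∀ l → w⟨ i ⟩ l ≤ p → l ≢ i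
  w≤p⇒≢ l wl≤p refl = ℕ.<⇒≱ p<N (≡.subst (_≤ p) w-at wl≤p)

  counted? : ∀ j (l : Fin (suc p)) → Dec (pos l ≤ j × w⟨ i ⟩ l ≤ p)
  counted? j l = (pos l ℕ.≤? j) ×-dec (w⟨ i ⟩ l ℕ.≤? p)

  count-before : count w⟨ i ⟩ (toℕ i) p ≡ toℕ i
  count-before = length-filter-initial (counted? (toℕ i)) (suc p) (λ l → l) (toℕ i)
    (ℕ.<⇒≤ (Fin.toℕ<n i)) λ l →
    mk⇔ proj₁ λ l<i → l<i , w≤p l λ { refl → ℕ.<-irrefl refl l<i }

  -- The i-th entry N exceeds p and contributes nothing, so passing from i-1 to i leaves the count
  -- unchanged. This is what forces V_i to meet im(x) in no more than V_{i-1}.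
  count-upto : count w⟨ i ⟩ (suc (toℕ i)) p ≡ toℕ i
  count-upto = length-filter-initial (counted? (suc (toℕ i))) (suc p) (λ l → l) (toℕ i)
    (ℕ.<⇒≤ (Fin.toℕ<n i)) λ l →
    mk⇔ (λ (l≤i , wl≤p) → ℕ.≤∧≢⇒< (ℕ.s≤s⁻¹ l≤i) (w≤p⇒≢ l wl≤p ∘ Fin.toℕ-injective))
        (λ l<i → ℕ.m≤n⇒m≤1+n l<i , w≤p l λ { refl → ℕ.<-irrefl refl l<i })

-- Polynomial expressions and their evaluation

module Formal {X : Set} = Elimination {Polynomial X} _:+_ _:*_ (con 1#) (con (- 1#))
module Numeric = Elimination _+_ _*_ 1# (- 1#)

⟦⟧-cong : ∀ {X} (f : Polynomial X) {ρ σ : X → ℂ} → (∀ x → ρ x ≈ σ x) → ⟦ f ⟧ ρ ≈ ⟦ f ⟧ σ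
⟦⟧-cong (con c)  ρ≈σ = ≈-refl
⟦⟧-cong (var x)  ρ≈σ = ρ≈σ x
⟦⟧-cong (f :+ g) ρ≈σ = +-cong (⟦⟧-cong f ρ≈σ) (⟦⟧-cong g ρ≈σ)
⟦⟧-cong (f :* g) ρ≈σ = *-cong (⟦⟧-cong f ρ≈σ) (⟦⟧-cong g ρ≈σ)

⟦reduce⟧ : ∀ {X d N} k (u : Vector (Vector (Polynomial X) N) (suc d)) {u′ ρ} →
  (∀ l j → ⟦ u l j ⟧ ρ ≡ u′ l j) → ∀ l j → ⟦ Formal.reduce k u l j ⟧ ρ ≡ Numeric.reduce k u′ l j
⟦reduce⟧ k u u≡ l j = ≡.cong₂ _+_ (≡.cong₂ _*_ (u≡ zero k) (u≡ (suc l) j))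
  (≡.cong₂ (λ a b → - 1# * a * b) (u≡ (suc l) k) (u≡ zero j))

-- `Elimination` assumes no laws, so one and the same program runs on expressions and on numbers,
-- and evaluation commutes with it up to `≡`. The scalar -1 enters as a constant because expressions
-- have no negation.
⟦pivotProduct⟧ : ∀ {X d N} κ (u : Vector (Vector (Polynomial X) N) d) {u′ ρ} →
  (∀ l j → ⟦ u l j ⟧ ρ ≡ u′ l j) → ⟦ Formal.pivotProduct κ u ⟧ ρ ≡ Numeric.pivotProduct κ u′
⟦pivotProduct⟧ {d = zero}  κ u u≡ = refl
⟦pivotProduct⟧ {d = suc d} κ u {u′} u≡ = ≡.cong₂ _*_ (u≡ zero (κ zero))
  (⟦pivotProduct⟧ (κ ∘ suc) (Formal.reduce (κ zero) u) (⟦reduce⟧ (κ zero) u u≡))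

formalSum : ∀ {X n} → Vector (Polynomial X) n → Polynomial X
formalSum = foldr _:+_ (con 0#)

⟦formalSum⟧ : ∀ {X n} (t : Vector (Polynomial X) n) ρ → ⟦ formalSum t ⟧ ρ ≡ sum (λ l → ⟦ t l ⟧ ρ)
⟦formalSum⟧ {n = zero}  t ρ = refl
⟦formalSum⟧ {n = suc n} t ρ = ≡.cong (⟦ t zero ⟧ ρ +_) (⟦formalSum⟧ (t ∘ suc) ρ)

entries : ∀ {n N} → Vector (Vector ℂ N) n → Fin n × Fin N → ℂ
entries A (l , k) = A l k

matrix : ∀ {n N} → Vector (Vector (Polynomial (Fin n × Fin N)) N) n
matrix l k = var (l , k)

e-on : ∀ {N m} {k : Fin N} → pos k ≡ m → e m k ≡ 1#
e-on {k = k} refl with toℕ k ℕ.≡ᵇ toℕ k | ℕ.≡⇒≡ᵇ (toℕ k) (toℕ k) refl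
... | true | _ = refl

e-off : ∀ {N m} {k : Fin N} → pos k ≢ m → e m k ≡ 0#
e-off {m = m} {k} k≢m with pos k ℕ.≡ᵇ m | ℕ.≡ᵇ⇒≡ (pos k) m
... | true  | k≡m = contradiction (k≡m _) k≢m
... | false | _   = refl

-- Standard basis and coordinate subspaces

module Coordinates (em : ∀ {ℓ} → ExcludedMiddle ℓ) where

  open LinearAlgebra em ℂ-commutativeRing (ℂ-isField em)
    hiding (_≈ᵥ_; linearCombination; LinearlyIndependent; Span; HasDim)
  open PolynomialFunctions em ℂ-commutativeRing (ℂ-isField em)
  open Prefixes em ℂ-commutativeRing (ℂ-isField em)

  ⟦⟧-isPolynomial : ∀ {X} (f : Polynomial X) {ρ : ℂ → X → ℂ} →
    (∀ x → IsPolynomial (λ t → ρ t x)) → IsPolynomial (λ t → ⟦ f ⟧ (ρ t))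
  ⟦⟧-isPolynomial (con c)  ρ-poly = const-isPolynomial c
  ⟦⟧-isPolynomial (var x)  ρ-poly = ρ-poly x
  ⟦⟧-isPolynomial (f :+ g) ρ-poly = +-isPolynomial (⟦⟧-isPolynomial f ρ-poly) (⟦⟧-isPolynomial g ρ-poly)
  ⟦⟧-isPolynomial (f :* g) ρ-poly = *-isPolynomial (⟦⟧-isPolynomial f ρ-poly) (⟦⟧-isPolynomial g ρ-poly)

  sum-isPolynomial : ∀ {n} (t : ℂ → Vector ℂ n) → (∀ l → IsPolynomial (λ r → t r l)) →
    IsPolynomial (λ r → sum (t r))
  sum-isPolynomial {zero}  t t-poly = const-isPolynomial 0#
  sum-isPolynomial {suc n} t t-poly = +-isPolynomial (t-poly zero)
    (sum-isPolynomial (λ r → t r ∘ suc) (t-poly ∘ suc))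

  lc-e : ∀ {d N} l (b : Vector (Vector ℂ N) d) → linearCombination (e (pos l)) b ≈ᵥ b l
  lc-e l b k = ≈-trans (lc-cong {c = e (pos l)} {δ l} {b} e≈δ (λ _ _ → ≈-refl) k) (lc-δ l b k)
    where
    e≈δ : e (pos l) ≈ᵥ δ l
    e≈δ l′ with l Fin.≟ l′
    ... | yes refl = reflexive (e-on {k = l} refl)
    ... | no l≢l′ = reflexive (e-off {k = l′} (l≢l′ ∘ ≡.sym ∘ Fin.toℕ-injective ∘ ℕ.suc-injective))

  standard-expansion : ∀ {N} (v : Vector ℂ N) → v ≈ᵥ linearCombination v (λ k → e (pos k))
  standard-expansion v j = ≈-sym (≈-trans
    (sum-single j (λ k k≢j → ≈-trans (*-congˡ {v k} (reflexive (e-off {k = j}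
      (k≢j ∘ ≡.sym ∘ Fin.toℕ-injective ∘ ℕ.suc-injective)))) (zeroʳ (v k))))
    (≈-trans (*-congˡ {v j} (reflexive (e-on {k = j} refl))) (*-identityʳ (v j))))

  span-e⇒supported : ∀ {N} m → span-e {N} m ⊆ SupportedBelow m
  span-e⇒supported {N} m {v} v∈ = IsSubspace.span⊆ (supportedBelow-isSubspace m)
    {b = λ (l : Fin m) → e (pos l)}
    (λ l k m≤k → reflexive (e-off {k = k} λ k≡l →
      ℕ.<⇒≢ (ℕ.<-≤-trans (Fin.toℕ<n l) m≤k) (≡.sym (ℕ.suc-injective k≡l)))) {v} v∈

  supported⇒span-e : ∀ {N} m → SupportedBelow m ⊆ span-e {N} m
  supported⇒span-e {N} m {v} v∈ = resp (λ k → ≈-sym (standard-expansion v k))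
    (sum∈ (λ l k → v l * e (pos l) k) term)
    where
    open IsSubspace (span-isSubspace λ (l : Fin m) → e {N} (pos l))
    term : ∀ l → span-e m (λ k → v l * e (pos l) k)
    term l with toℕ l ℕ.<? m
    ... | yes l<m = *∈ (v l) {e (pos l)} (≡.subst (λ a → span-e {N} m (e (suc a))) (Fin.toℕ-fromℕ< l<m)
                      (∈span (λ (l : Fin m) → e {N} (pos l)) (fromℕ< l<m)))
    ... | no l≮m = resp {0ᵥ} (λ k → ≈-sym (≈-trans
      (*-congʳ {e (pos l) k} (v∈ l (ℕ.≮⇒≥ l≮m))) (zeroˡ (e (pos l) k)))) 0∈

  hasDim-resp : ∀ {d N} {U W : Pred (Vector ℂ N) 0ℓ} → U ≐ W → HasDim U d → HasDim W d
  hasDim-resp (U⊆W , W⊆U) (b , indep , U⊆ , ⊆U) = b , indep , (λ w∈ → U⊆ (W⊆U w∈)) , (λ w∈ → U⊆W (⊆U w∈))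

  standard-independent : ∀ {N} m → m ≤ N → LinearlyIndependent (λ (l : Fin m) → e {N} (pos l))
  standard-independent {N} m m≤N = pivots⇒independent κ u (triangular⇒pivots κ u
    (λ l u≈0 → IsField.1≉0 (ℂ-isField em) (≈-trans (reflexive (≡.sym (e-on (κ≡ l)))) u≈0))
    λ {l} {l′} l<l′ → reflexive (e-off λ κl≡l′ → ℕ.<⇒≢ l<l′ (ℕ.suc-injective (≡.trans (≡.sym (κ≡ l)) κl≡l′))))
    where
    u : Vector (Vector ℂ N) m
    u l = e (pos l)
    κ : Vector (Fin N) m
    κ l = Fin.inject≤ l m≤N
    κ≡ : ∀ l → pos (κ l) ≡ pos l
    κ≡ l = ≡.cong suc (Fin.toℕ-inject≤ l m≤N)

  supported-hasDim : ∀ {N} m → m ≤ N → HasDim (SupportedBelow {N} m) m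
  supported-hasDim m m≤N = (λ l → e (pos l)) , standard-independent m m≤N ,
    supported⇒span-e m , span-e⇒supported m

-- The operator x, its image and a section of it

module Operator (em : ∀ {ℓ} → ExcludedMiddle ℓ) (p s : ℕ) (1≤p : 1 ≤ p) (p≤s : p ≤ s) where

  open ΔSpringer (suc p) s
  open Coordinates em
  open LinearAlgebra em ℂ-commutativeRing (ℂ-isField em)
    hiding (_≈ᵥ_; linearCombination; LinearlyIndependent; Span; HasDim)
  open Prefixes em ℂ-commutativeRing (ℂ-isField em)
  open import Relation.Binary.Reasoning.Setoid setoid

  E : Pred (Vector ℂ N) 0ℓ
  E = SupportedBelow p

  E-isSubspace : IsSubspace E
  E-isSubspace = supportedBelow-isSubspace p

  p≤N : p ≤ N
  p≤N = ℕ.m≤m+n p s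

  E-hasDim : HasDim E p
  E-hasDim = supported-hasDim p p≤N

  2n-2 : 2 ℕ.* suc p ∸ 2 ≡ p ℕ.+ p
  2n-2 = ≡.trans (≡.cong (_∸ 1) (ℕ.+-suc p (p ℕ.+ 0))) (≡.cong (p ℕ.+_) (ℕ.+-identityʳ p))

  x-basis-on : ∀ {m} → suc p ≤ m → m ≤ p ℕ.+ p → x-basis m ≡ e (m ∸ p)
  x-basis-on {m} p<m m≤2p with (suc p ℕ.≤? m) ×-dec (m ℕ.≤? 2 ℕ.* suc p ∸ 2)
  ... | yes _ = refl
  ... | no ¬r = contradiction (p<m , ℕ.≤-trans m≤2p (ℕ.≤-reflexive (≡.sym 2n-2))) ¬r

  x-basis-off : ∀ {m} → m ≤ p ⊎ p ℕ.+ p < m → x-basis m ≡ λ _ → 0#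
  x-basis-off {m} out with (suc p ℕ.≤? m) ×-dec (m ℕ.≤? 2 ℕ.* suc p ∸ 2)
  ... | no _ = refl
  ... | yes (p<m , m≤2p) with out
  ...   | inj₁ m≤p = contradiction p<m (ℕ.≤⇒≯ m≤p)
  ...   | inj₂ 2p<m = contradiction (ℕ.≤-trans m≤2p (ℕ.≤-reflexive 2n-2)) (ℕ.<⇒≱ 2p<m)

  X : Vector (Vector ℂ N) N
  X m = x-basis (pos m)

  x-cong : ∀ {v w} → v ≈ᵥ w → x v ≈ᵥ x w
  x-cong v≈w = lc-cong {b = X} v≈w (λ _ _ → ≈-refl)

  x-kills-E : ∀ {v} → E v → x v ≈ᵥ 0ᵥ
  x-kills-E {v} v∈E k = sum-≈0 {t = λ m → v m * x-basis (pos m) k} term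
    where
    term : ∀ m → v m * x-basis (pos m) k ≈ 0#
    term m with toℕ m ℕ.<? p
    ... | yes m<p = ≈-trans (*-congˡ {v m} (reflexive (≡.cong (λ b → b k) (x-basis-off (inj₁ m<p))))) (zeroʳ (v m))
    ... | no m≮p = ≈-trans (*-congʳ {x-basis (pos m) k} (v∈E m (ℕ.≮⇒≥ m≮p))) (zeroˡ (x-basis (pos m) k))

  X∈E : ∀ m → E (X m)
  X∈E m k p≤k with pos m ℕ.≤? p | pos m ℕ.≤? p ℕ.+ p
  ... | yes m≤p | _ = reflexive (≡.cong (λ b → b k) (x-basis-off (inj₁ m≤p)))
  ... | no _    | no m≰2p = reflexive (≡.cong (λ b → b k) (x-basis-off (inj₂ (ℕ.≰⇒> m≰2p))))
  ... | no m≰p  | yes m≤2p = ≈-trans (reflexive (≡.cong (λ b → b k) (x-basis-on (ℕ.≰⇒> m≰p) m≤2p)))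
    (reflexive (e-off {k = k} λ k≡ → ℕ.<⇒≱ (s≤s p≤k)
      (≡.subst (_≤ p) (≡.sym k≡) (ℕ.m≤n+o⇒m∸n≤o (pos m) p m≤2p))))

  x∈E : ∀ v → E (x v)
  x∈E v = IsSubspace.span⊆ E-isSubspace {b = X} X∈E (v , λ _ → ≈-refl)

  im-x⇒E : im-x ⊆ E
  im-x⇒E {w} (v , w≈) = IsSubspace.resp E-isSubspace {x v} {w} (λ k → ≈-sym (w≈ k)) (x∈E v)

  -- Since x kills im(x), it maps im(x) + ⟨v⟩ into the line through xv. Every stability question
  -- about such a space reduces to locating xv.
  x-combination : ∀ {z v y a} → E y → z ≈ᵥ (λ k → a * v k + y k) → x z ≈ᵥ λ k → a * x v k
  x-combination {z} {v} {y} {a} y∈E z≈ k = begin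
    x z k                            ≈⟨ x-cong {z} z≈ k ⟩
    x (λ k → a * v k + y k) k        ≈⟨ lc-+ (λ k → a * v k) y X k ⟩
    x (λ k → a * v k) k + x y k      ≈⟨ +-cong (lc-* a v X k) (x-kills-E {y} y∈E k) ⟩
    a * x v k + 0#                   ≈⟨ +-identityʳ (a * x v k) ⟩
    a * x v k                        ∎

  -- Preimages of e_1,...,e_p; the index p + k + 1 stays within N because p ≤ s. The default 0
  -- beyond p is harmless, as vectors of im(x) vanish in those coordinates.
  L : Vector (Vector ℂ N) N
  L k = if does (toℕ k ℕ.<? p) then e (suc (p ℕ.+ toℕ k)) else 0ᵥ

  lift : Vector ℂ N → Vector ℂ N
  lift u = linearCombination u L

  x-L : ∀ k → toℕ k < p → x (L k) ≈ᵥ e (pos k)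
  x-L k k<p j = begin
    x (L k) j
      ≈⟨ reflexive (≡.cong (λ b → x (if b then e (suc (p ℕ.+ toℕ k)) else 0ᵥ) j)
          (dec-true (toℕ k ℕ.<? p) k<p)) ⟩
    x (e (suc (p ℕ.+ toℕ k))) j
      ≈⟨ reflexive (≡.cong (λ m → x (e (suc m)) j) (≡.sym toℕ-m)) ⟩
    x (e (pos m)) j
      ≈⟨ lc-e m X j ⟩
    x-basis (suc (toℕ m)) j
      ≈⟨ reflexive (≡.cong (λ m → x-basis (suc m) j) toℕ-m) ⟩
    x-basis (suc (p ℕ.+ toℕ k)) j
      ≈⟨ reflexive (≡.cong (λ b → b j) (x-basis-on (s≤s (ℕ.m≤m+n p (toℕ k))) (ℕ.+-monoʳ-< p k<p))) ⟩
    e (suc (p ℕ.+ toℕ k) ∸ p) j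
      ≈⟨ reflexive (≡.cong (λ m → e m j)
          (≡.trans (≡.cong (_∸ p) (≡.sym (ℕ.+-suc p (toℕ k)))) (ℕ.m+n∸m≡n p (suc (toℕ k))))) ⟩
    e (pos k) j ∎
    where
    m<N : p ℕ.+ toℕ k < N
    m<N = ℕ.+-monoʳ-< p (ℕ.<-≤-trans k<p p≤s)
    m = fromℕ< m<N
    toℕ-m = Fin.toℕ-fromℕ< m<N

  x-lift : ∀ {u} → E u → x (lift u) ≈ᵥ u
  x-lift {u} u∈E j = begin
    x (lift u) j
      ≈⟨ lc-lc u L X j ⟩
    sum (λ k → u k * x (L k) j)
      ≈⟨ sum-cong-≋ term ⟩
    sum (λ k → u k * e (pos k) j)
      ≈⟨ standard-expansion u j ⟨
    u j ∎
    where
    term : ∀ k → u k * x (L k) j ≈ u k * e (pos k) j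
    term k = by-cases (toℕ k ℕ.<? p)
      where
      by-cases : Dec (toℕ k < p) → u k * x (L k) j ≈ u k * e (pos k) j
      by-cases (yes k<p) = *-congˡ {u k} (x-L k k<p j)
      by-cases (no k≮p) = ≈-trans (vanish (x (L k) j)) (≈-sym (vanish (e (pos k) j)))
        where
        vanish : ∀ a → u k * a ≈ 0#
        vanish a = ≈-trans (*-congʳ {a} (u∈E k (ℕ.≮⇒≥ k≮p))) (zeroˡ a)

  E⇒im-x : E ⊆ im-x
  E⇒im-x {u} u∈E = lift u , λ k → ≈-sym (x-lift {u} u∈E k)

-- Flags, frames and membership as polynomial equations

module Flags (em : ∀ {ℓ} → ExcludedMiddle ℓ) where

  open LinearAlgebra em ℂ-commutativeRing (ℂ-isField em)
    hiding (_≈ᵥ_; linearCombination; LinearlyIndependent; Span; HasDim)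
  open Prefixes em ℂ-commutativeRing (ℂ-isField em)

  private
    variable
      n N : ℕ

  space-isSubspace : ∀ (V : Flag n N) j → IsSubspace (space V j)
  space-isSubspace V j = hasDim-isSubspace (dim V j)

  space-mono : ∀ (V : Flag n N) {i j} → i Fin.≤ j → space V i ⊆ space V j
  space-mono V {i} i≤j = Fin.<-weakInduction-startingFrom (λ j → space V i ⊆ space V j)
    (λ v∈ → v∈) (λ j Vi⊆Vj v∈ → nested V j (Vi⊆Vj v∈)) i≤j

  frame∈space : ∀ {V : Flag n N} {A} → IsFrame A V → ∀ {j l} → toℕ l < toℕ j → space V j (A l)
  frame∈space {A = A} (_ , spans) {j} {l} l<j = proj₂ (spans j) (∈prefix A j l<j)

  space⊆ : ∀ {V : Flag n N} {A U} → IsFrame A V → ∀ {j} → IsSubspace U →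
    (∀ l → toℕ l < toℕ j → U (A l)) → space V j ⊆ U
  space⊆ {A = A} {U} (_ , spans) {j} U-sub A∈ v∈ = prefix⊆ {U = U} {A} {j} U-sub A∈ (proj₁ (spans j) v∈)

  -- Each step of the flag raises the dimension by one, so it offers a vector outside the previous
  -- space; these vectors are independent by `chain-independent`.
  frame-exists : ∀ (V : Flag n N) → ∃ λ A → IsFrame A V
  frame-exists {n} {N} V = A , A-independent , λ j →
    (λ v∈ → hasDim-spans {U = space V j} {u = λ l → A (inject! {i = j} l)} (dim V j)
      (independent-∘ A-independent (Fin.inject!-injective {i = j}))
      (λ l → A∈ j (inject! {i = j} l) (Fin.inject!-< {i = j} l)) v∈) ,
    prefix⊆ {U = space V j} {A} {j} (space-isSubspace V j) (A∈ j)
    where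
    new : ∀ l → ∃ λ v → space V (suc l) v × ¬ space V (inject₁ l) v
    new l = hasDim-new {U = space V (inject₁ l)} {W = space V (suc l)}
      (≡.subst (HasDim (space V (inject₁ l))) (Fin.toℕ-inject₁ l) (dim V (inject₁ l))) (dim V (suc l))
    A : Vector (Vector ℂ N) n
    A l = proj₁ (new l)
    A∈ : ∀ j l → toℕ l < toℕ j → space V j (A l)
    A∈ j l l<j = space-mono V {suc l} {j} l<j (proj₁ (proj₂ (new l)))
    A-independent : LinearlyIndependent A
    A-independent = chain-independent {U = space V} {A} (space-isSubspace V) (space-mono V)
      (λ l → proj₁ (proj₂ (new l))) (λ l → proj₂ (proj₂ (new l)))

  flag : (A : Vector (Vector ℂ N) n) → LinearlyIndependent A → Flag n N
  flag A indep = record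
    { space  = Prefix A
    ; nested = λ j → prefix-mono A {inject₁ j} {suc j}
        (≡.subst (_≤ suc (toℕ j)) (≡.sym (Fin.toℕ-inject₁ j)) (ℕ.n≤1+n (toℕ j)))
    ; dim    = prefix-hasDim indep
    }

  flag-isFrame : ∀ (A : Vector (Vector ℂ N) n) indep → IsFrame A (flag A indep)
  flag-isFrame A indep = indep , λ j → (λ v∈ → v∈) , (λ v∈ → v∈)

  -- A vector lies in V_j iff putting it in front of the independent A_1,...,A_j gives a dependent
  -- family, that is, iff all pivot products of that family vanish. They play the part of the
  -- maximal minors.
  membership : ∀ (j : Fin (suc n)) → Vector (Polynomial (Fin n × Fin N)) N →
    Vector (Fin N) (suc (toℕ j)) → Polynomial (Fin n × Fin N)
  membership j v κ = Formal.pivotProduct κ (v ∷ λ l → matrix (inject! {i = j} l))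

  membership⇔ : ∀ {V : Flag n N} {A} → IsFrame A V → ∀ j (v : Vector (Polynomial (Fin n × Fin N)) N) v′ →
    (∀ k → ⟦ v k ⟧ (entries A) ≡ v′ k) →
    space V j v′ ⇔ (∀ κ → ⟦ membership j v κ ⟧ (entries A) ≈ 0#)
  membership⇔ {n} {N} {V} {A} (indep , spans) j v v′ v≡ = mk⇔ to from
    where
    B : Vector (Vector ℂ N) (toℕ j)
    B l = A (inject! {i = j} l)
    evaluated : ∀ κ → ⟦ membership j v κ ⟧ (entries A) ≡ Numeric.pivotProduct κ (v′ ∷ B)
    evaluated κ = ⟦pivotProduct⟧ κ (v ∷ λ l → matrix (inject! {i = j} l)) {v′ ∷ B}
      λ { zero k → v≡ k ; (suc l) k → refl }
    to : space V j v′ → ∀ κ → ⟦ membership j v κ ⟧ (entries A) ≈ 0#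
    to v∈ κ = decidable-stable em λ p≉0 → ¬independent-∷ {u = B} {v′} (proj₁ (spans j) v∈)
      (pivots⇒independent κ (v′ ∷ B) λ p≈0 → p≉0 (≈-trans (reflexive (evaluated κ)) p≈0))
    from : (∀ κ → ⟦ membership j v κ ⟧ (entries A) ≈ 0#) → space V j v′
    from p≈0 = proj₂ (spans j) (decidable-stable em λ v∉ →
      let κ , p≉0 = independent⇒pivots (v′ ∷ B) (independent-∷ {u = B} {v′}
            (independent-∘ indep (Fin.inject!-injective {i = j})) v∉)
      in p≉0 (≈-trans (reflexive (≡.sym (evaluated κ))) (p≈0 κ)))

-- The description of the component

module Component (em : ∀ {ℓ} → ExcludedMiddle ℓ) (p s : ℕ) (1≤p : 1 ≤ p) (p≤s : p ≤ s) (i : Fin (suc p)) where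

  open ΔSpringer (suc p) s
  open Coordinates em
  open LinearAlgebra em ℂ-commutativeRing (ℂ-isField em)
    hiding (_≈ᵥ_; linearCombination; LinearlyIndependent; Span; HasDim)
  open PolynomialFunctions em ℂ-commutativeRing (ℂ-isField em)
  open Prefixes em ℂ-commutativeRing (ℂ-isField em)
  open Flags em
  open Operator em p s 1≤p p≤s
  open Permutation p s 1≤p p≤s i
  open import Relation.Binary.Reasoning.Setoid setoid

  Sandwiched : Pred (Flag (suc p) N) 0ℓ
  Sandwiched V = space V (inject₁ i) ⊆ im-x
               × im-x ⊆ space V (fromℕ (suc p))
               × space V (fromℕ (suc p)) ⊆ x ⊢ space V (inject₁ i)

  <inject₁ : ∀ {l : Fin (suc p)} → toℕ l < toℕ i → toℕ l < toℕ (inject₁ i)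
  <inject₁ {l} = ≡.subst (toℕ l <_) (≡.sym (Fin.toℕ-inject₁ i))

  inject₁< : ∀ {l : Fin (suc p)} → toℕ l < toℕ (inject₁ i) → toℕ l < toℕ i
  inject₁< {l} = ≡.subst (toℕ l <_) (Fin.toℕ-inject₁ i)

  <top : ∀ (l : Fin (suc p)) → toℕ l < toℕ (fromℕ (suc p))
  <top l = ≡.subst (toℕ l <_) (≡.sym (Fin.toℕ-fromℕ (suc p))) (Fin.toℕ<n l)

  e∈E : ∀ (m : Fin p) → E (e (pos m))
  e∈E m = span-e⇒supported p (∈span (λ (m : Fin p) → e {N} (pos m)) m)

  E⊆ : ∀ {U} → IsSubspace U → (∀ (m : Fin p) → U (e (pos m))) → E ⊆ U
  E⊆ {U} U-sub e∈U {v} v∈E = IsSubspace.span⊆ {U = U} U-sub {b = λ (m : Fin p) → e (pos m)} e∈U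
    {v} (supported⇒span-e p v∈E)

  preimage-isSubspace : ∀ {U} → IsSubspace U → IsSubspace (x ⊢ U)
  preimage-isSubspace {U} U-sub = record
    { resp = λ {v} {w} v≈w → resp {x v} {x w} (x-cong {v} {w} v≈w)
    ; 0∈   = resp {0ᵥ} {x 0ᵥ} (λ k → ≈-sym (lc-zeroˡ {c = 0ᵥ} X (λ _ → ≈-refl) k)) 0∈
    ; +∈   = λ {v} {w} v∈ w∈ → resp {λ k → x v k + x w k} {x (λ k → v k + w k)}
               (λ k → ≈-sym (lc-+ v w X k)) (+∈ {x v} {x w} v∈ w∈)
    ; *∈   = λ a {v} v∈ → resp {λ k → a * x v k} {x (λ k → a * v k)}
               (λ k → ≈-sym (lc-* a v X k)) (*∈ a {x v} v∈)
    }
    where open IsSubspace U-sub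

  formal-x : Fin (suc p) → Vector (Polynomial (Fin (suc p) × Fin N)) N
  formal-x l k = formalSum λ m → var (l , m) :* con (x-basis (pos m) k)

  -- One constructor per inclusion. The first is linear because im(x) is a coordinate subspace; the
  -- other two are rank conditions, imposed on the basis vectors of im(x) and on the images x(A_l).
  data Equation : Pred (Polynomial (Fin (suc p) × Fin N)) 0ℓ where
    initialEq : ∀ {l k} → toℕ l < toℕ i → p ≤ toℕ k → Equation (var (l , k))
    imageEq     : ∀ (m : Fin p) κ → Equation (membership (fromℕ (suc p)) (λ k → con (e (pos m) k)) κ)
    topEq     : ∀ l κ → Equation (membership (inject₁ i) (formal-x l) κ)

  sandwiched-closed : ZariskiClosed Sandwiched
  sandwiched-closed = Equation , λ V A A-frame → mk⇔ (to V A A-frame) (from V A A-frame)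
    where
    module _ (V : Flag (suc p) N) (A : Vector (Vector ℂ N) (suc p)) (A-frame : IsFrame A V) where
      im⊆top⇔ : ∀ m → _
      im⊆top⇔ m = membership⇔ {V = V} {A} A-frame (fromℕ (suc p))
        (λ k → con (e (pos m) k)) (e (pos m)) (λ _ → refl)
      x-top⊆⇔ : ∀ l → _
      x-top⊆⇔ l = membership⇔ {V = V} {A} A-frame (inject₁ i) (formal-x l) (x (A l))
        (λ k → ⟦formalSum⟧ (λ m → var (l , m) :* con (x-basis (pos m) k)) (entries A))
      to : Sandwiched V → ∀ f → Equation f → ⟦ f ⟧ (entries A) ≈ 0#
      to (V⊆im , _ , _) _ (initialEq {l} {k} l<i p≤k) =
        im-x⇒E {A l} (V⊆im {A l} (frame∈space {V = V} {A} A-frame (<inject₁ l<i))) k p≤k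
      to (_ , im⊆V , _) _ (imageEq m κ) =
        Equivalence.to (im⊆top⇔ m) (im⊆V {e (pos m)} (E⇒im-x {e (pos m)} (e∈E m))) κ
      to (_ , _ , V⊆x⁻¹) _ (topEq l κ) =
        Equivalence.to (x-top⊆⇔ l) (V⊆x⁻¹ {A l} (frame∈space {V = V} {A} A-frame (<top l))) κ
      from : (∀ f → Equation f → ⟦ f ⟧ (entries A) ≈ 0#) → Sandwiched V
      from eqs =
        (λ {v} v∈ → E⇒im-x {v} (space⊆ {V = V} {A} {E} A-frame {inject₁ i} E-isSubspace
          (λ l l<i k p≤k → eqs _ (initialEq (inject₁< l<i) p≤k)) v∈)) ,
        (λ {v} v∈ → E⊆ {space V (fromℕ (suc p))} (space-isSubspace V (fromℕ (suc p)))
          (λ m → Equivalence.from (im⊆top⇔ m) λ κ → eqs _ (imageEq m κ)) {v} (im-x⇒E {v} v∈)) ,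
        (λ {v} v∈ → space⊆ {V = V} {A} {x ⊢ space V (inject₁ i)} A-frame {fromℕ (suc p)}
          (preimage-isSubspace (space-isSubspace V (inject₁ i)))
          (λ l _ → Equivalence.from (x-top⊆⇔ l) λ κ → eqs _ (topEq l κ)) {v} v∈)

  cell⊆sandwiched : SchubertCell w⟨ i ⟩ ∩ Y ⊆ Sandwiched
  cell⊆sandwiched {V} (V∈cell , im⊆top , stable) = initial⊆ , (λ {v} → im⊆top {v}) , λ {z} → x-top {z}
    where
    initial = space V (inject₁ i)
    next = space V (suc i)
    top = space V (fromℕ (suc p))
    top-dim : HasDim top (suc p)
    top-dim = ≡.subst (HasDim top) (Fin.toℕ-fromℕ (suc p)) (dim V (fromℕ (suc p)))
    initial-dim : HasDim initial (toℕ i)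
    initial-dim = ≡.subst (HasDim initial) (Fin.toℕ-inject₁ i) (dim V (inject₁ i))
    -- Both cell conditions are used at m = p, where the coordinate subspace is im(x). V_{i-1} meets
    -- it in its full dimension i-1, hence lies in it; V_i meets it in the same dimension, hence
    -- exactly in V_{i-1}.
    initial∩-dim : HasDim (initial ∩ span-e p) (toℕ i)
    initial∩-dim = ≡.subst (HasDim (initial ∩ span-e p))
      (≡.trans (≡.cong (λ j → count w⟨ i ⟩ j p) (Fin.toℕ-inject₁ i)) count-before)
      (V∈cell (inject₁ i) p p≤N)
    next∩-dim : HasDim (next ∩ span-e p) (toℕ i)
    next∩-dim = ≡.subst (HasDim (next ∩ span-e p)) count-upto (V∈cell (suc i) p p≤N)
    initial⊆E : initial ⊆ E
    initial⊆E {v} v∈ = span-e⇒supported p {v}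
      (proj₂ (hasDim-⊇ {U = initial ∩ span-e p} {initial} initial∩-dim initial-dim proj₁ {v} v∈))
    initial⊆ : initial ⊆ im-x
    initial⊆ {v} v∈ = E⇒im-x {v} (initial⊆E {v} v∈)
    next∩E⊆initial : ∀ {v} → next v → E v → initial v
    next∩E⊆initial {v} v∈ v∈E = hasDim-⊇ {U = initial} {next ∩ span-e p} initial-dim next∩-dim
      (λ {v} v∈ → nested V i {v} v∈ , supported⇒span-e p {v} (initial⊆E {v} v∈))
      {v} (v∈ , supported⇒span-e p {v} v∈E)
    new : ∃ λ v → next v × ¬ (next ∩ span-e p) v
    new = hasDim-new {U = next ∩ span-e p} {next} next∩-dim (dim V (suc i))
    v = proj₁ new
    v∈next = proj₁ (proj₂ new)
    v∉E : ¬ E v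
    v∉E v∈E = proj₂ (proj₂ new) (v∈next , supported⇒span-e p {v} v∈E)
    -- Stability of V_i puts xv into V_i; being also in im(x), it lies in V_{i-1}. As V_n = im(x) +
    -- ⟨v⟩, this one vector decides the whole of x(V_n).
    x-top : top ⊆ x ⊢ initial
    x-top {z} z∈ =
      let a , y , y∈E , z≈ = hasDim-∷ {U = E} {top} E-hasDim top-dim
            (λ {y} y∈E → im⊆top {y} (E⇒im-x {y} y∈E))
            {v} (space-mono V {suc i} {fromℕ (suc p)} (<top i) {v} v∈next) v∉E {z} z∈
      in resp {λ k → a * x v k} {x z} (λ k → ≈-sym (x-combination {z} {v} {y} {a} y∈E z≈ k))
           (*∈ a {x v} (next∩E⊆initial {x v} (stable (suc i) {v} v∈next) (x∈E v)))
      where open IsSubspace (space-isSubspace V (inject₁ i))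

  -- The frames of the flags V with V_{i-1} ⊆ im(x) ⊆ V_n ⊆ x⁻¹V_{i-1}, before
  -- independence is imposed: V_n = im(x) + ⟨v⟩ with xv ∈ V_{i-1}.
  record Parametrised (A : Vector (Vector ℂ N) (suc p)) : Set where
    field
      u   : Vector (Vector ℂ N) (suc p)
      d   : Vector ℂ (suc p)
      v   : Vector ℂ N
      u∈E : ∀ l → E (u l)
      d≈0 : ∀ l → toℕ l < toℕ i → d l ≈ 0#
      A≈  : ∀ l → A l ≈ᵥ λ k → u l k + d l * v k
      xv∈ : Prefix u (inject₁ i) (x v)

  Decomposed : Vector ℂ N → Vector (Vector ℂ N) (suc p) → Fin (suc p) → Set
  Decomposed v A l = ∃ λ u → ∃ λ d → E u × (toℕ l < toℕ i → d ≈ 0#) × (A l ≈ᵥ λ k → u k + d * v k)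

  no-v-part : ∀ {a u : Vector ℂ N} {d} {v : Vector ℂ N} → a ≈ᵥ (λ k → u k + d * v k) → d ≈ 0# → a ≈ᵥ u
  no-v-part {a} {u} {d} {v} a≈ d≈0 k = begin
    a k              ≈⟨ a≈ k ⟩
    u k + d * v k    ≈⟨ +-congˡ {u k} (*-congʳ {v k} d≈0) ⟩
    u k + 0# * v k   ≈⟨ +-congˡ {u k} (zeroˡ (v k)) ⟩
    u k + 0#         ≈⟨ +-identityʳ (u k) ⟩
    u k              ∎

  -- For l < i the v-part is zero, so A_l and u_l agree. Membership of xv can therefore be moved
  -- from the frame to the u_l, whose coefficients are what the curve interpolates.
  parametrise : ∀ {A v} → (∀ l → Decomposed v A l) → Prefix A (inject₁ i) (x v) → Parametrised A
  parametrise {A} {v} split xv∈ = record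
    { u = u ; d = d ; v = v
    ; u∈E = λ l → proj₁ (proj₂ (proj₂ (split l)))
    ; d≈0 = d≈0
    ; A≈  = A≈
    ; xv∈ = prefix⊆ {U = Prefix u (inject₁ i)} {A} {inject₁ i} (prefix-isSubspace u (inject₁ i)) A∈ {x v} xv∈
    }
    where
    u : Vector (Vector ℂ N) (suc p)
    u l = proj₁ (split l)
    d : Vector ℂ (suc p)
    d l = proj₁ (proj₂ (split l))
    d≈0 : ∀ l → toℕ l < toℕ i → d l ≈ 0#
    d≈0 l = proj₁ (proj₂ (proj₂ (proj₂ (split l))))
    A≈ : ∀ l → A l ≈ᵥ λ k → u l k + d l * v k
    A≈ l = proj₂ (proj₂ (proj₂ (proj₂ (split l))))
    A∈ : ∀ l → toℕ l < toℕ (inject₁ i) → Prefix u (inject₁ i) (A l)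
    A∈ l l<i = IsSubspace.resp (prefix-isSubspace u (inject₁ i)) {u l} {A l}
      (λ k → ≈-sym (no-v-part {A l} {u l} {d l} {v} (A≈ l) (d≈0 l (inject₁< l<i)) k))
      (∈prefix u (inject₁ i) l<i)

  sandwiched⇒parametrised : ∀ {V A} → IsFrame A V → Sandwiched V → Parametrised A
  sandwiched⇒parametrised {V} {A} A-frame (initial⊆im , im⊆top , top⊆x⁻¹) =
    parametrise {A} {v} (λ l → split l (toℕ l ℕ.<? toℕ i))
      (proj₁ (proj₂ A-frame (inject₁ i)) {x v} (top⊆x⁻¹ {v} v∈top))
    where
    top = space V (fromℕ (suc p))
    top-dim : HasDim top (suc p)
    top-dim = ≡.subst (HasDim top) (Fin.toℕ-fromℕ (suc p)) (dim V (fromℕ (suc p)))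
    new : ∃ λ v → top v × ¬ E v
    new = hasDim-new {U = E} {top} E-hasDim top-dim
    v = proj₁ new
    v∈top = proj₁ (proj₂ new)
    split : ∀ l → Dec (toℕ l < toℕ i) → Decomposed v A l
    split l (yes l<i) = A l , 0# ,
      im-x⇒E {A l} (initial⊆im {A l} (frame∈space {V = V} {A} A-frame (<inject₁ l<i))) , (λ _ → ≈-refl) ,
      λ k → ≈-sym (≈-trans (+-congˡ {A l k} (zeroˡ (v k))) (+-identityʳ (A l k)))
    split l (no l≮i) =
      let a , y , y∈E , A≈ = hasDim-∷ {U = E} {top} E-hasDim top-dim
            (λ {y} y∈E → im⊆top {y} (E⇒im-x {y} y∈E)) {v} v∈top (proj₂ (proj₂ new))
            {A l} (frame∈space {V = V} {A} A-frame (<top l))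
      in y , a , y∈E , (λ l<i → contradiction l<i l≮i) ,
         λ k → ≈-trans (A≈ k) (+-comm (a * v k) (y k))

  module _ {A : Vector (Vector ℂ N) (suc p)} (P : Parametrised A)
           (A-independent : LinearlyIndependent A) (rows : Echelon pivot A) where

    open Parametrised P
    module R = Echelon rows

    top-basis : Vector (Vector ℂ N) (suc p)
    top-basis = v ∷ λ (m : Fin p) → e (pos m)

    Top : Pred (Vector ℂ N) 0ℓ
    Top = Span top-basis

    Top-isSubspace : IsSubspace Top
    Top-isSubspace = span-isSubspace top-basis

    E⊆Top : E ⊆ Top
    E⊆Top = E⊆ {Top} Top-isSubspace λ m → ∈span top-basis (suc m)

    Top-split : ∀ {z} → Top z → ∃ λ a → ∃ λ y → E y × z ≈ᵥ λ k → a * v k + y k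
    Top-split {z} (c , z≈) = c zero , linearCombination (c ∘ suc) (λ (m : Fin p) → e (pos m)) ,
      span-e⇒supported p (c ∘ suc , λ _ → ≈-refl) , z≈

    A∈Top : ∀ l → Top (A l)
    A∈Top l = resp {λ k → u l k + d l * v k} {A l} (λ k → ≈-sym (A≈ l k))
      (+∈ {u l} {λ k → d l * v k} (E⊆Top {u l} (u∈E l)) (*∈ (d l) {v} (∈span top-basis zero)))
      where open IsSubspace Top-isSubspace

    A≈u : ∀ l → toℕ l < toℕ i → A l ≈ᵥ u l
    A≈u l l<i = no-v-part {A l} {u l} {d l} {v} (A≈ l) (d≈0 l l<i)

    A∈E : ∀ l → toℕ l < toℕ i → E (A l)
    A∈E l l<i = IsSubspace.resp E-isSubspace {u l} {A l} (λ k → ≈-sym (A≈u l l<i k)) (u∈E l)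

    pivot-i≥p : p ≤ toℕ (pivot i)
    pivot-i≥p = ℕ.s≤s⁻¹ (≡.subst (p <_) (≡.trans (≡.sym w-at) (w≡pos-pivot i)) p<N)

    at-pivot-i : ∀ {z a y} → E y → z ≈ᵥ (λ k → a * v k + y k) → z (pivot i) ≈ a * v (pivot i)
    at-pivot-i {z} {a} {y} y∈E z≈ = ≈-trans (z≈ (pivot i)) (≈-trans
      (+-congˡ {a * v (pivot i)} (y∈E (pivot i) pivot-i≥p)) (+-identityʳ (a * v (pivot i))))

    row∈Top : ∀ l → Top (R.row l)
    row∈Top l = R.row∈ l Top-isSubspace λ l′ _ → A∈Top l′

    -- Column N vanishes on im(x), so the nonzero pivot of row i there can only come from its
    -- v-component.
    v-pivot≉0 : ¬ v (pivot i) ≈ 0#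
    v-pivot≉0 v≈0 =
      let a , y , y∈E , row≈ = Top-split {R.row i} (row∈Top i)
      in R.diag i (≈-trans (at-pivot-i {R.row i} {a} {y} y∈E row≈)
           (≈-trans (*-congˡ {a} v≈0) (zeroʳ a)))

    -- Rows before i involve only A_l with l < i, all in im(x). Rows after i have been cleared in
    -- column N, where v is nonzero, so their v-component is zero.
    row∈E : ∀ {l} → l ≢ i → E (R.row l)
    row∈E {l} l≢i with Fin.<-cmp l i
    ... | tri< l<i _ _ = R.row∈ l E-isSubspace λ l′ l′≤l → A∈E l′ (ℕ.≤-<-trans l′≤l l<i)
    ... | tri≈ _ l≡i _ = contradiction l≡i l≢i
    ... | tri> _ _ i<l =
      let a , y , y∈E , row≈ = Top-split {R.row l} (row∈Top l)
          a≈0 = *-cancel-0 {v (pivot i)} {a} (≈-trans (*-comm (v (pivot i)) a)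
            (≈-trans (≈-sym (at-pivot-i {R.row l} {a} {y} y∈E row≈)) (R.below i<l))) v-pivot≉0
      in IsSubspace.resp E-isSubspace {y} {R.row l} (λ k → ≈-sym (≈-trans (row≈ k)
           (≈-trans (+-congʳ {y k} (≈-trans (*-congʳ {v k} a≈0) (zeroˡ (v k)))) (+-identityˡ (y k))))) y∈E

    -- For l = i the pivot is the last column. For other rows, columns beyond p vanish because the
    -- row is in im(x), and the remaining columns to the right of the pivot are pivots of earlier
    -- rows.
    row-supported : ∀ l → SupportedBelow (pos (pivot l)) (R.row l)
    row-supported l k w≤k with l Fin.≟ i | toℕ k ℕ.<? p
    ... | yes refl | _ = contradiction (Fin.toℕ<n k)
      (ℕ.≤⇒≯ (≡.subst (_≤ toℕ k) (≡.trans (≡.sym (w≡pos-pivot i)) w-at) w≤k))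
    ... | no l≢i | no k≮p = row∈E l≢i k (ℕ.≮⇒≥ k≮p)
    ... | no l≢i | yes k<p =
      let l′ , l′<l , pivot≡k = pivot-hit {l} l≢i k (≡.subst (_≤ toℕ k) (≡.sym (w≡pos-pivot l)) w≤k) k<p
      in ≡.subst (λ k → R.row l k ≈ 0#) pivot≡k (R.below l′<l)

    flag∈cell : SchubertCell w⟨ i ⟩ (flag A A-independent)
    flag∈cell j m m≤N = hasDim-resp
      {U = Prefix A j ∩ SupportedBelow m} {Prefix A j ∩ span-e m}
      ((λ {z} (z∈ , z∈m) → z∈ , supported⇒span-e m {z} z∈m) ,
       (λ {z} (z∈ , z∈m) → z∈ , span-e⇒supported m {z} z∈m))
      (prefix∩supported-hasDim rows row-supported w⟨ i ⟩ w≡pos-pivot j m)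

    xv∈prefix : ∀ j → toℕ i ≤ toℕ j → Prefix A j (x v)
    xv∈prefix j i≤j = prefix⊆ {U = Prefix A j} {u} {inject₁ i} (prefix-isSubspace A j)
      (λ l l<i → IsSubspace.resp (prefix-isSubspace A j) {A l} {u l} (A≈u l (inject₁< l<i))
        (∈prefix A j (ℕ.<-≤-trans (inject₁< l<i) i≤j)))
      {x v} xv∈

    -- The n independent A_l lie in im(x) + ⟨v⟩, which has n generators, so they span it and V_n
    -- contains im(x). For stability, x kills V_j when j ≤ i-1, and otherwise x(V_j) lies in the
    -- line through xv, inside V_{i-1}.
    flag∈Y : Y (flag A A-independent)
    flag∈Y = (λ {z} z∈ → span⊆prefix {A = A} {fromℕ (suc p)} (≡.sym (Fin.toℕ-fromℕ (suc p))) {z}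
                (independent-spans {u = A} {top-basis} A-independent A∈Top {z} (E⊆Top {z} (im-x⇒E {z} z∈)))) ,
             λ j {z} → stable j {z} (toℕ j ℕ.≤? toℕ i)
      where
      stable : ∀ j {z} → Dec (toℕ j ≤ toℕ i) → Prefix A j z → Prefix A j (x z)
      stable j {z} (yes j≤i) z∈ = resp {0ᵥ} {x z} (λ k → ≈-sym (x-kills-E {z}
        (prefix⊆ {U = E} {A} {j} E-isSubspace (λ l l<j → A∈E l (ℕ.<-≤-trans l<j j≤i)) {z} z∈) k)) 0∈
        where open IsSubspace (prefix-isSubspace A j)
      stable j {z} (no j≰i) z∈ =
        let a , y , y∈E , z≈ = Top-split {z}
              (prefix⊆ {U = Top} {A} {j} Top-isSubspace (λ l _ → A∈Top l) {z} z∈)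
        in resp {λ k → a * x v k} {x z} (λ k → ≈-sym (x-combination {z} {v} {y} {a} y∈E z≈ k))
             (*∈ a {x v} (xv∈prefix j (ℕ.<⇒≤ (ℕ.≰⇒> j≰i))))
        where open IsSubspace (prefix-isSubspace A j)

  coordinateFrame : Vector (Vector ℂ N) (suc p)
  coordinateFrame l = e (w⟨ i ⟩ l)

  -- The frame is a partial permutation matrix: each pivot entry is 1, and distinctness of the w_l
  -- clears the rest of its column.
  coordinateFrame-pivots : ¬ Numeric.pivotProduct pivot coordinateFrame ≈ 0#
  coordinateFrame-pivots = triangular⇒pivots pivot coordinateFrame
    (λ l e≈0 → IsField.1≉0 (ℂ-isField em)
      (≈-trans (reflexive (≡.sym (e-on {k = pivot l} (≡.sym (w≡pos-pivot l))))) e≈0))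
    (λ {l} {l′} l<l′ → reflexive (e-off {k = pivot l} λ eq → w-distinct l<l′ (≡.trans (w≡pos-pivot l) eq)))

  x-e-N : x (e N) ≈ᵥ x-basis N
  x-e-N = ≡.subst (λ m → x (e m) ≈ᵥ x-basis m) (≡.trans (≡.sym (w≡pos-pivot i)) w-at) (lc-e (pivot i) X)

  -- Here admissibility enters, with v = e_N. If s > n-1 then N > 2n-2 and x e_N = 0. If s = n-1
  -- then x e_N = e_{n-1}, which is the first frame vector e_{w_1} and belongs to V_{i-1} because i
  -- ≥ 2.
  coordinateFrame-parametrised : Admissible i → Parametrised coordinateFrame
  coordinateFrame-parametrised admissible =
    parametrise {coordinateFrame} {e N} (λ l → split l (l Fin.≟ i)) (xv∈ admissible)
    where
    split : ∀ l → Dec (l ≡ i) → Decomposed (e N) coordinateFrame l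
    split l (yes refl) = 0ᵥ , 1# , (λ _ _ → ≈-refl) , (λ i<i → contradiction i<i (ℕ.<-irrefl refl)) , λ k →
      ≈-trans (reflexive (≡.cong (λ m → e m k) w-at))
        (≈-sym (≈-trans (+-identityˡ (1# * e N k)) (*-identityˡ (e N k))))
    split l (no l≢i) = e (w⟨ i ⟩ l) , 0# ,
      (λ k p≤k → reflexive (e-off {k = k} λ eq → ℕ.<⇒≱ (s≤s p≤k) (≡.subst (_≤ p) (≡.sym eq) (w≤p l l≢i)))) ,
      (λ _ → ≈-refl) ,
      λ k → ≈-sym (≈-trans (+-congˡ {e (w⟨ i ⟩ l) k} (zeroˡ (e N k))) (+-identityʳ (e (w⟨ i ⟩ l) k)))
    open IsSubspace (prefix-isSubspace coordinateFrame (inject₁ i))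
    xv∈ : Admissible i → Prefix coordinateFrame (inject₁ i) (x (e N))
    xv∈ (inj₁ p<s) = resp {0ᵥ} {x (e N)} (λ k → ≈-sym (≈-trans (x-e-N k)
      (reflexive (≡.cong (λ b → b k) (x-basis-off (inj₂ (ℕ.+-monoʳ-< p p<s))))))) 0∈
    xv∈ (inj₂ (s≡p , 2≤i)) = resp {e (w⟨ i ⟩ zero)} {x (e N)}
      (λ k → ≈-sym (≈-trans (x-e-N k) (≈-trans
        (reflexive (≡.cong (λ b → b k) (x-basis-on p<N (ℕ.≤-reflexive (≡.cong (p ℕ.+_) s≡p)))))
        (reflexive (≡.cong (λ m → e m k) (≡.trans (ℕ.m+n∸m≡n p s) (≡.trans s≡p (≡.sym w₀≡p))))))))
      (∈prefix coordinateFrame (inject₁ i) {zero} (<inject₁ {zero} 0<i))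
      where
      0<i : 0 < toℕ i
      0<i = ℕ.s≤s⁻¹ 2≤i
      w₀≡p : w⟨ i ⟩ zero ≡ p
      w₀≡p = ≡.trans (≡.sym (ℕ.+-identityʳ (w⟨ i ⟩ zero))) (w-before {zero} 0<i)

  -- The component of v in ker(x) complementary to `lift (x v)`. Splitting it off lets xv be
  -- prescribed independently of the rest of v.
  residue : Vector ℂ N → Vector ℂ N
  residue v k = v k + - 1# * lift (x v) k

  -- `SupportedBelow 0` is the zero subspace, so ker(x) inherits its closure properties as a
  -- preimage.
  Kernel : Pred (Vector ℂ N) 0ℓ
  Kernel = x ⊢ SupportedBelow 0

  Kernel-isSubspace : IsSubspace Kernel
  Kernel-isSubspace = preimage-isSubspace {SupportedBelow 0} (supportedBelow-isSubspace 0)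

  residue∈Kernel : ∀ v → Kernel (residue v)
  residue∈Kernel v k _ = begin
    x (residue v) k                              ≈⟨ lc-+ v (λ k → - 1# * lift (x v) k) X k ⟩
    x v k + x (λ k → - 1# * lift (x v) k) k      ≈⟨ +-congˡ {x v k} (lc-* (- 1#) (lift (x v)) X k) ⟩
    x v k + - 1# * x (lift (x v)) k              ≈⟨ +-congˡ {x v k} (*-congˡ { - 1#} (x-lift {x v} (x∈E v) k)) ⟩
    x v k + - 1# * x v k                         ≈⟨ x+-1x≈0 (x v k) ⟩
    0#                                           ∎

  lift+residue : ∀ v k → lift (x v) k + residue v k ≈ v k
  lift+residue v k = begin
    lift (x v) k + (v k + - 1# * lift (x v) k)  ≈⟨ +-congˡ {lift (x v) k} (+-comm (v k) (- 1# * lift (x v) k)) ⟩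
    lift (x v) k + (- 1# * lift (x v) k + v k)  ≈⟨ +-assoc (lift (x v) k) (- 1# * lift (x v) k) (v k) ⟨
    lift (x v) k + - 1# * lift (x v) k + v k    ≈⟨ +-congʳ {v k} (x+-1x≈0 (lift (x v) k)) ⟩
    0# + v k                                    ≈⟨ +-identityˡ (v k) ⟩
    v k                                         ∎

  lineᵥ : ∀ {n} → ℂ → Vector ℂ n → Vector ℂ n → Vector ℂ n
  lineᵥ t v w k = line t (v k) (w k)

  line∈ : ∀ {n} {U : Pred (Vector ℂ n) 0ℓ} → IsSubspace U → ∀ t {v w} → U v → U w → U (lineᵥ t v w)
  line∈ U-sub t {v} {w} v∈ w∈ = +∈ {λ k → (1# + - 1# * t) * v k} {λ k → t * w k}
    (*∈ (1# + - 1# * t) {v} v∈) (*∈ t {w} w∈)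
    where open IsSubspace U-sub

  -- A polynomial curve inside the parametrised tuples: u, d and the
  -- coefficients of xv move linearly, and v follows them.
  module Curve {A₀ A₁ : Vector (Vector ℂ N) (suc p)} (P₀ : Parametrised A₀) (P₁ : Parametrised A₁) where

    module P₀ = Parametrised P₀
    module P₁ = Parametrised P₁

    u : ℂ → Vector (Vector ℂ N) (suc p)
    u t l = lineᵥ t (P₀.u l) (P₁.u l)

    initial-u : ℂ → Vector (Vector ℂ N) (toℕ (inject₁ i))
    initial-u t l = u t (inject! {i = inject₁ i} l)

    d : ℂ → Vector ℂ (suc p)
    d t = lineᵥ t P₀.d P₁.d

    c : ℂ → Vector ℂ (toℕ (inject₁ i))
    c t = lineᵥ t (proj₁ P₀.xv∈) (proj₁ P₁.xv∈)

    image : ℂ → Vector ℂ N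
    image t = linearCombination (c t) (initial-u t)

    kernelPart : ℂ → Vector ℂ N
    kernelPart t = lineᵥ t (residue P₀.v) (residue P₁.v)

    v : ℂ → Vector ℂ N
    v t k = lift (image t) k + kernelPart t k

    -- The entries have degree at most three in t: `image` is quadratic, as a product of moving
    -- coefficients and moving vectors, and `d` adds one more factor.
    curve : ℂ → Vector (Vector ℂ N) (suc p)
    curve t l k = u t l k + d t l * v t k

    u∈E : ∀ t l → E (u t l)
    u∈E t l = line∈ {U = E} E-isSubspace t {P₀.u l} {P₁.u l} (P₀.u∈E l) (P₁.u∈E l)

    image∈E : ∀ t → E (image t)
    image∈E t = IsSubspace.span⊆ {U = E} E-isSubspace {b = initial-u t}
      (λ l → u∈E t (inject! {i = inject₁ i} l)) {image t} (c t , λ _ → ≈-refl)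

    x-v : ∀ t → x (v t) ≈ᵥ image t
    x-v t k = begin
      x (v t) k                                ≈⟨ lc-+ (lift (image t)) (kernelPart t) X k ⟩
      x (lift (image t)) k + x (kernelPart t) k
        ≈⟨ +-cong (x-lift {image t} (image∈E t) k)
             (line∈ {U = Kernel} Kernel-isSubspace t {residue P₀.v} {residue P₁.v}
               (residue∈Kernel P₀.v) (residue∈Kernel P₁.v) k z≤n) ⟩
      image t k + 0#                           ≈⟨ +-identityʳ (image t k) ⟩
      image t k                                ∎

    curve-parametrised : ∀ t → Parametrised (curve t)
    curve-parametrised t = record
      { u   = u t
      ; d   = d t
      ; v   = v t
      ; u∈E = u∈E t
      ; d≈0 = λ l l<i → ≈-trans (+-cong
          (≈-trans (*-congˡ {1# + - 1# * t} (P₀.d≈0 l l<i)) (zeroʳ (1# + - 1# * t)))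
          (≈-trans (*-congˡ {t} (P₁.d≈0 l l<i)) (zeroʳ t))) (+-identityˡ 0#)
      ; A≈  = λ _ _ → ≈-refl
      ; xv∈ = c t , x-v t
      }

    curve-isPolynomial : ∀ l k → IsPolynomial (λ t → curve t l k)
    curve-isPolynomial l k = +-isPolynomial (u-isPolynomial l k)
      (*-isPolynomial (line-isPolynomial (P₀.d l) (P₁.d l))
        (+-isPolynomial
          (sum-isPolynomial (λ t m → image t m * L m k) λ m →
            *-isPolynomial (image-isPolynomial m) (const-isPolynomial (L m k)))
          (line-isPolynomial (residue P₀.v k) (residue P₁.v k))))
      where
      u-isPolynomial : ∀ l k → IsPolynomial (λ t → u t l k)
      u-isPolynomial l k = line-isPolynomial (P₀.u l k) (P₁.u l k)
      image-isPolynomial : ∀ m → IsPolynomial (λ t → image t m)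
      image-isPolynomial m = sum-isPolynomial (λ t l → c t l * initial-u t l m) λ l →
        *-isPolynomial (line-isPolynomial (proj₁ P₀.xv∈ l) (proj₁ P₁.xv∈ l))
          (u-isPolynomial (inject! {i = inject₁ i} l) m)

    -- Where the parameters agree with those of `P`, `image` equals xv by the stored coefficients,
    -- and `lift+residue` then gives back v itself.
    endpoint : ∀ {A} (P : Parametrised A) t →
      let open Parametrised P using () renaming (u to u′; d to d′; v to v′; xv∈ to xv′∈) in
      (∀ l → u t l ≈ᵥ u′ l) → d t ≈ᵥ d′ → c t ≈ᵥ proj₁ xv′∈ → kernelPart t ≈ᵥ residue v′ →
      ∀ l → curve t l ≈ᵥ A l
    endpoint {A} P t u≈ d≈ c≈ kernel≈ l k = begin
      u t l k + d t l * v t k   ≈⟨ +-cong (u≈ l k) (*-cong (d≈ l) (v≈ k)) ⟩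
      P.u l k + P.d l * P.v k   ≈⟨ P.A≈ l k ⟨
      A l k                     ∎
      where
      module P = Parametrised P
      image≈ : image t ≈ᵥ x P.v
      image≈ k = ≈-trans
        (lc-cong {c = c t} {proj₁ P.xv∈} {initial-u t} {λ l → P.u (inject! {i = inject₁ i} l)} c≈
          (λ l → u≈ (inject! {i = inject₁ i} l)) k)
        (≈-sym (proj₂ P.xv∈ k))
      v≈ : v t ≈ᵥ P.v
      v≈ k = ≈-trans (+-cong (lc-cong {c = image t} {x P.v} {L} {L} image≈ (λ _ _ → ≈-refl) k) (kernel≈ k))
        (lift+residue P.v k)

    curve-0 : ∀ l → curve 0# l ≈ᵥ A₀ l
    curve-0 = endpoint P₀ 0# (λ l k → line-0 (P₀.u l k) (P₁.u l k)) (λ l → line-0 (P₀.d l) (P₁.d l))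
      (λ l → line-0 (proj₁ P₀.xv∈ l) (proj₁ P₁.xv∈ l)) (λ k → line-0 (residue P₀.v k) (residue P₁.v k))

    curve-1 : ∀ l → curve 1# l ≈ᵥ A₁ l
    curve-1 = endpoint P₁ 1# (λ l k → line-1 (P₀.u l k) (P₁.u l k)) (λ l → line-1 (P₀.d l) (P₁.d l))
      (λ l → line-1 (proj₁ P₀.xv∈ l) (proj₁ P₁.xv∈ l)) (λ k → line-1 (residue P₀.v k) (residue P₁.v k))

    -- Along the curve f and g become polynomials in t. As g is nonzero at t = 0, f vanishes for all
    -- t by `vanishing-on-open`, in particular at t = 1.
    vanishing-at-end : ∀ f g → ¬ ⟦ g ⟧ (entries A₀) ≈ 0# →
      (∀ B → Parametrised B → ¬ ⟦ g ⟧ (entries B) ≈ 0# → ⟦ f ⟧ (entries B) ≈ 0#) →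
      ⟦ f ⟧ (entries A₁) ≈ 0#
    vanishing-at-end f g g≉0 f≈0 = ≈-trans
      (⟦⟧-cong f {entries A₁} {entries (curve 1#)} λ (l , k) → ≈-sym (curve-1 l k))
      (vanishing-on-open natℂ natℂ-injective
        {λ t → ⟦ f ⟧ (entries (curve t))} {λ t → ⟦ g ⟧ (entries (curve t))}
        (⟦⟧-isPolynomial f {λ t → entries (curve t)} λ (l , k) → curve-isPolynomial l k)
        (⟦⟧-isPolynomial g {λ t → entries (curve t)} λ (l , k) → curve-isPolynomial l k)
        (0# , λ g≈0 → g≉0 (≈-trans
          (⟦⟧-cong g {entries A₀} {entries (curve 0#)} λ (l , k) → ≈-sym (curve-0 l k)) g≈0))
        (λ t → f≈0 (curve t) (curve-parametrised t))
        1#)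

  -- Up to V_{i-1} the spaces lie in im(x), which x kills; from V_i on they contain V_{i-1}, into
  -- which x maps all of V_n.
  sandwiched⊆Y : Sandwiched ⊆ Y
  sandwiched⊆Y {V} (initial⊆im , im⊆top , top⊆x⁻¹) =
    (λ {z} → im⊆top {z}) , λ j {z} → stable j {z} (toℕ j ℕ.≤? toℕ i)
    where
    stable : ∀ j {z} → Dec (toℕ j ≤ toℕ i) → space V j z → space V j (x z)
    stable j {z} (yes j≤i) z∈ = resp {0ᵥ} {x z} (λ k → ≈-sym (x-kills-E {z} (im-x⇒E {z} (initial⊆im {z}
      (space-mono V {j} {inject₁ i} (≡.subst (toℕ j ≤_) (≡.sym (Fin.toℕ-inject₁ i)) j≤i) {z} z∈))) k)) 0∈
      where open IsSubspace (space-isSubspace V j)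
    stable j {z} (no j≰i) z∈ = space-mono V {inject₁ i} {j}
      (≡.subst (_≤ toℕ j) (≡.sym (Fin.toℕ-inject₁ i)) (ℕ.<⇒≤ (ℕ.≰⇒> j≰i))) {x z}
      (top⊆x⁻¹ {z} (space-mono V {j} {fromℕ (suc p)} (Fin.≤fromℕ j) {z} z∈))

  pivotPolynomial : Polynomial (Fin (suc p) × Fin N)
  pivotPolynomial = Formal.pivotProduct pivot matrix

  ⟦pivotPolynomial⟧ : ∀ B → ⟦ pivotPolynomial ⟧ (entries B) ≡ Numeric.pivotProduct pivot B
  ⟦pivotPolynomial⟧ B = ⟦pivotProduct⟧ pivot matrix {B} λ _ _ → refl

  generic-flag : ∀ B → Parametrised B → ¬ ⟦ pivotPolynomial ⟧ (entries B) ≈ 0# →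
    ∃ λ V → IsFrame B V × (SchubertCell w⟨ i ⟩ ∩ Y) V
  generic-flag B P nonzero =
    flag B indep , flag-isFrame B indep , flag∈cell P indep rows , flag∈Y P indep rows
    where
    pivots : ¬ Numeric.pivotProduct pivot B ≈ 0#
    pivots p≈0 = nonzero (≈-trans (reflexive (⟦pivotPolynomial⟧ B)) p≈0)
    indep : LinearlyIndependent B
    indep = pivots⇒independent pivot B pivots
    rows : Echelon pivot B
    rows = echelon pivot B pivots

  coordinateFrame-generic : ¬ ⟦ pivotPolynomial ⟧ (entries coordinateFrame) ≈ 0#
  coordinateFrame-generic p≈0 = coordinateFrame-pivots
    (≈-trans (reflexive (≡.sym (⟦pivotPolynomial⟧ coordinateFrame))) p≈0)

  sandwiched⊆K : Admissible i → Sandwiched ⊆ K i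
  sandwiched⊆K admissible {V} V∈ = sandwiched⊆Y {V} V∈ , λ Z (F , Z⇔F) cell⊆Z →
    Equivalence.from (Z⇔F V A A-frame) λ f f∈F →
      -- The curve runs from the coordinate frame, where the pivot polynomial is nonzero, to a frame
      -- of `V`. Wherever that polynomial is nonzero the tuple frames a flag of the cell, hence of
      -- `Z`, and each equation `f` of `Z` vanishes on it.
      vanishing-at-end (coordinateFrame-parametrised admissible) (sandwiched⇒parametrised {V} {A} A-frame V∈)
        f pivotPolynomial coordinateFrame-generic λ B P nonzero →
          let W , B-frame , W∈ = generic-flag B P nonzero
          in Equivalence.to (Z⇔F W B B-frame) (cell⊆Z {W} W∈) f f∈F
    where
    open Curve using (vanishing-at-end)
    A = proj₁ (frame-exists V)
    A-frame = proj₂ (frame-exists V)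

theorem3p1 : (∀ {ℓ} → ExcludedMiddle ℓ) →
    ∀ (n s : ℕ) → 2 ≤ n → n ∸ 1 ≤ s →
    let open ΔSpringer n s in
    ∀ (i : Fin n) → Admissible i →
    K i ≐ λ V → space V (inject₁ i) ⊆ im-x
    × im-x ⊆ space V (fromℕ n)
    × space V (fromℕ n) ⊆ x ⊢ space V (inject₁ i)
theorem3p1 em (suc p) s (s≤s 1≤p) p≤s i admissible =
  -- The sandwich condition is itself one of the closed sets containing the cell over which the
  -- closure quantifies.
  (λ {V} (_ , closed) → closed Sandwiched sandwiched-closed (λ {W} → cell⊆sandwiched {W})) ,
  λ {V} → sandwiched⊆K admissible {V}
  where
  open Component em p s 1≤p p≤s i
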